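{- Let $D\geq 1$ be an integer. Every $(D,\mathrm{F})$-critical multigraph $G$ with $|V(G)|\geq 3$ satisfies $|E(G)|\geq \frac{(4D+3)|V(G)|+2}{2(D+1)}$.
   Context: All multigraphs are loopless; edges are counted with multiplicity. A forest is an acyclic multigraph, where a pair of parallel edges counts as a cycle. A $(D,\mathrm{F})$-coloring of a multigraph $G$ is a partition $(M,F)$ of $V(G)$ such that $G[M]$ is a forest with maximum degree at most $D$ and $G[F]$ is a forest. A multigraph is $(D,\mathrm{F})$-critical if it has no $(D,\mathrm{F})$-coloring but every proper subgraph of it has one. -}

module Defs where

open import Data.Nat using (ℕ; suc; _≤_; _*_; _+_)
open import Data.Fin using (Fin; zero; suc; inject₁; fromℕ; _≟_)
open import Data.Fin.Base using ()
open import Data.Bool using (Bool; true; false; _∧_; _∨_; T)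
open import Data.Bool.Properties using (T?)
open import Data.List using (List; filter; length; allFin)
open import Data.Product using (Σ; _×_; _,_; proj₁; proj₂; ∃)
open import Data.Sum using (_⊎_)
open import Relation.Nullary using (¬_)
open import Relation.Nullary.Decidable using (⌊_⌋)
open import Relation.Binary.PropositionalEquality using (_≡_; _≢_)
open import Function.Definitions using (Injective)

record Multigraph : Set where
  field
    n : ℕ
    m : ℕ
    ends : Fin m → Fin n × Fin n
    loopless : ∀ e → proj₁ (ends e) ≢ proj₂ (ends e)
open Multigraph public

Joins : (G : Multigraph) → Fin (m G) → Fin (n G) → Fin (n G) → Set
Joins G e x y =
  (proj₁ (ends G e) ≡ x × proj₂ (ends G e) ≡ y) ⊎
  (proj₁ (ends G e) ≡ y × proj₂ (ends G e) ≡ x)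

EdgeSet : Multigraph → Set
EdgeSet G = Fin (m G) → Bool

VertexSet : Multigraph → Set
VertexSet G = Fin (n G) → Bool

-- A cycle in the sub-multigraph with edge set P: a closed walk
-- v₀ e₀ v₁ … e_{k-1} v_k = v₀ with k ≥ 2, pairwise distinct edges, pairwise
-- distinct vertices v₀ … v_{k-1}, all edges in P.  (k = 2: parallel edges.)
record Cycle (G : Multigraph) (P : EdgeSet G) : Set where
  field
    k : ℕ
    k≥2 : 2 ≤ k
    vtx : Fin (suc k) → Fin (n G)
    edg : Fin k → Fin (m G)
    closed : vtx (fromℕ k) ≡ vtx zero
    joins : ∀ i → Joins G (edg i) (vtx (inject₁ i)) (vtx (suc i))
    inP : ∀ i → P (edg i) ≡ true
    edg-inj : Injective _≡_ _≡_ edg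
    vtx-inj : Injective _≡_ _≡_ (λ i → vtx (inject₁ i))

IsForest : (G : Multigraph) → EdgeSet G → Set
IsForest G P = ¬ Cycle G P

incident : (G : Multigraph) → Fin (m G) → Fin (n G) → Bool
incident G e v = ⌊ proj₁ (ends G e) ≟ v ⌋ ∨ ⌊ proj₂ (ends G e) ≟ v ⌋

degree : (G : Multigraph) → EdgeSet G → Fin (n G) → ℕ
degree G P v = length (filter (λ e → T? (P e ∧ incident G e v)) (allFin (m G)))

induced : (G : Multigraph) → VertexSet G → EdgeSet G → VertexSet G → EdgeSet G
induced G VS ES c e =
  ES e ∧ VS (proj₁ (ends G e)) ∧ VS (proj₂ (ends G e))
       ∧ c (proj₁ (ends G e)) ∧ c (proj₂ (ends G e))

not : Bool → Bool
not true = false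
not false = true

-- (D,F)-colouring of the subgraph H = (VS , ES) of G: a partition (M , F) of
-- VS, given by c (c v = true ↔ v ∈ M), with H[M] a forest of max degree ≤ D
-- and H[F] a forest.
DFColoring : ℕ → (G : Multigraph) → VertexSet G → EdgeSet G → Set
DFColoring D G VS ES =
  Σ (VertexSet G) λ c →
    IsForest G (induced G VS ES c) ×
    (∀ v → VS v ≡ true → c v ≡ true → degree G (induced G VS ES c) v ≤ D) ×
    IsForest G (induced G VS ES (λ v → not (c v)))

IsSubgraph : (G : Multigraph) → VertexSet G → EdgeSet G → Set
IsSubgraph G VS ES =
  ∀ e → ES e ≡ true → VS (proj₁ (ends G e)) ≡ true × VS (proj₂ (ends G e)) ≡ true

IsProper : (G : Multigraph) → VertexSet G → EdgeSet G → Set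
IsProper G VS ES = (∃ λ v → VS v ≡ false) ⊎ (∃ λ e → ES e ≡ false)

Critical : ℕ → Multigraph → Set
Critical D G =
  ¬ DFColoring D G (λ _ → true) (λ _ → true) ×
  (∀ VS ES → IsSubgraph G VS ES → IsProper G VS ES → DFColoring D G VS ES)

{-# OPTIONS --safe #-}

-- Give every vertex v a capacity k v ≤ D + 1 and ask that v ∈ M have fewer than k v neighbours
-- in M, so that k v = 0 forces v into F.  Put
--   ρ(S) = Σ_{v ∈ S} (2 k v + 2D + 1) − 2 (D + 1) e(S).
-- If ρ(S) ≥ −1 for all nonempty S, then a colouring exists (induction on Σ (k v + 1)).
--
-- Extension: colour a set A, contract it to one vertex of capacity 0 carrying its edges to F, and
-- set k w = 0 for the outside vertices w with an edge to the M-part of A.  Capacity 0 costs at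
-- most 2 (D + 1), the price of one edge, so a set B outside A keeps potential ≥ ρ(A ∪ B) − ρ(A).
-- With A of least potential, this yields ρ ≥ 3 on proper sets of size ≥ 2, and ρ ≥ 4 if D = 1.
--
-- Reduction: a vertex of degree ≤ min(3, k v + 1) is deleted, lowering k at its neighbours.  For
-- D ≥ 2 this always works, so the charges 2 k v + 2D + 1 − (D + 1) d(v) are all negative and
-- ρ(V) ≤ −|V|.  For D = 1 the vertices with k = 2 and d = 3 may survive, with charge +1; a few
-- more reductions and discharging leave only a graph on five vertices.
--
-- For a critical G with k = D + 1 everywhere, a set of least potential is either V, or else
-- colourable by criticality, and its colouring then extends to G.
module Submission where

open import Defs
open import Data.Nat using (ℕ; _≤_; _*_; _+_)
open import Data.Nat using (zero; suc; _∸_; _⊓_; _<_; z≤n; s≤s) renaming (_≟_ to _≟ℕ_)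
open import Data.Nat.Properties hiding (_≟_)
open import Data.Nat.Induction using (<-wellFounded)
open import Data.Nat.Tactic.RingSolver using (solve)
open import Algebra.Properties.Semiring.Sum +-*-semiring using (sum; sum-cong-≗; ∑-distrib-+; ∑-comm; *-distribˡ-sum; sum-replicate-zero)
open import Data.Bool using (Bool; true; false; _∧_; _∨_; if_then_else_) renaming (_≟_ to _≟ᵇ_)
open import Data.Bool.Properties using (T?)
open import Data.Empty using (⊥; ⊥-elim)
open import Data.Fin using (Fin; zero; suc; _≟_; toℕ; inject₁; fromℕ<)
open import Data.Fin.Properties using (any?; pigeonhole; toℕ-fromℕ; toℕ-inject₁; toℕ<n; toℕ-injective; toℕ-fromℕ<)
open import Data.Fin.Relation.Unary.Top using (view; ‵fromℕ; ‵inject₁)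
open import Data.Fin.Subset.Properties using (anySubset?)
open import Data.List using ([]; _∷_; filter; length; tabulate)
open import Data.Product using (∃; _×_; _,_; proj₁; proj₂)
open import Data.Sum using (_⊎_; inj₁; inj₂; map₂; swap; assocʳ)
open import Data.Vec using (lookup) renaming (tabulate to tabulateᵛ)
open import Data.Vec.Properties using (lookup∘tabulate)
open import Function using (_∘_; case_of_)
open import Induction.WellFounded using (Acc; acc)
open import Relation.Binary.Definitions using (tri<; tri≈; tri>)
open import Relation.Binary.PropositionalEquality
open import Relation.Nullary using (¬_; Dec; yes; no; does)
open import Relation.Nullary.Decidable using (dec-true; _×-dec_; ¬?; ⌊_⌋)

-- Capacities are there because deletion and contraction both leave constraints on the surviving
-- neighbours, which a lower `k` can record. The constant 2D + 1 is the potential of a single vertex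
-- of capacity 0: if a contracted set has no larger potential, then the sets through the new vertex
-- do not get worse than the sets they come from. The gap is needed because a deleted vertex may
-- take one unit of capacity, worth 2, from each of three neighbours; to end at -1 or above, a set
-- that contains them needs potential 5. Adding the deleted vertex to such a set shows that its
-- potential is at least 2D + 2. This is enough for D ≥ 2 and one too little for D = 1, which is why
-- that case is treated separately. What helps there is that M is a matching, hence acyclic for
-- free: contraction may then leave two edges between the M-parts instead of one, and this raises
-- the gap from 3 to 4.

-- X ≤ Y is a combination of the hypotheses and s is the slack; the equation is left to `solve`.
lin : ∀ {a b X Y} s → X ≤ Y → a + Y + s ≡ b + X → a ≤ b
lin {a} {b} {X} {Y} s X≤Y eq = +-cancelʳ-≤ Y a b (begin
  a + Y     ≤⟨ m≤m+n (a + Y) s ⟩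
  a + Y + s ≡⟨ eq ⟩
  b + X     ≤⟨ +-monoʳ-≤ b X≤Y ⟩
  b + Y     ∎)
  where open ≤-Reasoning

infixl 6 _⊕_
infixl 7 _⊛_

_⊕_ : ∀ {a b c d} → a ≤ b → c ≤ d → a + c ≤ b + d
_⊕_ = +-mono-≤

_⊛_ : ∀ c {a b} → a ≤ b → c * a ≤ c * b
_⊛_ = *-monoʳ-≤

true≢false : ∀ {b} → b ≡ true → b ≡ false → ⊥
true≢false refl ()

∧-true : ∀ {a b} → a ≡ true → b ≡ true → a ∧ b ≡ true
∧-true refl refl = refl

∧-trueˡ : ∀ {a b} → a ∧ b ≡ true → a ≡ true
∧-trueˡ {true} _ = refl

∧-trueʳ : ∀ {a b} → a ∧ b ≡ true → b ≡ true
∧-trueʳ {true} p = p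

not-true : ∀ {a} → not a ≡ true → a ≡ false
not-true {false} _ = refl

not-false : ∀ {a} → a ≡ false → not a ≡ true
not-false refl = refl

bool-cases : ∀ b → b ≡ true ⊎ b ≡ false
bool-cases true = inj₁ refl
bool-cases false = inj₂ refl

does-true : ∀ {A : Set} (a? : Dec A) → does a? ≡ true → A
does-true (yes a) _ = a

-- Finite sums

⟦_⟧ : Bool → ℕ
⟦ true ⟧ = 1
⟦ false ⟧ = 0

⟦⟧≤1 : ∀ b → ⟦ b ⟧ ≤ 1
⟦⟧≤1 true = s≤s z≤n
⟦⟧≤1 false = z≤n

sum-mono : ∀ {n} {f g : Fin n → ℕ} → (∀ i → f i ≤ g i) → sum f ≤ sum g
sum-mono {zero} h = z≤n
sum-mono {suc n} h = +-mono-≤ (h zero) (sum-mono (h ∘ suc))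

sum-zero : ∀ {n} {f : Fin n → ℕ} → (∀ i → f i ≡ 0) → sum f ≡ 0
sum-zero {n} h = trans (sum-cong-≗ h) (sum-replicate-zero n)

sum-single : ∀ {n} (f : Fin n → ℕ) j → (∀ i → i ≢ j → f i ≡ 0) → sum f ≡ f j
sum-single {suc n} f zero h = trans (cong (f zero +_) (sum-zero λ i → h (suc i) λ ())) (+-identityʳ _)
sum-single {suc n} f (suc j) h =
  cong₂ _+_ (h zero λ ()) (sum-single (f ∘ suc) j λ i i≢j → h (suc i) λ { refl → i≢j refl })

sum-pos : ∀ {n} (f : Fin n → ℕ) → 1 ≤ sum f → ∃ λ i → 1 ≤ f i
sum-pos {suc n} f p with f zero in eq
... | suc _ = zero , subst (1 ≤_) (sym eq) (s≤s z≤n)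
... | zero with sum-pos (f ∘ suc) p
...   | i , q = suc i , q

term≤sum : ∀ {n} (f : Fin n → ℕ) i → f i ≤ sum f
term≤sum f zero = m≤m+n _ _
term≤sum f (suc i) = ≤-trans (term≤sum (f ∘ suc) i) (m≤n+m _ _)

-- Serves to select a prescribed number of crossing edges: once for the number at each inner
-- endpoint, then for the edges at that endpoint.
sum-trim : ∀ {n} (f : Fin n → ℕ) t → t ≤ sum f → ∃ λ (g : Fin n → ℕ) → (∀ i → g i ≤ f i) × sum g ≡ t
sum-trim {zero} f .zero z≤n = (λ ()) , (λ ()) , refl
sum-trim {suc n} f t t≤ with ≤-total t (f zero)
... | inj₁ t≤f0 = (λ { zero → t ; (suc _) → 0 }) , (λ { zero → t≤f0 ; (suc _) → z≤n })
                , trans (cong (t +_) (sum-zero {n} {λ _ → 0} λ _ → refl)) (+-identityʳ t)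
... | inj₂ f0≤t with sum-trim (f ∘ suc) (t ∸ f zero) (≤-trans (∸-monoˡ-≤ (f zero) t≤) (≤-reflexive (m+n∸m≡n (f zero) _)))
...   | g , g≤f , eq = (λ { zero → f zero ; (suc i) → g i }) , (λ { zero → ≤-refl ; (suc i) → g≤f i })
                     , trans (cong (f zero +_) eq) (m+[n∸m]≡n f0≤t)

-- Vertex sets and sums over them

module _ {N : ℕ} where

  Sub : Set
  Sub = Fin N → Bool

  infix 4 _∈_ _∉_ _⊆_
  _∈_ _∉_ : Fin N → Sub → Set
  v ∈ S = S v ≡ true
  v ∉ S = S v ≡ false

  _⊆_ : Sub → Sub → Set
  S ⊆ T = ∀ {v} → v ∈ S → v ∈ T

  Nonempty : Sub → Set
  Nonempty S = ∃ λ v → v ∈ S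

  infixl 6 _∪_ _∖_ _-_ _+ᵥ_
  infixl 7 _∩_

  _∪_ _∩_ _∖_ : Sub → Sub → Sub
  (S ∪ T) v = S v ∨ T v
  (S ∩ T) v = S v ∧ T v
  (S ∖ T) v = S v ∧ not (T v)

  ∁ : Sub → Sub
  ∁ S v = not (S v)

  ∅ : Sub
  ∅ _ = false

  ｛_｝ : Fin N → Sub
  ｛ v ｝ u = does (u ≟ v)

  _-_ _+ᵥ_ : Sub → Fin N → Sub
  S - v = S ∖ ｛ v ｝
  S +ᵥ v = S ∪ ｛ v ｝

  ≡⊎≢ : ∀ (u v : Fin N) → u ≡ v ⊎ u ≢ v
  ≡⊎≢ u v with u ≟ v
  ... | yes p = inj₁ p
  ... | no ¬p = inj₂ ¬p

  ∈-｛｝ : ∀ v → v ∈ ｛ v ｝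
  ∈-｛｝ v with v ≟ v
  ... | yes _ = refl
  ... | no ¬p = ⊥-elim (¬p refl)

  ∉-｛｝ : ∀ {u v} → u ≢ v → u ∉ ｛ v ｝
  ∉-｛｝ {u} {v} u≢v with u ≟ v
  ... | yes p = ⊥-elim (u≢v p)
  ... | no _ = refl

  ∈-｛｝⁻ : ∀ {u v} → u ∈ ｛ v ｝ → u ≡ v
  ∈-｛｝⁻ {u} {v} p with u ≟ v
  ... | yes q = q

  ∈∉⇒≢ : ∀ {S : Sub} {u v} → u ∈ S → v ∉ S → u ≢ v
  ∈∉⇒≢ p q refl = true≢false p q

  ∪⁺ˡ : ∀ (S T : Sub) → S ⊆ S ∪ T
  ∪⁺ˡ S T {v} p rewrite p = refl

  ∪⁺ʳ : ∀ (S T : Sub) → T ⊆ S ∪ T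
  ∪⁺ʳ S T {v} p with S v
  ... | true = refl
  ... | false = p

  ∪⁻ : ∀ (S T : Sub) {v} → v ∈ S ∪ T → v ∈ S ⊎ v ∈ T
  ∪⁻ S T {v} p with S v
  ... | true = inj₁ refl
  ... | false = inj₂ p

  ∖⁺ : ∀ (S T : Sub) {v} → v ∈ S → v ∉ T → v ∈ S ∖ T
  ∖⁺ S T p q = ∧-true p (not-false q)

  ∖⁻ˡ : ∀ (S T : Sub) → S ∖ T ⊆ S
  ∖⁻ˡ S T = ∧-trueˡ

  ∖⁻ʳ : ∀ (S T : Sub) {v} → v ∈ S ∖ T → v ∉ T
  ∖⁻ʳ S T {v} p = not-true (∧-trueʳ {S v} p)

  -⊆ˡ : ∀ (S : Sub) v → S - v ⊆ S
  -⊆ˡ S v = ∧-trueˡ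

  ⊆+ᵥ : ∀ (S : Sub) v → S ⊆ S +ᵥ v
  ⊆+ᵥ S v = ∪⁺ˡ S ｛ v ｝

  -⁺ : ∀ (S : Sub) {u v} → u ∈ S → u ≢ v → u ∈ S - v
  -⁺ S {u} {v} p q = ∖⁺ S ｛ v ｝ p (∉-｛｝ q)

  -⁻ : ∀ (S : Sub) {u v} → u ∈ S - v → u ≢ v
  -⁻ S {u} {v} p refl = true≢false (∈-｛｝ v) (∖⁻ʳ S ｛ v ｝ p)

  +ᵥ-⊆ : ∀ (S T : Sub) {v} → S ⊆ T → v ∈ T → S +ᵥ v ⊆ T
  +ᵥ-⊆ S T {v} S⊆T v∈T p with ∪⁻ S ｛ v ｝ p
  ... | inj₁ q = S⊆T q
  ... | inj₂ q = subst (_∈ T) (sym (∈-｛｝⁻ q)) v∈T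

  v∈+ᵥ : ∀ (S : Sub) v → v ∈ S +ᵥ v
  v∈+ᵥ S v = ∪⁺ʳ S ｛ v ｝ (∈-｛｝ v)

  +ᵥ-∉ : ∀ (S : Sub) {u v} → u ∉ S → u ≢ v → u ∉ S +ᵥ v
  +ᵥ-∉ S p q rewrite p = ∉-｛｝ q

  -∉ : ∀ (S : Sub) v → v ∉ S - v
  -∉ S v with S v
  ... | false = refl
  ... | true rewrite ∈-｛｝ v = refl

  ∉-⊆ : ∀ (S T : Sub) {v} → S ⊆ T → v ∉ T → v ∉ S
  ∉-⊆ S T {v} S⊆T v∉T with S v in eq
  ... | false = refl
  ... | true = ⊥-elim (true≢false (S⊆T eq) v∉T)

  opaque
    over : Sub → (Fin N → ℕ) → ℕ
    over S f = sum λ u → if S u then f u else 0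

  size : Sub → ℕ
  size S = over S λ _ → 1

  opaque
    unfolding over

    over-mono : ∀ S {f g} → (∀ {u} → u ∈ S → f u ≤ g u) → over S f ≤ over S g
    over-mono S {f} {g} h = sum-mono pt
      where
      pt : ∀ u → (if S u then f u else 0) ≤ (if S u then g u else 0)
      pt u with S u in eq
      ... | true = h eq
      ... | false = z≤n

    over-cong : ∀ S {f g} → (∀ {u} → u ∈ S → f u ≡ g u) → over S f ≡ over S g
    over-cong S h = ≤-antisym (over-mono S λ p → ≤-reflexive (h p)) (over-mono S λ p → ≤-reflexive (sym (h p)))

    over-⊆ : ∀ {S T} f → S ⊆ T → over S f ≤ over T f
    over-⊆ {S} {T} f S⊆T = sum-mono pt
      where
      pt : ∀ u → (if S u then f u else 0) ≤ (if T u then f u else 0)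
      pt u with S u in eq
      ... | false = z≤n
      ... | true rewrite S⊆T eq = ≤-refl

    over-≗ : ∀ {S T : Sub} f → (∀ v → S v ≡ T v) → over S f ≡ over T f
    over-≗ f h = sum-cong-≗ λ u → cong (if_then f u else 0) (h u)

    over-+ : ∀ S f g → over S (λ u → f u + g u) ≡ over S f + over S g
    over-+ S f g = trans (sum-cong-≗ pt) (∑-distrib-+ {N} (λ u → if S u then f u else 0) (λ u → if S u then g u else 0))
      where
      pt : ∀ u → (if S u then f u + g u else 0) ≡ (if S u then f u else 0) + (if S u then g u else 0)
      pt u with S u
      ... | true = refl
      ... | false = refl

    over-* : ∀ S c f → over S (λ u → c * f u) ≡ c * over S f
    over-* S c f = trans (sum-cong-≗ pt) (sym (*-distribˡ-sum {N} c (λ u → if S u then f u else 0)))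
      where
      pt : ∀ u → (if S u then c * f u else 0) ≡ c * (if S u then f u else 0)
      pt u with S u
      ... | true = refl
      ... | false = sym (*-zeroʳ c)

    over-swap : ∀ S T (f : Fin N → Fin N → ℕ) →
      over S (λ u → over T (f u)) ≡ over T (λ w → over S λ u → f u w)
    over-swap S T f = trans (sum-cong-≗ left) (trans (∑-comm g) (sum-cong-≗ right))
      where
      g : Fin N → Fin N → ℕ
      g u w = if S u then (if T w then f u w else 0) else 0
      left : ∀ u → (if S u then over T (f u) else 0) ≡ sum (g u)
      left u with S u
      ... | true = refl
      ... | false = sym (sum-zero {N} λ _ → refl)
      right : ∀ w → sum (λ u → g u w) ≡ (if T w then over S (λ u → f u w) else 0)
      right w with T w
      ... | true = refl
      ... | false = sum-zero λ u → h u
        where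
        h : ∀ u → (if S u then 0 else 0) ≡ 0
        h u with S u
        ... | true = refl
        ... | false = refl

    over-sum : ∀ {m} S (f : Fin m → Fin N → ℕ) → over S (λ w → sum λ e → f e w) ≡ sum λ e → over S (f e)
    over-sum {m} S f = trans (sum-cong-≗ pt) (∑-comm (λ w e → if S w then f e w else 0))
      where
      pt : ∀ w → (if S w then sum (λ e → f e w) else 0) ≡ sum λ e → if S w then f e w else 0
      pt w with S w
      ... | true = refl
      ... | false = sym (sum-zero {m} λ _ → refl)

    over-all : ∀ f → over (λ _ → true) f ≡ sum f
    over-all f = refl

    over-∪ : ∀ {S T : Sub} f → (∀ {v} → v ∈ S → v ∉ T) → over (S ∪ T) f ≡ over S f + over T f
    over-∪ {S} {T} f dis = trans (sum-cong-≗ pt) (∑-distrib-+ {N} (λ u → if S u then f u else 0) (λ u → if T u then f u else 0))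
      where
      pt : ∀ u → (if S u ∨ T u then f u else 0) ≡ (if S u then f u else 0) + (if T u then f u else 0)
      pt u with S u in eq
      ... | false = refl
      ... | true rewrite dis eq = sym (+-identityʳ (f u))

    over-split : ∀ (S A : Sub) f → over S f ≡ over (S ∩ A) f + over (S ∖ A) f
    over-split S A f = trans (sum-cong-≗ pt) (∑-distrib-+ {N} (λ u → if S u ∧ A u then f u else 0) (λ u → if S u ∧ not (A u) then f u else 0))
      where
      pt : ∀ u → (if S u then f u else 0) ≡ (if S u ∧ A u then f u else 0) + (if S u ∧ not (A u) then f u else 0)
      pt u with S u | A u
      ... | false | _ = refl
      ... | true | true = sym (+-identityʳ (f u))
      ... | true | false = refl

    over-split′ : ∀ (S A : Sub) f → over S f ≡ over (S ∖ A) f + over (S ∩ A) f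
    over-split′ S A f = trans (over-split S A f) (+-comm (over (S ∩ A) f) (over (S ∖ A) f))

    over-｛｝ : ∀ v f → over ｛ v ｝ f ≡ f v
    over-｛｝ v f = trans (sum-single _ v λ i i≢v → cong (if_then f i else 0) (∉-｛｝ i≢v))
                          (cong (if_then f v else 0) (∈-｛｝ v))

    over-+ᵥ : ∀ {S : Sub} {v} f → v ∉ S → over (S +ᵥ v) f ≡ over S f + f v
    over-+ᵥ {S} {v} f v∉S = trans
      (over-∪ {S} f λ p → ∉-｛｝ (∈∉⇒≢ {S} p v∉S))
      (cong (over S f +_) (over-｛｝ v f))

    -+ᵥ : ∀ (S : Sub) {v} → v ∈ S → ∀ u → S u ≡ ((S - v) +ᵥ v) u
    -+ᵥ S {v} v∈S u with u ≟ v
    ... | yes refl rewrite v∈S = refl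
    ... | no _ with S u
    ...   | true = refl
    ...   | false = refl

    over-remove : ∀ {S : Sub} {v} f → v ∈ S → over S f ≡ over (S - v) f + f v
    over-remove {S} {v} f v∈S = trans (over-≗ f (-+ᵥ S v∈S)) (over-+ᵥ {S - v} f (-∉ S v))

    over-zero : ∀ S {f} → (∀ {u} → u ∈ S → f u ≡ 0) → over S f ≡ 0
    over-zero S {f} h = sum-zero pt
      where
      pt : ∀ u → (if S u then f u else 0) ≡ 0
      pt u with S u in eq
      ... | true = h eq
      ... | false = refl

    over-trim : ∀ S f t → t ≤ over S f → ∃ λ (g : Fin N → ℕ) → (∀ u → g u ≤ f u) × over S g ≡ t
    over-trim S f t t≤ with sum-trim (λ u → if S u then f u else 0) t t≤
    ... | g , g≤ , eq = g , (λ u → ≤-trans (g≤ u) (le u)) , trans (sum-cong-≗ λ u → same u (g≤ u)) eq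
      where
      le : ∀ u → (if S u then f u else 0) ≤ f u
      le u with S u
      ... | true = ≤-refl
      ... | false = z≤n
      same : ∀ u → g u ≤ (if S u then f u else 0) → (if S u then g u else 0) ≡ g u
      same u p with S u
      ... | true = refl
      ... | false = sym (n≤0⇒n≡0 p)

    over-pos : ∀ S f → 1 ≤ over S f → ∃ λ u → u ∈ S × 1 ≤ f u
    over-pos S f p with sum-pos _ p
    ... | u , q with S u in eq
    ...   | true = u , eq , q

    term≤over : ∀ (S : Sub) f {v} → v ∈ S → f v ≤ over S f
    term≤over S f {v} p = ≤-trans (≤-reflexive (sym (cong (if_then f v else 0) p))) (term≤sum (λ u → if S u then f u else 0) v)

  size-pos : ∀ (S : Sub) → Nonempty S → 1 ≤ size S
  size-pos S (v , p) = term≤over S (λ _ → 1) p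

  size-nonempty : ∀ (S : Sub) → 1 ≤ size S → Nonempty S
  size-nonempty S h = let v , p , _ = over-pos S (λ _ → 1) h in v , p

  size-≥2 : ∀ (S : Sub) {u v} → u ∈ S → v ∈ S → u ≢ v → 2 ≤ size S
  size-≥2 S {u} {v} pu pv u≢v = subst (2 ≤_) (sym (over-remove {S} (λ _ → 1) pv))
    (+-monoˡ-≤ 1 (size-pos (S - v) (u , -⁺ S pu u≢v)))

  empty? : ∀ (S : Sub) → Nonempty S ⊎ (∀ v → v ∉ S)
  empty? S with size S in eq
  ... | suc _ with over-pos S _ (subst (1 ≤_) (sym eq) (s≤s z≤n))
  ...   | v , p , _ = inj₁ (v , p)
  empty? S | zero = inj₂ h
    where
    h : ∀ v → v ∉ S
    h v with S v in eq'
    ... | false = refl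
    ... | true = ⊥-elim (case subst (1 ≤_) eq (size-pos S (v , eq')) of λ ())

  ∉⇒⊆- : ∀ (S T : Sub) {v} → S ⊆ T → v ∉ S → S ⊆ T - v
  ∉⇒⊆- S T S⊆T v∉S p = -⁺ T (S⊆T p) (∈∉⇒≢ {S} p v∉S)

  -⊆ : ∀ (S T : Sub) {v} → S ⊆ T +ᵥ v → S - v ⊆ T
  -⊆ S T {v} S⊆ p with ∪⁻ T ｛ v ｝ (S⊆ (-⊆ˡ S v p))
  ... | inj₁ q = q
  ... | inj₂ q = ⊥-elim (-⁻ S p (∈-｛｝⁻ q))

-- Edge multiplicities, forests, and colourings with capacities

module _ {N : ℕ} where

  Mult : Set
  Mult = Fin N → Fin N → ℕ

  Symmetric Irreflexive : Mult → Set
  Symmetric μ = ∀ u w → μ u w ≡ μ w u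
  Irreflexive μ = ∀ u → μ u u ≡ 0

  deg : Mult → Sub → Fin N → ℕ
  deg μ S u = over S (μ u)

  cross : Mult → Sub → Sub → ℕ
  cross μ S T = over S (deg μ T)

  -- Every edge inside S is counted twice.
  Q : Mult → Sub → ℕ
  Q μ S = cross μ S S

  cross-sym : ∀ {μ} → Symmetric μ → ∀ S T → cross μ S T ≡ cross μ T S
  cross-sym {μ} σ S T = trans (over-swap S T μ) (over-cong T λ {w} _ → over-cong S λ {u} _ → σ u w)

  Q-≗ : ∀ μ {S T : Sub} → (∀ v → S v ≡ T v) → Q μ S ≡ Q μ T
  Q-≗ μ {S} {T} h = trans (over-≗ _ h) (over-cong T λ _ → over-≗ _ h)

  Q-mono : ∀ {μ ν : Mult} S → (∀ {u w} → u ∈ S → w ∈ S → μ u w ≤ ν u w) → Q μ S ≤ Q ν S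
  Q-mono S h = over-mono S λ p → over-mono S λ q → h p q

  Q-∪ : ∀ {μ} → Symmetric μ → ∀ {S T} → (∀ {v} → v ∈ S → v ∉ T) →
    Q μ (S ∪ T) ≡ Q μ S + Q μ T + 2 * cross μ S T
  Q-∪ {μ} σ {S} {T} dis = begin
    over (S ∪ T) (deg μ (S ∪ T))
      ≡⟨ over-∪ _ dis ⟩
    over S (deg μ (S ∪ T)) + over T (deg μ (S ∪ T))
      ≡⟨ cong₂ _+_ (over-cong S λ _ → over-∪ _ dis) (over-cong T λ _ → over-∪ _ dis) ⟩
    over S (λ u → deg μ S u + deg μ T u) + over T (λ u → deg μ S u + deg μ T u)
      ≡⟨ cong₂ _+_ (over-+ S _ _) (over-+ T _ _) ⟩
    Q μ S + cross μ S T + (cross μ T S + Q μ T)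
      ≡⟨ cong (λ x → Q μ S + cross μ S T + (x + Q μ T)) (cross-sym σ T S) ⟩
    Q μ S + cross μ S T + (cross μ S T + Q μ T)
      ≡⟨ rearrange (Q μ S) (Q μ T) (cross μ S T) ⟩
    Q μ S + Q μ T + 2 * cross μ S T ∎
    where
    open ≡-Reasoning
    rearrange : ∀ a b c → a + c + (c + b) ≡ a + b + 2 * c
    rearrange a b c = solve (a ∷ b ∷ c ∷ [])

  Q-split : ∀ {μ} → Symmetric μ → ∀ S A →
    Q μ S ≡ Q μ (S ∩ A) + Q μ (S ∖ A) + 2 * cross μ (S ∩ A) (S ∖ A)
  Q-split {μ} σ S A = trans (Q-≗ μ {S} {(S ∩ A) ∪ (S ∖ A)} pt) (Q-∪ σ {S ∩ A} {S ∖ A} dis)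
    where
    pt : ∀ v → S v ≡ ((S ∩ A) ∪ (S ∖ A)) v
    pt v with S v | A v
    ... | true | true = refl
    ... | true | false = refl
    ... | false | _ = refl
    dis : ∀ {v} → v ∈ S ∩ A → v ∉ S ∖ A
    dis {v} p with S v | A v
    dis p | true | true = refl

  cross-｛｝ : ∀ {μ} → Symmetric μ → ∀ S v → cross μ S ｛ v ｝ ≡ deg μ S v
  cross-｛｝ {μ} σ S v = over-cong S λ {u} _ → trans (over-｛｝ v (μ u)) (σ u v)

  Q-｛｝ : ∀ {μ} → Irreflexive μ → ∀ v → Q μ ｛ v ｝ ≡ 0
  Q-｛｝ {μ} ι v = trans (over-｛｝ v _) (trans (over-｛｝ v _) (ι v))

  Q-+ᵥ : ∀ {μ} → Symmetric μ → Irreflexive μ → ∀ {S v} → v ∉ S →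
    Q μ (S +ᵥ v) ≡ Q μ S + 2 * deg μ S v
  Q-+ᵥ {μ} σ ι {S} {v} v∉S = trans
    (Q-∪ σ {S} {｛ v ｝} λ p → ∉-｛｝ (∈∉⇒≢ {S = S} p v∉S))
    (cong₂ _+_ (trans (cong (Q μ S +_) (Q-｛｝ ι v)) (+-identityʳ _)) (cong (2 *_) (cross-｛｝ σ S v)))

  Q-remove : ∀ {μ} → Symmetric μ → Irreflexive μ → ∀ {S v} → v ∈ S →
    Q μ S ≡ Q μ (S - v) + 2 * deg μ (S - v) v
  Q-remove {μ} σ ι {S} {v} v∈S = trans (Q-≗ μ (-+ᵥ S v∈S)) (Q-+ᵥ σ ι {S - v} (-∉ S v))

  Q-empty : ∀ μ {S} → (∀ v → v ∉ S) → Q μ S ≡ 0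
  Q-empty μ {S} e = over-zero S λ {u} p → ⊥-elim (true≢false p (e u))

  deg-empty : ∀ μ {S} v → (∀ v → v ∉ S) → deg μ S v ≡ 0
  deg-empty μ {S} v e = over-zero S λ {u} p → ⊥-elim (true≢false p (e u))

  size-or-Q : ∀ {μ} → Symmetric μ → Irreflexive μ → ∀ {S} → Nonempty S → 2 ≤ size S ⊎ Q μ S ≡ 0
  size-or-Q {μ} σ ι {S} (v , p) with empty? (S - v)
  ... | inj₁ (u , q) = inj₁ (size-≥2 S (-⊆ˡ S v q) p (-⁻ S q))
  ... | inj₂ e = inj₂ (trans (Q-remove σ ι {S} p)
    (cong₂ (λ a b → a + 2 * b) (Q-empty μ {S - v} e) (deg-empty μ {S - v} v e)))

  -- Acyclicity by counting: a nonempty set spans fewer edges than it has vertices, doubled because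
  -- `Q` counts each edge twice. Deletion, contraction and subdivision then become arithmetic;
  -- `Bridge` relates this to cycles.
  Forest : Mult → Sub → Set
  Forest μ X = ∀ S → S ⊆ X → Nonempty S → Q μ S + 2 ≤ 2 * size S

  Forest-⊆ : ∀ {μ X Y} → Y ⊆ X → Forest μ X → Forest μ Y
  Forest-⊆ Y⊆X f S S⊆Y = f S λ p → Y⊆X (S⊆Y p)

  Forest-mono : ∀ {μ ν : Mult} {X} → (∀ {u w} → u ∈ X → w ∈ X → μ u w ≤ ν u w) → Forest ν X → Forest μ X
  Forest-mono h f S S⊆X ne = ≤-trans (+-monoˡ-≤ 2 (Q-mono S λ p q → h (S⊆X p) (S⊆X q))) (f S S⊆X ne)

  -- The vertex `v` raises `2 * size` by 2, so the rest of a set through `v` has to absorb the edges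
  -- to `v` without the `+ 2` of `Forest`. The bound is left as a hypothesis because in a
  -- subdivision it comes from a forest for another multiplicity.
  forest-insert : ∀ {μ} → Symmetric μ → Irreflexive μ → ∀ X v →
    Forest μ (X - v) →
    (∀ S → S ⊆ X - v → Nonempty S → Q μ S + 2 * deg μ S v ≤ 2 * size S) →
    Forest μ X
  forest-insert {μ} σ ι X v f h S S⊆X ne with bool-cases (S v)
  ... | inj₂ v∉S = f S (∉⇒⊆- S X S⊆X v∉S) ne
  ... | inj₁ v∈S = subst₂ _≤_ (sym (cong (_+ 2) (Q-remove σ ι {S} v∈S))) (sym (cong (2 *_) (over-remove {S = S} (λ _ → 1) v∈S)))
    (main (empty? (S - v)))
    where
    arith : ∀ q d s → q + 2 * d ≤ 2 * s → q + 2 * d + 2 ≤ 2 * (s + 1)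
    arith q d s p = lin 0 p (solve (q ∷ d ∷ s ∷ []))
    main : Nonempty (S - v) ⊎ (∀ u → u ∉ S - v) → Q μ (S - v) + 2 * deg μ (S - v) v + 2 ≤ 2 * (size (S - v) + 1)
    main (inj₁ ne′) = arith (Q μ (S - v)) (deg μ (S - v) v) (size (S - v))
      (h (S - v) (λ p → -⁺ X (S⊆X (-⊆ˡ S v p)) (-⁻ S p)) ne′)
    main (inj₂ e) = arith (Q μ (S - v)) (deg μ (S - v) v) (size (S - v))
      (subst (_≤ 2 * size (S - v)) (sym (cong₂ (λ a b → a + 2 * b) (Q-empty μ {S - v} e) (deg-empty μ {S - v} v e))) z≤n)

  forest-leaf : ∀ {μ} → Symmetric μ → Irreflexive μ → ∀ X v →
    Forest μ (X - v) → deg μ (X - v) v ≤ 1 → Forest μ X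
  forest-leaf {μ} σ ι X v f d≤1 = forest-insert σ ι X v f λ S S⊆ ne →
    ≤-trans (+-monoʳ-≤ (Q μ S) (2 ⊛ ≤-trans (over-⊆ (μ v) S⊆) d≤1)) (f S S⊆ ne)

  -- Summing degrees gives `Q μ S ≤ size S`, which is enough once `S` has two vertices. With
  -- capacities at most 2 this makes `forestM` a consequence of `bound`.
  matching-forest : ∀ {μ} → Symmetric μ → Irreflexive μ → ∀ X → (∀ {v} → v ∈ X → deg μ X v ≤ 1) → Forest μ X
  matching-forest {μ} σ ι X h S S⊆X ne with size-or-Q σ ι {S} ne
  ... | inj₂ q0 = subst (λ q → q + 2 ≤ 2 * size S) (sym q0) (2 ⊛ size-pos S ne)
  ... | inj₁ s≥2 = arith (Q μ S) (size S) (over-mono S λ p → ≤-trans (over-⊆ _ S⊆X) (h (S⊆X p))) s≥2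
    where
    arith : ∀ q s → q ≤ s → 2 ≤ s → q + 2 ≤ 2 * s
    arith q s a b = lin 0 (a ⊕ b) (solve (q ∷ s ∷ []))

  -- φ is the part M.
  record IsCol (V : Sub) (μ : Mult) (k : Fin N → ℕ) (φ : Sub) : Set where
    field
      bound : ∀ {v} → v ∈ V → v ∈ φ → suc (deg μ (V ∩ φ) v) ≤ k v
      forestM : Forest μ (V ∩ φ)
      forestF : Forest μ (V ∩ ∁ φ)

  Colourable : Sub → Mult → (Fin N → ℕ) → Set
  Colourable V μ k = ∃ (IsCol V μ k)

  IsCol-mono : ∀ {V μ ν} {k l φ} → (∀ {u w} → u ∈ V → w ∈ V → μ u w ≤ ν u w) → (∀ {u} → u ∈ V → l u ≤ k u) →
    IsCol V ν l φ → IsCol V μ k φ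
  IsCol-mono {V} {μ} {ν} {k} {l} {φ} μ≤ν l≤k c = record
    { bound = λ p q → ≤-trans (s≤s (over-mono (V ∩ φ) λ r → μ≤ν p (∧-trueˡ r))) (≤-trans (bound p q) (l≤k p))
    ; forestM = Forest-mono (λ p q → μ≤ν (∧-trueˡ p) (∧-trueˡ q)) forestM
    ; forestF = Forest-mono (λ p q → μ≤ν (∧-trueˡ p) (∧-trueˡ q)) forestF
    }
    where open IsCol c

  -- Extending a colouring by one vertex

  module Extend {μ : Mult} (σ : Symmetric μ) (ι : Irreflexive μ) (V : Sub) (v : Fin N) (v∈V : v ∈ V) (k : Fin N → ℕ) where

    -- ν may contain extra edges that are subdivided by v.
    extendF : ∀ {ν l φ} → IsCol (V - v) ν l φ →
      (∀ {u w} → u ∈ V - v → w ∈ V - v → μ u w ≤ ν u w) →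
      (∀ {u} → u ∈ V - v → l u ≤ k u) →
      (∀ S → S ⊆ (V - v) ∩ ∁ φ → Q μ S + 2 * deg μ S v ≤ Q ν S + 2) →
      IsCol V μ k (φ - v)
    extendF {ν} {l} {φ} c μ≤ν l≤k h = record
      { bound = λ {u} p q → ≤-trans (s≤s (over-⊆ (μ u) (λ {w} → M⊆ {w})))
          (bound (-⁺ V p (-⁻ φ q)) (-⊆ˡ φ v q))
      ; forestM = Forest-⊆ M⊆ forestM
      ; forestF = forest-insert σ ι (V ∩ ∁ (φ - v)) v (Forest-⊆ F⊆ forestF)
          λ S S⊆ ne → ≤-trans (h S λ p → F⊆ (S⊆ p)) (IsCol.forestF c S (λ p → F⊆ (S⊆ p)) ne)
      }
      where
      open IsCol (IsCol-mono μ≤ν l≤k c)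
      M⊆ : V ∩ (φ - v) ⊆ (V - v) ∩ φ
      M⊆ {w} p with V w | φ w | ｛ v ｝ w
      M⊆ p | true | true | false = refl
      M⊆ () | true | true | true
      M⊆ () | true | false | _
      M⊆ () | false | _ | _
      F⊆ : V ∩ ∁ (φ - v) - v ⊆ (V - v) ∩ ∁ φ
      F⊆ {w} p with V w | φ w | ｛ v ｝ w
      F⊆ p | true | false | false = refl
      F⊆ () | true | true | true
      F⊆ () | true | true | false
      F⊆ () | true | false | true
      F⊆ () | false | _ | _

    extendF-leaf : ∀ {l φ} → IsCol (V - v) μ l φ → (∀ {u} → u ∈ V - v → l u ≤ k u) →
      deg μ ((V - v) ∩ ∁ φ) v ≤ 1 → IsCol V μ k (φ - v)
    extendF-leaf c l≤k d≤1 = extendF c (λ _ _ → ≤-refl) l≤k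
      λ S S⊆ → +-monoʳ-≤ (Q μ S) (2 ⊛ ≤-trans (over-⊆ (μ v) S⊆) d≤1)

    -- With at most one edge into M the new vertex is a leaf there and closes no cycle; the last
    -- hypothesis gives its M-neighbour room for it.
    extendM : ∀ {l φ} → IsCol (V - v) μ l φ →
      (∀ {u} → u ∈ V - v → l u ≤ k u) →
      deg μ ((V - v) ∩ φ) v ≤ 1 → suc (deg μ ((V - v) ∩ φ) v) ≤ k v →
      (∀ {u} → u ∈ V - v → u ∈ φ → suc (deg μ ((V - v) ∩ φ) u + μ u v) ≤ k u) →
      IsCol V μ k (φ +ᵥ v)
    extendM {l} {φ} c l≤k d≤1 d<k slack = record
      { bound = bnd
      ; forestM = forest-leaf σ ι (V ∩ (φ +ᵥ v)) v (Forest-⊆ M⊆ forestM) (≤-trans (over-⊆ (μ v) M⊆) d≤1)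
      ; forestF = Forest-⊆ F⊆ forestF
      }
      where
      open IsCol (IsCol-mono (λ _ _ → ≤-refl) l≤k c)
      M⊆ : V ∩ (φ +ᵥ v) - v ⊆ (V - v) ∩ φ
      M⊆ {w} p with V w | φ w | ｛ v ｝ w
      M⊆ p | true | true | false = refl
      M⊆ () | true | true | true
      M⊆ () | true | false | true
      M⊆ () | true | false | false
      M⊆ () | false | _ | _
      F⊆ : V ∩ ∁ (φ +ᵥ v) ⊆ (V - v) ∩ ∁ φ
      F⊆ {w} p with V w | φ w | ｛ v ｝ w
      F⊆ p | true | false | false = refl
      F⊆ () | true | true | _
      F⊆ () | true | false | true
      F⊆ () | false | _ | _
      v∈ : v ∈ V ∩ (φ +ᵥ v)
      v∈ = ∧-true v∈V (v∈+ᵥ φ v)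
      degM≤ : ∀ u → deg μ (V ∩ (φ +ᵥ v)) u ≤ deg μ ((V - v) ∩ φ) u + μ u v
      degM≤ u = ≤-trans (≤-reflexive (over-remove (μ u) v∈)) (+-monoˡ-≤ (μ u v) (over-⊆ (μ u) M⊆))
      bnd : ∀ {u} → u ∈ V → u ∈ φ +ᵥ v → suc (deg μ (V ∩ (φ +ᵥ v)) u) ≤ k u
      bnd {u} p q with ≡⊎≢ u v
      ... | inj₁ refl = ≤-trans (s≤s (≤-trans (degM≤ u) (≤-reflexive (trans (cong (deg μ ((V - v) ∩ φ) u +_) (ι u)) (+-identityʳ _))))) d<k
      ... | inj₂ u≢v = ≤-trans (s≤s (degM≤ u)) (slack (-⁺ V p u≢v) (case ∪⁻ φ ｛ v ｝ q of λ
              { (inj₁ r) → r ; (inj₂ r) → ⊥-elim (u≢v (∈-｛｝⁻ r)) }))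

    -- With at most one edge into F, `v` becomes a leaf of F. Otherwise the degree bounds leave at
    -- most one edge to M and a capacity that accommodates it, so `v` goes to M; slack is asked for
    -- in this case only, and only at an M-neighbour of `v`.
    extend-slack : ∀ {l φ} → IsCol (V - v) μ l φ →
      (∀ {u} → u ∈ V - v → l u ≤ k u) →
      deg μ V v ≤ 3 → deg μ V v ≤ suc (k v) →
      (2 ≤ deg μ ((V - v) ∩ ∁ φ) v → ∀ {u} → u ∈ V - v → u ∈ φ → 1 ≤ μ u v → 2 + deg μ ((V - v) ∩ φ) u ≤ k u) →
      Colourable V μ k
    extend-slack {l} {φ} c l≤k d≤3 d≤1+k slack with deg μ ((V - v) ∩ ∁ φ) v ≤? 1
    ... | yes F≤1 = φ - v , extendF-leaf c l≤k F≤1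
    ... | no F≰1 = φ +ᵥ v , extendM c l≤k M≤1 (arith₂ _ _ (k v) F≥2 (≤-trans M+F≤ d≤1+k)) sl
      where
      F≥2 : 2 ≤ deg μ ((V - v) ∩ ∁ φ) v
      F≥2 = ≰⇒> F≰1
      M+F≤ : deg μ ((V - v) ∩ φ) v + deg μ ((V - v) ∩ ∁ φ) v ≤ deg μ V v
      M+F≤ = ≤-trans (≤-reflexive (sym (over-split (V - v) φ (μ v)))) (over-⊆ (μ v) (-⊆ˡ V v))
      arith₁ : ∀ a b → 2 ≤ b → a + b ≤ 3 → a ≤ 1
      arith₁ a b p q = lin 0 (p ⊕ q) (solve (a ∷ b ∷ []))
      arith₂ : ∀ a b c → 2 ≤ b → a + b ≤ 1 + c → 1 + a ≤ c
      arith₂ a b c p q = lin 0 (p ⊕ q) (solve (a ∷ b ∷ c ∷ []))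
      M≤1 : deg μ ((V - v) ∩ φ) v ≤ 1
      M≤1 = arith₁ _ _ F≥2 (≤-trans M+F≤ d≤3)
      sl : ∀ {u} → u ∈ V - v → u ∈ φ → suc (deg μ ((V - v) ∩ φ) u + μ u v) ≤ k u
      sl {u} p q with μ u v in eq
      ... | zero = ≤-trans (≤-reflexive (cong suc (+-identityʳ _))) (≤-trans (IsCol.bound c p q) (l≤k p))
      ... | suc m = ≤-trans (s≤s (≤-trans (+-monoʳ-≤ _ sm≤1) (≤-reflexive (+-comm _ 1))))
                      (slack F≥2 p q (subst (1 ≤_) (sym eq) (s≤s z≤n)))
        where
        sm≤1 : suc m ≤ 1
        sm≤1 = ≤-trans (≤-reflexive (trans (sym eq) (σ u v)))
          (≤-trans (term≤over ((V - v) ∩ φ) (μ v) (∧-true p q)) M≤1)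

-- Contraction of a coloured set

∸-slack : ∀ a k x → suc a ≤ k ∸ x → suc (a + x) ≤ k
∸-slack a k x p with ≤-total x k
... | inj₁ x≤k = subst (suc (a + x) ≤_) (m∸n+n≡m x≤k) (+-monoˡ-≤ x p)
... | inj₂ k≤x = case subst (suc a ≤_) (m≤n⇒m∸n≡0 k≤x) p of λ ()

module _ {N : ℕ} where

  wt : ℕ → (Fin N → ℕ) → Sub → ℕ
  wt D k S = over S λ u → 2 * k u + (2 * D + 1)

  -- Potential at least −1 on all nonempty subsets.
  Adm : ℕ → Sub → Mult → (Fin N → ℕ) → Set
  Adm D V μ k = ∀ S → S ⊆ V → Nonempty S → suc D * Q μ S ≤ wt D k S + 1

  meas : Sub → (Fin N → ℕ) → ℕ
  meas V k = over V λ u → suc (k u)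

  -- If joining `C` to `A` does not lower the potential, `C` pays for its edges to `A` by itself. In
  -- this form the minimality of `A` reaches the contracted graph.
  superset-potential : ∀ D {μ} → Symmetric μ → ∀ k {A C : Sub} → (∀ {v} → v ∈ C → v ∉ A) →
    wt D k A + suc D * Q μ (C ∪ A) ≤ wt D k (C ∪ A) + suc D * Q μ A →
    suc D * (Q μ C + 2 * cross μ C A) ≤ wt D k C
  superset-potential D {μ} σ k {A} {C} dis h = arith (wt D k A) (wt D k C) D (Q μ A) (Q μ C) (cross μ C A)
    (subst₂ (λ q w → wt D k A + suc D * q ≤ w + suc D * Q μ A) (Q-∪ σ dis) (over-∪ _ dis) h)
    where
    arith : ∀ a c D p q x → a + suc D * (q + p + 2 * x) ≤ c + a + suc D * p → suc D * (q + 2 * x) ≤ c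
    arith a c D p q x h = lin 0 h (solve (a ∷ c ∷ D ∷ p ∷ q ∷ x ∷ []))

  Hypothesis : ℕ → ℕ → Set
  Hypothesis D b = ∀ (V : Sub) μ k → Symmetric μ → Irreflexive μ → (∀ u → k u ≤ suc D) → Adm D V μ k → meas V k < b → Colourable V μ k

  unless : ℕ → ℕ → ℕ
  unless zero x = x
  unless (suc _) _ = 0

  -- A is contracted to its vertex a, which is forced into F; an outside vertex with an
  -- edge to the M-coloured part of A is forced into F too, unless all such edges are in ex.
  module Contract {μ : Mult} (σ : Symmetric μ) (ι : Irreflexive μ) (k : Fin N → ℕ)
    (V A : Sub {N}) (A⊆V : A ⊆ V) (a : Fin N) (a∈A : a ∈ A) (φ : Sub {N})
    (ex : Mult) (ex≤μ : ∀ {u w} → u ∈ A → w ∉ A → ex u w ≤ μ u w) where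

    outside : Sub
    outside = V ∖ A

    k₁ : Fin N → ℕ
    k₁ u = k u ∸ over outside (ex u)

    toF block exM : Fin N → ℕ
    toF w = deg μ (A ∩ ∁ φ) w
    block w = over (A ∩ φ) λ u → μ u w ∸ ex u w
    exM w = over (A ∩ φ) λ u → ex u w

    -- Every vertex of `A` gets the edges of the contracted vertex, which avoids a test for `a`; of
    -- these vertices `V′` contains only `a`.
    ν : Mult
    ν u w = if A u then (if A w then 0 else toF w) else (if A w then toF u else μ u w)

    l : Fin N → ℕ
    l w = if A w then 0 else unless (block w) (k w ∸ exM w)

    V′ : Sub
    V′ = outside +ᵥ a

    ν-sym : Symmetric ν
    ν-sym u w with A u | A w
    ... | true | true = refl
    ... | true | false = refl
    ... | false | true = refl
    ... | false | false = σ u w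

    ν-irr : Irreflexive ν
    ν-irr u with A u
    ... | true = refl
    ... | false = ι u

    ν-out : ∀ {u w} → u ∉ A → w ∉ A → ν u w ≡ μ u w
    ν-out p q rewrite p | q = refl

    ν-a : ∀ {w} → w ∉ A → ν a w ≡ toF w
    ν-a q rewrite a∈A | q = refl

    l-a : l a ≡ 0
    l-a rewrite a∈A = refl

    l-cap : ∀ {K} → (∀ u → k u ≤ K) → ∀ u → l u ≤ K
    l-cap cap u with A u | block u
    ... | true | _ = z≤n
    ... | false | zero = ≤-trans (m∸n≤m (k u) (exM u)) (cap u)
    ... | false | suc _ = z≤n

    l≤k : ∀ u → l u ≤ k u
    l≤k u with A u | block u
    ... | true | _ = z≤n
    ... | false | zero = m∸n≤m (k u) (exM u)
    ... | false | suc _ = z≤n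

    out∉A : ∀ {w} → w ∈ outside → w ∉ A
    out∉A = ∖⁻ʳ V A

    a∉out : a ∉ outside
    a∉out rewrite a∈A with V a
    ... | true = refl
    ... | false = refl

    Qν≡ : ∀ {S} → S ⊆ outside → Q ν S ≡ Q μ S
    Qν≡ {S} h = over-cong S λ p → over-cong S λ q → ν-out (out∉A (h p)) (out∉A (h q))

    Qν+a : ∀ {S} → S ⊆ outside → Q ν (S +ᵥ a) ≡ Q μ S + 2 * over S toF
    Qν+a {S} h = trans (Q-+ᵥ ν-sym ν-irr {S} {a} (∉-⊆ S outside h a∉out))
      (cong₂ (λ x y → x + 2 * y) (Qν≡ h) (over-cong S λ q → ν-a (out∉A (h q))))

    module Combine (c : IsCol A μ k₁ φ) {ψ : Sub} (c′ : IsCol V′ ν l ψ) where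

      module φ = IsCol c
      module ψ = IsCol c′

      χ : Sub
      χ v = if A v then φ v else ψ v

      χ-in : ∀ {v} → v ∈ A → χ v ≡ φ v
      χ-in p rewrite p = refl

      χ-out : ∀ {v} → v ∉ A → χ v ≡ ψ v
      χ-out p rewrite p = refl

      out⊆V′ : outside ⊆ V′
      out⊆V′ = ⊆+ᵥ outside a

      a∉ψ : a ∉ ψ
      a∉ψ with ψ a in eq
      ... | false = refl
      ... | true = case subst (suc (deg ν (V′ ∩ ψ) a) ≤_) l-a (ψ.bound (v∈+ᵥ outside a) eq) of λ ()

      l-M : ∀ {w} → w ∈ outside → w ∈ ψ → block w ≡ 0 × l w ≡ k w ∸ exM w
      l-M {w} p q = go (ψ.bound (out⊆V′ p) q)
        where
        go : ∀ {x} → suc x ≤ l w → block w ≡ 0 × l w ≡ k w ∸ exM w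
        go h rewrite out∉A p with block w
        ... | zero = refl , refl

      -- An outside vertex that ended in M was not blocked, so all its edges to the M-part of `A`
      -- are excepted ones, and `k₁` and `l` have already paid for those at both ends.
      μ≤ex : ∀ {u w} → u ∈ A → u ∈ φ → w ∈ outside → w ∈ ψ → μ u w ≤ ex u w
      μ≤ex {u} {w} p q r s = m∸n≡0⇒m≤n (n≤0⇒n≡0 (≤-trans
        (term≤over (A ∩ φ) (λ u → μ u w ∸ ex u w) (∧-true p q))
        (≤-reflexive (proj₁ (l-M r s)))))

      M∩A⊆ : (V ∩ χ) ∩ A ⊆ A ∩ φ
      M∩A⊆ {u} p with V u | A u
      M∩A⊆ p | true | true = ∧-trueˡ p
      M∩A⊆ p | true | false = ⊥-elim (true≢false (∧-trueʳ p) refl)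

      M∖A⊆out : (V ∩ χ) ∖ A ⊆ outside
      M∖A⊆out {u} p = ∖⁺ V A (∧-trueˡ (∧-trueˡ {V u ∧ χ u} p)) (∖⁻ʳ (V ∩ χ) A p)

      M∖A⊆ψ : (V ∩ χ) ∖ A ⊆ ψ
      M∖A⊆ψ {u} p = trans (sym (χ-out (out∉A (M∖A⊆out p)))) (∧-trueʳ {V u} (∧-trueˡ {V u ∧ χ u} p))

      bnd : ∀ {u} → u ∈ V → u ∈ χ → suc (deg μ (V ∩ χ) u) ≤ k u
      bnd {u} u∈V u∈χ with bool-cases (A u)
      ... | inj₁ u∈A = ≤-trans (s≤s (≤-trans (≤-reflexive (over-split (V ∩ χ) A (μ u))) (+-mono-≤
              (over-⊆ (μ u) M∩A⊆)
              (≤-trans (over-mono ((V ∩ χ) ∖ A) λ p → μ≤ex u∈A u∈φ (M∖A⊆out p) (M∖A⊆ψ p)) (over-⊆ (ex u) M∖A⊆out)))))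
              (∸-slack (deg μ (A ∩ φ) u) (k u) (over outside (ex u)) (φ.bound u∈A u∈φ))
        where
        u∈φ : u ∈ φ
        u∈φ = trans (sym (χ-in u∈A)) u∈χ
      ... | inj₂ u∉A = ≤-trans (s≤s (≤-trans (≤-reflexive (over-split′ (V ∩ χ) A (μ u))) (+-mono-≤
              (≤-trans (over-mono ((V ∩ χ) ∖ A) λ p → ≤-reflexive (sym (ν-out u∉A (out∉A (M∖A⊆out p)))))
                       (over-⊆ {S = (V ∩ χ) ∖ A} {V′ ∩ ψ} (ν u) λ p → ∧-true (out⊆V′ (M∖A⊆out p)) (M∖A⊆ψ p)))
              (≤-trans (over-⊆ (μ u) M∩A⊆) (over-mono (A ∩ φ) λ {x} p →
                 ≤-trans (≤-reflexive (σ u x)) (μ≤ex (∧-trueˡ p) (∧-trueʳ p) u∈out u∈ψ))))))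
              (∸-slack (deg ν (V′ ∩ ψ) u) (k u) (exM u) (subst (suc (deg ν (V′ ∩ ψ) u) ≤_) (proj₂ (l-M u∈out u∈ψ)) (ψ.bound (out⊆V′ u∈out) u∈ψ)))
        where
        u∈out : u ∈ outside
        u∈out = ∖⁺ V A u∈V u∉A
        u∈ψ : u ∈ ψ
        u∈ψ = trans (sym (χ-out u∉A)) u∈χ

      size-split : ∀ S → size S ≡ size (S ∩ A) + size (S ∖ A)
      size-split S = over-split S A _

      outer : ∀ {X} → Forest ν X → ∀ S → (∀ u → u ∉ S ∩ A) → S ⊆ V → S ∖ A ⊆ X → Nonempty S → Q μ S + 2 ≤ 2 * size S
      outer f S e S⊆V h ne = ≤-trans (≤-reflexive (cong (_+ 2) (sym (Qν≡ λ p → ∖⁻ʳ⇒out p))))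
        (f S (λ p → h (∖⁺ S A p (∉A p))) ne)
        where
        ∉A : ∀ {u} → u ∈ S → u ∉ A
        ∉A {u} p with A u in eq
        ... | false = refl
        ... | true = ⊥-elim (true≢false (∧-true p eq) (e u))
        ∖⁻ʳ⇒out : ∀ {u} → u ∈ S → u ∈ outside
        ∖⁻ʳ⇒out p = ∖⁺ V A (S⊆V p) (∉A p)

      -- For a set that meets `A`, the bound for its part in `A` is added to the bound for the rest
      -- together with `a`. The crossing edges are among the edges of `a`, and the additional vertex
      -- `a` uses up one of the two `+ 2`.
      fF : Forest μ (V ∩ ∁ χ)
      fF S S⊆ ne with empty? (S ∩ A)
      ... | inj₂ e = outer ψ.forestF S e (λ p → ∧-trueˡ (S⊆ p))
              (λ p → ∧-true (out⊆V′ (S₂⊆out p)) (S₂⊆F p)) ne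
        where
        S₂⊆out : S ∖ A ⊆ outside
        S₂⊆out p = ∖⁺ V A (∧-trueˡ (S⊆ (∖⁻ˡ S A p))) (∖⁻ʳ S A p)
        S₂⊆F : S ∖ A ⊆ ∁ ψ
        S₂⊆F {u} p = trans (cong not (sym (χ-out (out∉A (S₂⊆out p))))) (∧-trueʳ {V u} (S⊆ (∖⁻ˡ S A p)))
      ... | inj₁ ne₁ = subst₂ _≤_ (cong (_+ 2) (sym (Q-split σ S A))) (cong (2 *_) (sym (size-split S)))
              (arith (Q μ (S ∩ A)) (Q μ (S ∖ A)) (cross μ (S ∩ A) (S ∖ A)) (size (S ∩ A)) (size (S ∖ A)) (φ.forestF (S ∩ A) S₁⊆ ne₁)
                (subst₂ _≤_ (cong (_+ 2) (Qν+a S₂⊆out)) (cong (2 *_) (over-+ᵥ {S = S ∖ A} {a} (λ _ → 1) (∉-⊆ (S ∖ A) outside S₂⊆out a∉out)))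
                  (ψ.forestF (S ∖ A +ᵥ a) S₂a⊆ (a , v∈+ᵥ (S ∖ A) a)))
                (≤-trans (≤-reflexive (cross-sym σ (S ∩ A) (S ∖ A))) (over-mono (S ∖ A) λ _ → over-⊆ _ S₁⊆)))
        where
        S₁⊆ : S ∩ A ⊆ A ∩ ∁ φ
        S₁⊆ {u} p = ∧-true (∧-trueʳ {S u} p) (trans (cong not (sym (χ-in (∧-trueʳ {S u} p)))) (∧-trueʳ {V u} (S⊆ (∧-trueˡ {S u} p))))
        S₂⊆out : S ∖ A ⊆ outside
        S₂⊆out p = ∖⁺ V A (∧-trueˡ (S⊆ (∖⁻ˡ S A p))) (∖⁻ʳ S A p)
        S₂⊆F : S ∖ A ⊆ ∁ ψ
        S₂⊆F {u} p = trans (cong not (sym (χ-out (out∉A (S₂⊆out p))))) (∧-trueʳ {V u} (S⊆ (∖⁻ˡ S A p)))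
        S₂a⊆ : S ∖ A +ᵥ a ⊆ V′ ∩ ∁ ψ
        S₂a⊆ = +ᵥ-⊆ (S ∖ A) (V′ ∩ ∁ ψ) (λ p → ∧-true (out⊆V′ (S₂⊆out p)) (S₂⊆F p))
          (∧-true (v∈+ᵥ outside a) (not-false a∉ψ))
        arith : ∀ q₁ q₂ c s₁ s₂ {t} → q₁ + 2 ≤ 2 * s₁ → q₂ + 2 * t + 2 ≤ 2 * (s₂ + 1) → c ≤ t → q₁ + q₂ + 2 * c + 2 ≤ 2 * (s₁ + s₂)
        arith q₁ q₂ c s₁ s₂ {t} p q r = lin 0 (p ⊕ q ⊕ 2 ⊛ r) (solve (q₁ ∷ q₂ ∷ c ∷ s₁ ∷ s₂ ∷ t ∷ []))

      -- Two forests joined by at most one edge form a forest; with capacities at most 2 the part M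
      -- is a matching, whatever the number of crossing edges.
      fM : over A (λ u → over outside (ex u)) ≤ 1 ⊎ (∀ u → k u ≤ 2) → Forest μ (V ∩ χ)
      fM (inj₂ k≤2) = matching-forest σ ι (V ∩ χ) λ {u} p → ≤-pred (≤-trans (bnd (∧-trueˡ p) (∧-trueʳ {V u} p)) (k≤2 u))
      fM (inj₁ ex≤1) = main
        where
        main : Forest μ (V ∩ χ)
        main S S⊆ ne with empty? (S ∩ A) | empty? (S ∖ A)
        ... | inj₂ e | _ = outer ψ.forestM S e (λ p → ∧-trueˡ (S⊆ p))
                (λ {u} p → ∧-true (out⊆V′ (M∖A⊆out (h p))) (M∖A⊆ψ (h p))) ne
          where
          h : S ∖ A ⊆ (V ∩ χ) ∖ A
          h {u} p = ∖⁺ (V ∩ χ) A (S⊆ (∖⁻ˡ S A p)) (∖⁻ʳ S A p)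
        ... | inj₁ ne₁ | inj₂ e = φ.forestM S (λ {u} p → M∩A⊆ {u} (∧-true (S⊆ p) (inA u p))) ne
          where
          inA : ∀ u → u ∈ S → u ∈ A
          inA u p with A u in eq
          ... | true = refl
          ... | false = ⊥-elim (true≢false (∖⁺ S A p eq) (e u))
        ... | inj₁ ne₁ | inj₁ ne₂ = subst₂ _≤_ (cong (_+ 2) (sym (Q-split σ S A))) (cong (2 *_) (sym (size-split S)))
              (arith (Q μ (S ∩ A)) (Q μ (S ∖ A)) (cross μ (S ∩ A) (S ∖ A)) (size (S ∩ A)) (size (S ∖ A)) (φ.forestM (S ∩ A) S₁⊆ ne₁)
                (subst (λ q → q + 2 ≤ 2 * size (S ∖ A)) (Qν≡ S₂⊆out)
                  (ψ.forestM (S ∖ A) (λ p → ∧-true (out⊆V′ (S₂⊆out p)) (M∖A⊆ψ (h p))) ne₂))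
                (≤-trans (over-mono (S ∩ A) λ {u} p → ≤-trans
                   (over-mono (S ∖ A) λ q → μ≤ex (∧-trueˡ (S₁⊆ p)) (∧-trueʳ (S₁⊆ p)) (S₂⊆out q) (M∖A⊆ψ (h q)))
                   (over-⊆ (ex u) S₂⊆out))
                 (≤-trans (over-⊆ _ λ {u} → ∧-trueʳ {S u}) ex≤1)))
          where
          S₁⊆ : S ∩ A ⊆ A ∩ φ
          S₁⊆ {u} p = M∩A⊆ (∧-true (S⊆ (∧-trueˡ p)) (∧-trueʳ {S u} p))
          h : S ∖ A ⊆ (V ∩ χ) ∖ A
          h {u} p = ∖⁺ (V ∩ χ) A (S⊆ (∖⁻ˡ S A p)) (∖⁻ʳ S A p)
          S₂⊆out : S ∖ A ⊆ outside
          S₂⊆out p = M∖A⊆out (h p)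
          arith : ∀ q₁ q₂ c s₁ s₂ → q₁ + 2 ≤ 2 * s₁ → q₂ + 2 ≤ 2 * s₂ → c ≤ 1 → q₁ + q₂ + 2 * c + 2 ≤ 2 * (s₁ + s₂)
          arith q₁ q₂ c s₁ s₂ p q r = lin 0 (p ⊕ q ⊕ 2 ⊛ r) (solve (q₁ ∷ q₂ ∷ c ∷ s₁ ∷ s₂ ∷ []))

      combined : over A (λ u → over outside (ex u)) ≤ 1 ⊎ (∀ u → k u ≤ 2) → IsCol V μ k χ
      combined cond = record { bound = bnd ; forestM = fM cond ; forestF = fF }

    module Admissible (D : ℕ) (cap : ∀ u → k u ≤ suc D) where

      exA : Fin N → ℕ
      exA w = over A λ u → ex u w

      -- Lost capacity is charged to the edges into the M-part of `A`: at most `suc D` to a blocking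
      -- edge, 1 to an excepted one.
      k≤ : ∀ {w} → w ∉ A → k w ≤ l w + suc D * block w + exM w
      k≤ {w} w∉A rewrite w∉A with block w
      ... | suc b = ≤-trans (cap w) (≤-trans (≤-trans (m≤m*n (suc D) (suc b)) (m≤n+m _ 0)) (m≤m+n _ _))
      ... | zero = ≤-trans (m≤n+m∸n (k w) (exM w)) (≤-reflexive (arith (exM w) (k w ∸ exM w) (suc D)))
        where
        arith : ∀ x y d → x + y ≡ y + d * 0 + x
        arith x y d = solve (x ∷ y ∷ d ∷ [])

      degA : ∀ {w} → w ∉ A → deg μ A w ≡ toF w + (block w + exM w)
      degA {w} w∉A = trans (over-split′ A φ (μ w))
        (cong (toF w +_) (trans (over-cong (A ∩ φ) λ {u} p →
           trans (σ w u) (sym (m∸n+n≡m (ex≤μ (∧-trueˡ p) w∉A)))) (over-+ (A ∩ φ) _ _)))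

      exA≤ : ∀ {w} → w ∉ A → exA w ≤ toF w + exM w
      exA≤ {w} w∉A = ≤-trans (≤-reflexive (over-split′ A φ (λ u → ex u w)))
        (+-monoˡ-≤ (exM w) (over-mono (A ∩ ∁ φ) λ {u} p → ≤-trans (ex≤μ (∧-trueˡ p) w∉A) (≤-reflexive (σ u w))))

      module _ (C : Sub) (C⊆ : C ⊆ outside) where

        β ξ f : ℕ
        β = over C block
        ξ = over C exM
        f = over C toF

        wt≤ : wt D k C ≤ wt D l C + 2 * (suc D * β + ξ)
        wt≤ = ≤-trans (over-mono C λ {u} p → arith (k u) (l u) (suc D * block u) (exM u) (2 * D + 1) (k≤ (out∉A (C⊆ p))))
          (≤-reflexive (trans (over-+ C _ _) (cong (wt D l C +_)
            (trans (over-* C 2 _) (cong (2 *_) (trans (over-+ C _ _) (cong (_+ ξ) (over-* C (suc D) block))))))))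
          where
          arith : ∀ a b c d e → a ≤ b + c + d → 2 * a + e ≤ (2 * b + e) + 2 * (c + d)
          arith a b c d e p = lin 0 (2 ⊛ p) (solve (a ∷ b ∷ c ∷ d ∷ e ∷ []))

        cross≡ : cross μ C A ≡ f + (β + ξ)
        cross≡ = trans (over-cong C λ p → degA (out∉A (C⊆ p)))
          (trans (over-+ C _ _) (cong (f +_) (over-+ C _ _)))

        exA-sum : over C exA ≤ f + ξ
        exA-sum = ≤-trans (over-mono C λ p → exA≤ (out∉A (C⊆ p))) (≤-reflexive (over-+ C _ _))

      -- Each edge from `C` to `A` costs at most the price of an edge, with a rebate of `2 * D` if
      -- it is excepted. The first bound serves the sets without `a`; the second serves the sets
      -- with `a`, which gain the weight `2 * D + 1` of a vertex of capacity 0 on top of the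
      -- allowance 1.
      adm : (∀ C → C ⊆ outside → Nonempty C → suc D * (Q μ C + 2 * cross μ C A) ≤ wt D k C + 1 + 2 * D * over C exA) →
            (∀ C → C ⊆ outside → Nonempty C → suc D * (Q μ C + 2 * cross μ C A) ≤ wt D k C + (2 * D + 2)) →
            Adm D V′ ν l
      adm H₁ H₂ S S⊆ ne with bool-cases (S a)
      ... | inj₂ a∉S = subst (λ q → suc D * q ≤ wt D l S + 1) (sym (Qν≡ S⊆out))
              (arith D (Q μ S) (f S S⊆out) (β S S⊆out) (ξ S S⊆out) _ _ _ _
                (H₁ S S⊆out ne) (wt≤ S S⊆out) (cross≡ S S⊆out) (exA-sum S S⊆out))
        where
        S⊆out : S ⊆ outside
        S⊆out {u} p with ∪⁻ outside ｛ a ｝ (S⊆ p)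
        ... | inj₁ q = q
        ... | inj₂ q = ⊥-elim (∈∉⇒≢ {S = S} p a∉S (∈-｛｝⁻ q))
        arith : ∀ D q f β ξ c x w w′ → suc D * (q + 2 * c) ≤ w + 1 + 2 * D * x → w ≤ w′ + 2 * (suc D * β + ξ) →
          c ≡ f + (β + ξ) → x ≤ f + ξ → suc D * q ≤ w′ + 1
        arith D q f β ξ _ x w w′ p r refl s = lin (2 * f) (p ⊕ r ⊕ 2 * D ⊛ s) (solve (D ∷ q ∷ f ∷ β ∷ ξ ∷ x ∷ w ∷ w′ ∷ []))
      ... | inj₁ a∈S = subst₂ (λ q w → suc D * q ≤ w + 1) (sym Q≡) (sym wt≡) (main (empty? (S - a)))
        where
        C⊆out : S - a ⊆ outside
        C⊆out = -⊆ S outside S⊆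
        Q≡ : Q ν S ≡ Q μ (S - a) + 2 * f (S - a) C⊆out
        Q≡ = trans (Q-≗ ν (-+ᵥ S a∈S)) (Qν+a C⊆out)
        wt≡ : wt D l S ≡ wt D l (S - a) + (2 * D + 1)
        wt≡ = trans (over-remove _ a∈S) (cong (λ x → wt D l (S - a) + (2 * x + (2 * D + 1))) l-a)
        arith : ∀ D q f β ξ c w w′ → suc D * (q + 2 * c) ≤ w + (2 * D + 2) → w ≤ w′ + 2 * (suc D * β + ξ) →
          c ≡ f + (β + ξ) → suc D * (q + 2 * f) ≤ w′ + (2 * D + 1) + 1
        arith D q f β ξ _ w w′ p r refl = lin (2 * D * ξ) (p ⊕ r) (solve (D ∷ q ∷ f ∷ β ∷ ξ ∷ w ∷ w′ ∷ []))
        main : Nonempty (S - a) ⊎ (∀ u → u ∉ S - a) → suc D * (Q μ (S - a) + 2 * f (S - a) C⊆out) ≤ wt D l (S - a) + (2 * D + 1) + 1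
        main (inj₁ ne′) = arith D (Q μ (S - a)) (f (S - a) C⊆out) (β (S - a) C⊆out) (ξ (S - a) C⊆out) (cross μ (S - a) A) (wt D k (S - a)) (wt D l (S - a))
          (H₂ (S - a) C⊆out ne′) (wt≤ (S - a) C⊆out) (cross≡ (S - a) C⊆out)
        main (inj₂ e) = subst (_≤ wt D l (S - a) + (2 * D + 1) + 1)
          (sym (trans (cong₂ (λ x y → suc D * (x + 2 * y)) (Q-empty μ e) (over-zero (S - a) λ {u} p → ⊥-elim (true≢false p (e u)))) (*-zeroʳ (suc D))))
          z≤n

    meas-V : meas V k ≡ over (V ∩ A) (λ u → suc (k u)) + meas outside k
    meas-V = over-split V A _

    A⊆V∩A : A ⊆ V ∩ A
    A⊆V∩A p = ∧-true (A⊆V p) p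

    -- The vertices of `A` count at least 2 together, whereas `a` with capacity 0 counts 1.
    meas-contract : 2 ≤ size A → meas V′ l < meas V k
    meas-contract sA = subst₂ _<_ (sym (over-+ᵥ {S = outside} _ a∉out)) (sym meas-V)
      (arith _ _ (l a) _ l-a (over-mono outside λ {u} _ → s≤s (l≤k u))
        (≤-trans sA (≤-trans (over-⊆ _ A⊆V∩A) (over-mono (V ∩ A) λ _ → s≤s z≤n))))
      where
      arith : ∀ p q x r → x ≡ 0 → p ≤ q → 2 ≤ r → suc (p + suc x) ≤ r + q
      arith p q x r refl h i = lin 0 (h ⊕ i) (solve (p ∷ q ∷ r ∷ []))

    meas-part : Nonempty outside → meas A k₁ < meas V k
    meas-part ne = subst (meas A k₁ <_) (sym meas-V)
      (arith _ _ _ (≤-trans (over-mono A λ {u} _ → s≤s (m∸n≤m (k u) (over outside (ex u)))) (over-⊆ _ A⊆V∩A))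
        (≤-trans (size-pos outside ne) (over-mono outside λ _ → s≤s z≤n)))
      where
      arith : ∀ p q r → p ≤ q → 1 ≤ r → suc p ≤ q + r
      arith p q r h i = lin 0 (h ⊕ i) (solve (p ∷ q ∷ r ∷ []))

-- The potential gap

-- The first three ranges call for 0, 1 and 2 excepted edges in `gap-from`; in the last one the gap
-- 4 is already there.
classify : ∀ a q → a ≤ q ⊎ (q + 1 ≤ a × a ≤ q + 2) ⊎ (q + 3 ≤ a × a ≤ q + 3) ⊎ q + 4 ≤ a
classify a q with a ≤? q | a ≤? q + 2 | a ≤? q + 3
... | yes h | _ | _ = inj₁ h
... | no h | yes h′ | _ = inj₂ (inj₁ (≤-trans (≤-reflexive (+-comm q 1)) (≰⇒> h) , h′))
... | no _ | no h | yes h′ = inj₂ (inj₂ (inj₁ (≤-trans (≤-reflexive (+-suc q 2)) (≰⇒> h) , h′)))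
... | no _ | no _ | no h = inj₂ (inj₂ (inj₂ (≤-trans (≤-reflexive (+-suc q 3)) (≰⇒> h))))

module _ {N : ℕ} where

  -- The search for subsets runs over bit vectors, which agree with a given subset only pointwise.
  Respects≗ : (Sub {N} → Set) → Set
  Respects≗ P = ∀ {S T : Sub {N}} → (∀ v → S v ≡ T v) → P S → P T

  any-subset? : ∀ {P : Sub {N} → Set} → Respects≗ P → (∀ S → Dec (P S)) → Dec (∃ P)
  any-subset? resp P? with anySubset? (λ xs → P? (lookup xs))
  ... | yes (xs , p) = yes (lookup xs , p)
  ... | no ¬p = no λ { (S , p) → ¬p (tabulateᵛ S , resp (λ v → sym (lookup∘tabulate S v)) p) }

  minimise : ∀ {P : Sub {N} → Set} → Respects≗ P → (∀ S → Dec (P S)) →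
    (f : Sub {N} → ℕ) → (∀ {S T} → (∀ v → S v ≡ T v) → f S ≡ f T) →
    ∀ S → P S → ∃ λ A → P A × (∀ B → P B → f A ≤ f B)
  minimise {P} resp P? f f-resp S p = go S p (<-wellFounded (f S))
    where
    go : ∀ S → P S → Acc _<_ (f S) → ∃ λ A → P A × (∀ B → P B → f A ≤ f B)
    go S p (acc rec) with any-subset? {λ T → P T × f T < f S}
      (λ { e (q , r) → resp e q , subst (_< f S) (f-resp e) r }) (λ T → P? T ×-dec (suc (f T) ≤? f S))
    ... | yes (T , q , r) = go T q (rec r)
    ... | no ¬T = S , p , λ B q → ≮⇒≥ λ r → ¬T (B , q , r)

  ⊆? : ∀ (S T : Sub {N}) → Dec (S ⊆ T)
  ⊆? S T with empty? (S ∖ T)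
  ... | inj₁ (v , p) = no λ h → true≢false (h (∖⁻ˡ S T p)) (∖⁻ʳ S T p)
  ... | inj₂ e = yes λ {v} p → case bool-cases (T v) of λ
    { (inj₁ q) → q ; (inj₂ q) → ⊥-elim (true≢false (∖⁺ S T p q) (e v)) }

  nonempty? : ∀ (S : Sub {N}) → Dec (Nonempty S)
  nonempty? S with empty? S
  ... | inj₁ p = yes p
  ... | inj₂ e = no λ { (v , p) → true≢false p (e v) }

  -- A minimiser of the potential wt − (D + 1) Q, with the negative terms moved across.
  min-potential : ∀ D V (μ : Mult) k {P : Sub {N} → Set} → Respects≗ P → (∀ S → Dec (P S)) →
    (∀ {S} → P S → S ⊆ V) → ∀ S → P S →
    ∃ λ A → P A × (∀ B → P B → wt D k A + suc D * Q μ B ≤ wt D k B + suc D * Q μ A)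
  min-potential D V μ k {P} resp P? P⊆ S p with minimise resp P? val val-resp S p
    where
    val : Sub → ℕ
    -- Inside `V` the subtraction is exact, so this is the potential shifted by a constant into the
    -- natural numbers.
    val T = wt D k T + suc D * (Q μ V ∸ Q μ T)
    val-resp : ∀ {S T} → (∀ v → S v ≡ T v) → val S ≡ val T
    val-resp e = cong₂ (λ w q → w + suc D * (Q μ V ∸ q)) (over-≗ _ e) (Q-≗ μ e)
  ... | A , pA , min = A , pA , λ B pB → arith (wt D k A) (wt D k B) (suc D) (Q μ A) (Q μ B) (Q μ V ∸ Q μ A) (Q μ V ∸ Q μ B)
        (min B pB) (trans (m+[n∸m]≡n (Q≤ pA)) (sym (m+[n∸m]≡n (Q≤ pB))))
    where
    Q≤ : ∀ {T} → P T → Q μ T ≤ Q μ V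
    Q≤ {T} pT = ≤-trans (over-⊆ _ (P⊆ pT)) (over-mono V λ _ → over-⊆ _ (P⊆ pT))
    arith : ∀ a b d q r x y → a + d * x ≤ b + d * y → q + x ≡ r + y → a + d * r ≤ b + d * q
    arith a b d q r x y h e = lin 0 (h ⊕ d ⊛ ≤-reflexive (sym e)) (solve (a ∷ b ∷ d ∷ q ∷ r ∷ x ∷ y ∷ []))

  module Gap (D : ℕ) (1≤D : 1 ≤ D) (V : Sub {N}) {μ : Mult} (σ : Symmetric μ) (ι : Irreflexive μ)
    (k : Fin N → ℕ) (cap : ∀ u → k u ≤ suc D) (adm : Adm D V μ k)
    (IH : Hypothesis {N} D (meas V k)) where

    -- Both conditions serve the induction: a vertex outside makes `A` smaller than `V`, and two
    -- vertices inside make the contraction smaller than `V`.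
    Proper : Sub → Set
    Proper S = S ⊆ V × Nonempty (V ∖ S) × 2 ≤ size S

    proper-resp : Respects≗ Proper
    proper-resp {S} {T} e (h , (v , p) , s) =
      (λ {u} q → h (trans (e u) q)) , (v , trans (cong (λ b → V v ∧ not b) (sym (e v))) p) , subst (2 ≤_) (over-≗ _ e) s

    proper? : ∀ S → Dec (Proper S)
    proper? S = ⊆? S V ×-dec (nonempty? (V ∖ S) ×-dec (2 ≤? size S))

    -- At δ crossing edges, k is lowered by one at both ends instead of forbidding both ends in M:
    -- each costs 2 inside A and 2 outside, where the edge itself pays 2 (D + 1).
    module _ (A : Sub) (pA : Proper A)
      (min : ∀ B → Proper B → wt D k A + suc D * Q μ B ≤ wt D k B + suc D * Q μ A)
      (δ : ℕ) (lo : suc D * Q μ A + 2 * δ ≤ wt D k A + 1)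
      (hi₁ : wt D k A ≤ suc D * Q μ A + 2 * D * δ)
      (hi₂ : wt D k A ≤ suc D * Q μ A + (2 * D + 1))
      (few : δ ≤ 1 ⊎ (∀ u → k u ≤ 2)) (δ≤ : δ ≤ suc D) where

      private
        A⊆V = proj₁ pA
        out : Sub
        out = V ∖ A

        neA : Nonempty A
        neA = size-nonempty A (≤-trans (s≤s z≤n) (proj₂ (proj₂ pA)))

        lo-sub : ∀ S → S ⊆ V → Nonempty (V ∖ S) → Nonempty S → suc D * Q μ S + 2 * δ ≤ wt D k S + 1 ⊎ Q μ S ≡ 0
        lo-sub S S⊆V neV∖S ne with size-or-Q σ ι {S} ne
        ... | inj₂ q0 = inj₂ q0
        ... | inj₁ s = inj₁ (arith (wt D k A) (wt D k S) (suc D * Q μ A) (suc D * Q μ S) (2 * δ) (min S (S⊆V , neV∖S , s)) lo)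
          where
          arith : ∀ a s p q d → a + q ≤ s + p → p + d ≤ a + 1 → q + d ≤ s + 1
          arith a s p q d h i = lin 0 (h ⊕ i) (solve (a ∷ s ∷ p ∷ q ∷ d ∷ []))

        record Chosen : Set where
          field
            ex : Mult
            ex≤μ : ∀ {u w} → u ∈ A → w ∉ A → ex u w ≤ μ u w
            t : ℕ
            total : over A (λ u → over out (ex u)) ≡ t
            t≤δ : t ≤ δ
            -- If fewer than `δ` edges cross, all of them are excepted.
            full : t ≡ δ ⊎ t ≡ cross μ A out

        choose : Chosen
        choose with ≤-total δ (cross μ A out)
        ... | inj₁ le = pick δ le ≤-refl (inj₁ refl)
          where
          pick : ∀ t → t ≤ cross μ A out → t ≤ δ → t ≡ δ ⊎ t ≡ cross μ A out → Chosen
          pick t le t≤δ f with over-trim A (deg μ out) t le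
          ... | g , g≤ , eq = record
            { ex = λ u → proj₁ (row u) ; ex≤μ = λ {u} {w} _ _ → proj₁ (proj₂ (row u)) w ; t = t
            ; total = trans (over-cong A λ {u} _ → proj₂ (proj₂ (row u))) eq ; t≤δ = t≤δ ; full = f }
            where
            row : ∀ u → ∃ λ (h : Fin N → ℕ) → (∀ w → h w ≤ μ u w) × over out h ≡ g u
            row u = over-trim out (μ u) (g u) (g≤ u)
        ... | inj₂ ge = record { ex = μ ; ex≤μ = λ _ _ → ≤-refl ; t = cross μ A out ; total = refl ; t≤δ = ge ; full = inj₂ refl }

        open Chosen choose

        k₁ : Fin N → ℕ
        k₁ u = k u ∸ over out (ex u)

        adm₁ : Adm D A μ k₁
        adm₁ S S⊆A ne with lo-sub S (λ p → A⊆V (S⊆A p)) (proj₁ (proj₁ (proj₂ pA)) , V∖S) ne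
          where
          V∖S : _ ∈ V ∖ S
          V∖S = ∖⁺ V S (∖⁻ˡ V A (proj₂ (proj₁ (proj₂ pA))))
            (∉-⊆ S A S⊆A (∖⁻ʳ V A (proj₂ (proj₁ (proj₂ pA)))))
        ... | inj₂ q0 = subst (λ q → suc D * q ≤ wt D k₁ S + 1) (sym q0) (subst (_≤ wt D k₁ S + 1) (sym (*-zeroʳ (suc D))) z≤n)
        ... | inj₁ h = arith (suc D * Q μ S) δ t (wt D k S) (wt D k₁ S) h wt≤ t≤δ
          where
          wt≤ : wt D k S ≤ wt D k₁ S + 2 * t
          wt≤ = ≤-trans (over-mono S λ {u} _ → pt (k u) (over out (ex u)) (2 * D + 1))
            (≤-trans (≤-reflexive (over-+ S _ _)) (+-monoʳ-≤ (wt D k₁ S)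
              (≤-trans (≤-reflexive (over-* S 2 _)) (2 ⊛ ≤-trans (over-⊆ _ S⊆A) (≤-reflexive total)))))
            where
            arith′ : ∀ a b c d → a ≤ c + b → 2 * a + d ≤ (2 * b + d) + 2 * c
            arith′ a b c d p = lin 0 (2 ⊛ p) (solve (a ∷ b ∷ c ∷ d ∷ []))
            pt : ∀ a c d → 2 * a + d ≤ (2 * (a ∸ c) + d) + 2 * c
            pt a c d = arith′ a (a ∸ c) c d (m≤n+m∸n a c)
          arith : ∀ q δ t w w′ → q + 2 * δ ≤ w + 1 → w ≤ w′ + 2 * t → t ≤ δ → q ≤ w′ + 1
          arith q δ t w w′ p r s = lin 0 (p ⊕ r ⊕ 2 ⊛ s) (solve (q ∷ δ ∷ t ∷ w ∷ w′ ∷ []))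

      -- `lo` keeps `A` admissible although it gives up 2 for each excepted edge. `hi₁` and `hi₂`
      -- keep the contraction admissible when a set covers the whole outside, without and with `a`;
      -- if a vertex is missing, the minimality of `A` is enough.
      minimal-set-colours : Colourable V μ k
      minimal-set-colours = χ , combined (few′ few)
        where
        a = proj₁ neA
        a∈A = proj₂ neA
        -- `meas-part` is needed to obtain the colouring of `A` but does not depend on it, so `∅`
        -- stands in for the colouring.
        module C₀ = Contract σ ι k V A A⊆V a a∈A ∅ ex ex≤μ
        colA : Colourable A μ k₁
        colA = IH A μ k₁ σ ι (λ u → ≤-trans (m∸n≤m (k u) (over out (ex u))) (cap u)) adm₁ (C₀.meas-part (proj₁ (proj₂ pA)))
        open Contract σ ι k V A A⊆V a a∈A (proj₁ colA) ex ex≤μ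
        open Admissible D cap using (exA) renaming (adm to contract-adm)

        disj : ∀ {C} → C ⊆ outside → ∀ {v} → v ∈ C → v ∉ A
        disj C⊆ p = out∉A (C⊆ p)

        whole : ∀ C → C ⊆ outside → Nonempty C → (∀ v → v ∉ outside ∖ C) →
          suc D * (Q μ C + Q μ A + 2 * cross μ C A) ≤ wt D k C + wt D k A + 1
        whole C C⊆ (c , c∈C) _ = subst₂ (λ q w → suc D * q ≤ w + 1) (Q-∪ σ (disj C⊆)) (over-∪ _ (disj C⊆))
          (adm (C ∪ A) (λ {u} p → case ∪⁻ C A p of λ { (inj₁ q) → ∖⁻ˡ V A (C⊆ q) ; (inj₂ q) → A⊆V q })
            (c , ∪⁺ˡ C A c∈C))

        part : ∀ C → C ⊆ outside → Nonempty (outside ∖ C) → suc D * (Q μ C + 2 * cross μ C A) ≤ wt D k C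
        part C C⊆ (v , p) = superset-potential D σ k (disj C⊆)
            (min (C ∪ A) (sub , (v , ∖⁺ V (C ∪ A) (∖⁻ˡ V A v∈out) v∉) , ≤-trans (proj₂ (proj₂ pA)) (over-⊆ _ (∪⁺ʳ C A))))
          where
          v∈out : v ∈ outside
          v∈out = ∖⁻ˡ outside C p
          v∉ : v ∉ C ∪ A
          v∉ rewrite ∖⁻ʳ outside C p = out∉A v∈out
          sub : C ∪ A ⊆ V
          sub {u} p = case ∪⁻ C A p of λ { (inj₁ q) → ∖⁻ˡ V A (C⊆ q) ; (inj₂ q) → A⊆V q }

        out⊆C : ∀ C → (∀ v → v ∉ outside ∖ C) → outside ⊆ C
        out⊆C C e {v} p = case bool-cases (C v) of λ { (inj₁ q) → q ; (inj₂ q) → ⊥-elim (true≢false (∖⁺ outside C p q) (e v)) }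

        exA-total : ∀ C → outside ⊆ C → t ≤ over C exA
        exA-total C h = ≤-trans (≤-reflexive (trans (sym total) (over-swap A outside ex))) (over-⊆ exA h)

        H₁ : ∀ C → C ⊆ outside → Nonempty C → suc D * (Q μ C + 2 * cross μ C A) ≤ wt D k C + 1 + 2 * D * over C exA
        H₁ C C⊆ ne with empty? (outside ∖ C)
        ... | inj₁ ne′ = ≤-trans (part C C⊆ ne′) (≤-trans (m≤m+n _ 1) (m≤m+n _ _))
        ... | inj₂ e with full
        ...   | inj₁ t≡δ = arith (wt D k A) (wt D k C) D (Q μ A) (Q μ C) (cross μ C A) δ (over C exA) (whole C C⊆ ne e) hi₁
                (subst (_≤ over C exA) t≡δ (exA-total C (out⊆C C e)))
          where
          arith : ∀ a c D p q x δ y → suc D * (q + p + 2 * x) ≤ c + a + 1 → a ≤ suc D * p + 2 * D * δ → δ ≤ y →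
            suc D * (q + 2 * x) ≤ c + 1 + 2 * D * y
          arith a c D p q x δ y h i j = lin 0 (h ⊕ i ⊕ 2 * D ⊛ j) (solve (a ∷ c ∷ D ∷ p ∷ q ∷ x ∷ δ ∷ y ∷ []))
        -- Every crossing edge is excepted and costs `C` only 2. Either `C` is a proper set of
        -- potential at least 2δ - 1, or it has no edges and `δ ≤ suc D` bounds the cost by the
        -- weight of one vertex and the allowance 1.
        ...   | inj₂ t≡c = arith (wt D k C) D (Q μ C) (cross μ C A) (over C exA) t (Qpart (lo-sub C (λ p → ∖⁻ˡ V A (C⊆ p)) (a , a∈) ne)) x≤t
                (exA-total C (out⊆C C e))
          where
          a∈ : a ∈ V ∖ C
          a∈ = ∖⁺ V C (A⊆V a∈A) (∉-⊆ C outside C⊆ a∉out)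
          x≤t : cross μ C A ≤ t
          x≤t = ≤-trans (over-⊆ _ C⊆) (≤-reflexive (trans (cross-sym σ outside A) (sym t≡c)))
          Qpart : suc D * Q μ C + 2 * δ ≤ wt D k C + 1 ⊎ Q μ C ≡ 0 → suc D * Q μ C + 2 * t ≤ wt D k C + 1
          Qpart (inj₁ h) = ≤-trans (+-monoʳ-≤ (suc D * Q μ C) (2 ⊛ t≤δ)) h
          Qpart (inj₂ q0) rewrite q0 | *-zeroʳ D = ≤-trans (2 ⊛ ≤-trans t≤δ δ≤)
            (≤-trans (≤-reflexive (ar D)) (+-monoˡ-≤ 1 (≤-trans (m≤n+m (2 * D + 1) (2 * k (proj₁ ne)))
              (term≤over C (λ u → 2 * k u + (2 * D + 1)) (proj₂ ne)))))
            where
            ar : ∀ D → 2 * suc D ≡ 2 * D + 1 + 1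
            ar D = solve (D ∷ [])
          arith : ∀ c D q x y t → suc D * q + 2 * t ≤ c + 1 → x ≤ t → t ≤ y → suc D * (q + 2 * x) ≤ c + 1 + 2 * D * y
          arith c D q x y t h i j = lin 0 (h ⊕ 2 * suc D ⊛ i ⊕ 2 * D ⊛ j) (solve (c ∷ D ∷ q ∷ x ∷ y ∷ t ∷ []))

        H₂ : ∀ C → C ⊆ outside → Nonempty C → suc D * (Q μ C + 2 * cross μ C A) ≤ wt D k C + (2 * D + 2)
        H₂ C C⊆ ne with empty? (outside ∖ C)
        ... | inj₁ ne′ = ≤-trans (part C C⊆ ne′) (m≤m+n _ _)
        ... | inj₂ e = arith (wt D k A) (wt D k C) D (Q μ A) (Q μ C) (cross μ C A) (whole C C⊆ ne e) hi₂
          where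
          arith : ∀ a c D p q x → suc D * (q + p + 2 * x) ≤ c + a + 1 → a ≤ suc D * p + (2 * D + 1) →
            suc D * (q + 2 * x) ≤ c + (2 * D + 2)
          arith a c D p q x h i = lin 0 (h ⊕ i) (solve (a ∷ c ∷ D ∷ p ∷ q ∷ x ∷ []))

        colC : Colourable V′ ν l
        colC = IH V′ ν l ν-sym ν-irr (l-cap cap) (contract-adm H₁ H₂) (meas-contract (proj₂ (proj₂ pA)))
        open Combine (proj₂ colA) (proj₂ colC)

        few′ : δ ≤ 1 ⊎ (∀ u → k u ≤ 2) → over A (λ u → over outside (ex u)) ≤ 1 ⊎ (∀ u → k u ≤ 2)
        few′ (inj₁ δ≤1) = inj₁ (≤-trans (≤-reflexive total) (≤-trans t≤δ δ≤1))
        few′ (inj₂ h) = inj₂ h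

    GapBy : ℕ → Set
    GapBy g = ∀ S → Proper S → suc D * Q μ S + g ≤ wt D k S

    -- Least potential at most 0, equal to 1 or 2, and equal to 3 is met by δ = 0, 1, 2. Two
    -- excepted edges between the M-parts could close a cycle unless capacities are at most 2, so
    -- the value 3 is excluded only for D = 1.
    gap-from : ∀ A → Proper A →
      (∀ B → Proper B → wt D k A + suc D * Q μ B ≤ wt D k B + suc D * Q μ A) →
      Colourable V μ k ⊎ GapBy 3 × (D ≡ 1 → GapBy 4)
    gap-from A pA min = cases (classify a q) (D ≟ℕ 1)
      where
      a q : ℕ
      a = wt D k A
      q = suc D * Q μ A
      above : ∀ g → q + g ≤ a → GapBy g
      above g h S p = arith a (wt D k S) q (suc D * Q μ S) g (min S p) h
        where
        arith : ∀ a s p q g → a + q ≤ s + p → p + g ≤ a → q + g ≤ s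
        arith a s p q g h i = lin 0 (h ⊕ i) (solve (a ∷ s ∷ p ∷ q ∷ g ∷ []))
      ne : Nonempty A
      ne = size-nonempty A (≤-trans (s≤s z≤n) (proj₂ (proj₂ pA)))
      bump : ∀ q a c → q + c ≤ a → q + (c + 1) ≤ a + 1
      bump q a c h = lin 0 h (solve (q ∷ a ∷ c ∷ []))
      cases : a ≤ q ⊎ (q + 1 ≤ a × a ≤ q + 2) ⊎ (q + 3 ≤ a × a ≤ q + 3) ⊎ q + 4 ≤ a → Dec (D ≡ 1) →
        Colourable V μ k ⊎ GapBy 3 × (D ≡ 1 → GapBy 4)
      cases (inj₁ h) _ = inj₁ (minimal-set-colours A pA min 0
        (≤-trans (≤-reflexive (+-identityʳ q)) (adm A (proj₁ pA) ne))
        (≤-trans h (m≤m+n q (2 * D * 0))) (≤-trans h (m≤m+n q (2 * D + 1))) (inj₁ z≤n) z≤n)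
      cases (inj₂ (inj₁ (h , h′))) _ = inj₁ (minimal-set-colours A pA min 1 (bump q a 1 h)
        (≤-trans h′ (+-monoʳ-≤ q (≤-trans (2 ⊛ 1≤D) (≤-reflexive (sym (*-identityʳ (2 * D)))))))
        (≤-trans h′ (+-monoʳ-≤ q (≤-trans (2 ⊛ 1≤D) (m≤m+n (2 * D) 1)))) (inj₁ ≤-refl) (s≤s z≤n))
      cases (inj₂ (inj₂ (inj₁ (h , h′)))) (no D≢1) = inj₂ (above 3 h , λ D≡1 → ⊥-elim (D≢1 D≡1))
      cases (inj₂ (inj₂ (inj₁ (h , h′)))) (yes D≡1) = inj₁ (minimal-set-colours A pA min 2 (bump q a 3 h)
        (≤-trans h′ (+-monoʳ-≤ q (subst (λ d → 3 ≤ 2 * d * 2) (sym D≡1) (s≤s (s≤s (s≤s z≤n))))))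
        (≤-trans h′ (+-monoʳ-≤ q (subst (λ d → 3 ≤ 2 * d + 1) (sym D≡1) ≤-refl)))
        (inj₂ λ u → subst (λ d → k u ≤ suc d) D≡1 (cap u)) (subst (λ d → 2 ≤ suc d) (sym D≡1) ≤-refl))
      cases (inj₂ (inj₂ (inj₂ h))) _ = inj₂ (above 3 (≤-trans (+-monoʳ-≤ q (n≤1+n 3)) h) , λ _ → above 4 h)

    gap : Colourable V μ k ⊎ GapBy 3 × (D ≡ 1 → GapBy 4)
    gap = go (any-subset? proper-resp proper?)
      where
      go : Dec (∃ Proper) → Colourable V μ k ⊎ GapBy 3 × (D ≡ 1 → GapBy 4)
      go (no ¬p) = inj₂ ((λ S p → ⊥-elim (¬p (S , p))) , λ _ S p → ⊥-elim (¬p (S , p)))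
      go (yes (S₀ , p₀)) = let A , pA , min = min-potential D V μ k proper-resp proper? proj₁ S₀ p₀ in gap-from A pA min

-- Deleting a vertex of small degree

⟦⟧-mono : ∀ {a b} → (a ≡ true → b ≡ true) → ⟦ a ⟧ ≤ ⟦ b ⟧
⟦⟧-mono {false} h = z≤n
⟦⟧-mono {true} h rewrite h refl = ≤-refl

module _ {N : ℕ} where

  over-indicator : ∀ (T : Sub {N}) x → over T (λ u → ⟦ ｛ x ｝ u ⟧) ≡ ⟦ T x ⟧
  over-indicator T x with bool-cases (T x)
  ... | inj₁ p = trans (over-remove _ p) (cong₂ _+_ (over-zero (T - x) λ q → cong ⟦_⟧ (∖⁻ʳ T ｛ x ｝ q)) (trans (cong ⟦_⟧ (∈-｛｝ x)) (sym (cong ⟦_⟧ p))))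
  ... | inj₂ p = trans (over-zero T λ q → cong ⟦_⟧ (∉-｛｝ (∈∉⇒≢ {S = T} q p))) (sym (cong ⟦_⟧ p))

  -- A list in which each vertex occurs as often as `f` says, stated through the counts that it
  -- gives on every subset.
  Listed : ∀ {d} → Sub {N} → (Fin N → ℕ) → (Fin d → Fin N) → Set
  Listed S f nb = (∀ i → nb i ∈ S) × (∀ T → T ⊆ S → over T f ≡ sum λ i → ⟦ T (nb i) ⟧)

  listed : ∀ d S f → over S f ≡ d → ∃ λ (nb : Fin d → Fin N) → Listed S f nb
  listed zero S f eq = (λ ()) , (λ ()) , λ T T⊆S → n≤0⇒n≡0 (≤-trans (over-⊆ f T⊆S) (≤-reflexive eq))
  listed (suc d) S f eq = extend (over-pos S f (subst (1 ≤_) (sym eq) (s≤s z≤n)))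
    where
    extend : (∃ λ x → x ∈ S × 1 ≤ f x) → ∃ λ (nb : Fin (suc d) → Fin N) → Listed S f nb
    extend (x , x∈S , fx≥1) = nb′ , nb∈′ , λ T T⊆S → trans (over-f T) (cong (⟦ T x ⟧ +_) (proj₂ (proj₂ rest) T T⊆S))
      where
      f′ : Fin N → ℕ
      f′ u = f u ∸ ⟦ ｛ x ｝ u ⟧
      ｛x｝≤f : ∀ u → ⟦ ｛ x ｝ u ⟧ ≤ f u
      ｛x｝≤f u with u ≟ x
      ... | yes refl = fx≥1
      ... | no _ = z≤n
      over-f : ∀ T → over T f ≡ ⟦ T x ⟧ + over T f′
      over-f T = trans (over-cong T λ {u} _ → sym (m+[n∸m]≡n (｛x｝≤f u)))
        (trans (over-+ T _ f′) (cong (_+ over T f′) (over-indicator T x)))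
      rest : ∃ λ (nb : Fin d → Fin N) → Listed S f′ nb
      rest = listed d S f′ (suc-injective (trans (sym (trans (over-f S) (cong (_+ over S f′) (cong ⟦_⟧ x∈S)))) eq))
      nb′ : Fin (suc d) → Fin N
      nb′ zero = x
      nb′ (suc i) = proj₁ rest i
      nb∈′ : ∀ i → nb′ i ∈ S
      nb∈′ zero = x∈S
      nb∈′ (suc i) = proj₁ (proj₂ rest) i

  wt-+ᵥ : ∀ D k {S : Sub {N}} {v} → v ∉ S → wt D k (S +ᵥ v) ≡ wt D k S + (2 * k v + (2 * D + 1))
  wt-+ᵥ D k {S} {v} v∉S = over-+ᵥ {S = S} {v} _ v∉S

  small-forest : ∀ {μ} → Symmetric μ → Irreflexive μ → ∀ {X : Sub {N}} → size X ≤ 1 → Forest μ X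
  small-forest σ ι sX S S⊆ ne = case size-or-Q σ ι {S} ne of λ
    { (inj₁ s) → ⊥-elim (1+n≰n (≤-trans s (≤-trans (over-⊆ _ S⊆) sX)))
    ; (inj₂ q0) → subst (λ q → q + 2 ≤ 2 * size S) (sym q0) (2 ⊛ size-pos S ne) }

  small-colourable : ∀ {V : Sub {N}} {μ} → Symmetric μ → Irreflexive μ → ∀ k → size V ≤ 1 → Colourable V μ k
  small-colourable {V} {μ} σ ι k sV = ∅ , record
    { bound = λ _ ()
    ; forestM = λ { S S⊆ (v , p) → ⊥-elim (true≢false (∧-trueʳ {V v} (S⊆ p)) refl) }
    ; forestF = small-forest σ ι (≤-trans (over-⊆ {S = V ∩ ∁ ∅} {V} _ ∧-trueˡ) sV)
    }

  meas-mono : ∀ {V V′ : Sub {N}} {k l} → V′ ⊆ V → (∀ u → l u ≤ k u) → ∀ {v} → v ∈ V → v ∉ V′ → meas V′ l < meas V k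
  meas-mono {V} {V′} {k} {l} V′⊆V l≤k {v} v∈V v∉V′ = subst (meas V′ l <_) (sym (over-remove _ v∈V))
    (arith _ _ (k v) (≤-trans (over-⊆ _ (∉⇒⊆- V′ V V′⊆V v∉V′)) (over-mono (V - v) λ {u} _ → s≤s (l≤k u))))
    where
    arith : ∀ a b c → a ≤ b → suc a ≤ b + suc c
    arith a b c h = lin c h (solve (a ∷ b ∷ c ∷ []))

  module Step (D : ℕ) (1≤D : 1 ≤ D) (V : Sub {N}) {μ : Mult} (σ : Symmetric μ) (ι : Irreflexive μ)
    (k : Fin N → ℕ) (cap : ∀ u → k u ≤ suc D) (adm : Adm D V μ k)
    (IH : Hypothesis {N} D (meas V k)) where

    open Gap D 1≤D V σ ι k cap adm IH public

    module _ (v : Fin N) where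

      -- One unit is enough for any number of parallel edges, because `v` goes to M only with at
      -- most one edge into M. A neighbour of capacity 0 has nothing to lose and is in F anyway.
      loss : Fin N → ℕ
      loss u = 1 ⊓ μ v u ⊓ k u

      loss≤μ : ∀ u → loss u ≤ μ v u
      loss≤μ u = ≤-trans (m⊓n≤m (1 ⊓ μ v u) (k u)) (m⊓n≤n 1 (μ v u))

      reduce : v ∈ V → deg μ V v ≤ 3 → deg μ V v ≤ suc (k v) →
        (∀ S → S ⊆ V - v → 2 ≤ size S → suc D * Q μ S + 2 * over S loss ≤ wt D k S + 1) →
        Colourable V μ k
      reduce v∈V d≤3 d≤1+k h = Extend.extend-slack σ ι V v v∈V k (proj₂ col) (λ {u} _ → k′≤k u) d≤3 d≤1+k slack
        where
        k′ : Fin N → ℕ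
        k′ u = k u ∸ loss u
        k′≤k : ∀ u → k′ u ≤ k u
        k′≤k u = m∸n≤m (k u) (loss u)
        adm′ : Adm D (V - v) μ k′
        adm′ S S⊆ ne with size-or-Q σ ι {S} ne
        ... | inj₂ q0 = subst (_≤ wt D k′ S + 1) (sym (trans (cong (suc D *_) q0) (*-zeroʳ (suc D)))) z≤n
        ... | inj₁ s = arith (suc D * Q μ S) (over S loss) (wt D k S) (wt D k′ S) (h S S⊆ s)
              (trans (over-cong S λ {u} _ → pt (k u) (k′ u) (loss u) (2 * D + 1) (m∸n+n≡m (m⊓n≤n (1 ⊓ μ v u) (k u))))
                (trans (over-+ S _ _) (cong (wt D k′ S +_) (over-* S 2 loss))))
          where
          pt : ∀ a b c e → b + c ≡ a → 2 * a + e ≡ (2 * b + e) + 2 * c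
          pt _ b c e refl = solve (b ∷ c ∷ e ∷ [])
          arith : ∀ q x w w′ → q + 2 * x ≤ w + 1 → w ≡ w′ + 2 * x → q ≤ w′ + 1
          arith q x _ w′ p refl = lin 0 p (solve (q ∷ x ∷ w′ ∷ []))
        col : Colourable (V - v) μ k′
        col = IH (V - v) μ k′ σ ι (λ u → ≤-trans (k′≤k u) (cap u)) adm′
          (meas-mono {V} {V - v} {k} {k′} (-⊆ˡ V v) k′≤k v∈V (-∉ V v))
        slack : 2 ≤ deg μ ((V - v) ∩ ∁ (proj₁ col)) v → ∀ {u} → u ∈ V - v → u ∈ proj₁ col → 1 ≤ μ u v →
          2 + deg μ ((V - v) ∩ proj₁ col) u ≤ k u
        slack _ {u} p q μ≥1 = go (deg μ ((V - v) ∩ proj₁ col) u) (k u) (μ v u) (IsCol.bound (proj₂ col) p q) (subst (1 ≤_) (σ u v) μ≥1)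
          where
          go : ∀ d a m → suc d ≤ a ∸ (1 ⊓ m ⊓ a) → 1 ≤ m → 2 + d ≤ a
          go d (suc a) (suc m) h _ = s≤s h

      -- Two lost units cost 4, which takes the potential from 3 to the permitted -1.
      few-losses : v ∈ V → GapBy 3 → ∀ S → S ⊆ V - v → 2 ≤ size S → over S loss ≤ 2 →
        suc D * Q μ S + 2 * over S loss ≤ wt D k S + 1
      few-losses v∈V g S S⊆ s = arith (suc D * Q μ S) (over S loss) (wt D k S)
        (g S ((λ p → -⊆ˡ V v (S⊆ p)) , (v , ∖⁺ V S v∈V (∉-⊆ S (V - v) S⊆ (-∉ V v))) , s))
        where
        arith : ∀ q x w → q + 3 ≤ w → x ≤ 2 → q + 2 * x ≤ w + 1
        arith q x w h i = lin 0 (h ⊕ 2 ⊛ i) (solve (q ∷ x ∷ w ∷ []))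

      reduce-few : v ∈ V → deg μ V v ≤ 3 → deg μ V v ≤ suc (k v) → GapBy 3 → over (V - v) loss ≤ 2 → Colourable V μ k
      reduce-few v∈V d≤3 d≤1+k g few = reduce v∈V d≤3 d≤1+k λ S S⊆ s →
        few-losses v∈V g S S⊆ s (≤-trans (over-⊆ loss S⊆) few)

      -- Three losses in `S` require three edges from `v` into `S`. Admissibility of `S +ᵥ v` and
      -- `k v ≤ suc D` then give `S` potential at least 2D + 2, where 5 is needed.
      reduce-D≥2 : 2 ≤ D → v ∈ V → deg μ V v ≤ 3 → deg μ V v ≤ suc (k v) → GapBy 3 → Colourable V μ k
      reduce-D≥2 D≥2 v∈V d≤3 d≤1+k g = reduce v∈V d≤3 d≤1+k main
        where
        main : ∀ S → S ⊆ V - v → 2 ≤ size S → suc D * Q μ S + 2 * over S loss ≤ wt D k S + 1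
        main S S⊆ s with over S loss ≤? 2
        ... | yes x≤2 = few-losses v∈V g S S⊆ s x≤2
        ... | no x≰2 = arith D (Q μ S) (deg μ S v) (over S loss) (k v) (wt D k S)
              (subst₂ (λ q w → suc D * q ≤ w + 1) (Q-+ᵥ σ ι {S} {v} v∉S) (wt-+ᵥ D k {S} {v} v∉S)
                (adm (S +ᵥ v) (+ᵥ-⊆ S V (λ p → -⊆ˡ V v (S⊆ p)) v∈V) (v , v∈+ᵥ S v)))
              (≤-trans (over-mono S λ {u} _ → loss≤μ u) (≤-trans (over-⊆ (μ v) λ p → -⊆ˡ V v (S⊆ p)) d≤3))
              (≤-trans (≰⇒> x≰2) (over-mono S λ {u} _ → loss≤μ u)) (cap v) D≥2
          where
          v∉S : v ∉ S
          v∉S = ∉-⊆ S (V - v) S⊆ (-∉ V v)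
          arith : ∀ D q d x k w → suc D * (q + 2 * d) ≤ w + (2 * k + (2 * D + 1)) + 1 → x ≤ 3 → 3 ≤ d → k ≤ suc D → 2 ≤ D →
            suc D * q + 2 * x ≤ w + 1
          arith D q d x k w h i j l m = lin 1 (h ⊕ 2 ⊛ i ⊕ 2 * suc D ⊛ j ⊕ 2 ⊛ l ⊕ 2 ⊛ m) (solve (D ∷ q ∷ d ∷ x ∷ k ∷ w ∷ []))

    D≥2-colourable : 2 ≤ D → Colourable V μ k
    D≥2-colourable D≥2 = go gap
      where
      heavy : ∀ D k d → 1 ≤ D → k ≤ suc D → ¬ (d ≤ 3 × d ≤ suc k) → (2 * k + (2 * D + 1)) + 1 ≤ suc D * d
      heavy D k d 1≤D cap ¬l with d ≤? 3
      ... | no d≰3 = lin 0 (suc D ⊛ ≰⇒> d≰3 ⊕ 2 ⊛ cap) (solve (D ∷ k ∷ d ∷ []))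
      ... | yes d≤3 with d ≤? suc k
      ...   | yes d≤ = ⊥-elim (¬l (d≤3 , d≤))
      ...   | no d≰ = lin 0 (suc D ⊛ ≰⇒> d≰ ⊕ k ⊛ 1≤D) (solve (D ∷ k ∷ d ∷ []))
      go : Colourable V μ k ⊎ GapBy 3 × (D ≡ 1 → GapBy 4) → Colourable V μ k
      go (inj₁ c) = c
      go (inj₂ (g , _)) with any? (λ v → (V v ≟ᵇ true) ×-dec ((deg μ V v ≤? 3) ×-dec (deg μ V v ≤? suc (k v))))
      ... | yes (v , v∈ , d≤3 , d≤1+k) = reduce-D≥2 v D≥2 v∈ d≤3 d≤1+k g
      ... | no ¬light with empty? V
      ...   | inj₂ eV = small-colourable σ ι k (≤-trans (≤-reflexive (over-zero V λ {u} p → ⊥-elim (true≢false p (eV u)))) z≤n)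
      ...   | inj₁ neV = small-colourable σ ι k (arith (wt D k V) (size V) (suc D * Q μ V) total (adm V (λ p → p) neV))
        where
        total : wt D k V + size V ≤ suc D * Q μ V
        total = ≤-trans (≤-reflexive (sym (over-+ V _ _))) (≤-trans
          (over-mono V λ {u} p → heavy D (k u) (deg μ V u) 1≤D (cap u) λ light → ¬light (u , p , light))
          (≤-reflexive (over-* V (suc D) _)))
        arith : ∀ w s q → w + s ≤ q → q ≤ w + 1 → s ≤ 1
        arith w s q h i = lin 0 (h ⊕ i) (solve (w ∷ s ∷ q ∷ []))

-- The case D = 1

-- The counting behind a subdivision: two edges replace one, and the `+ 2` belongs to the new
-- vertex. It supplies the last hypothesis of `extendF`.
subdivide : ∀ a b c → c + 2 * (⟦ a ⟧ + ⟦ b ⟧) ≤ c + 2 * ⟦ a ∧ b ⟧ + 2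
subdivide true true c = ≤-reflexive (sym (+-assoc c 2 2))
subdivide true false c = ≤-reflexive (sym (cong (_+ 2) (+-identityʳ c)))
subdivide false true c = ≤-reflexive (sym (cong (_+ 2) (+-identityʳ c)))
subdivide false false c = m≤m+n _ 2

⟦∧⟧-comm : ∀ a b → ⟦ a ∧ b ⟧ ≡ ⟦ b ∧ a ⟧
⟦∧⟧-comm true true = refl
⟦∧⟧-comm true false = refl
⟦∧⟧-comm false true = refl
⟦∧⟧-comm false false = refl

module _ {N : ℕ} where

  addEdge : Mult {N} → Fin N → Fin N → Mult
  addEdge μ x y u w = μ u w + (⟦ ｛ x ｝ u ∧ ｛ y ｝ w ⟧ + ⟦ ｛ y ｝ u ∧ ｛ x ｝ w ⟧)

  addEdge-sym : ∀ {μ} x y → Symmetric μ → Symmetric (addEdge μ x y)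
  addEdge-sym x y σ u w = cong₂ _+_ (σ u w) (trans (+-comm ⟦ ｛ x ｝ u ∧ ｛ y ｝ w ⟧ _)
    (cong₂ _+_ (⟦∧⟧-comm (｛ y ｝ u) (｛ x ｝ w)) (⟦∧⟧-comm (｛ x ｝ u) (｛ y ｝ w))))

  addEdge-irr : ∀ {μ} {x y} → x ≢ y → Irreflexive μ → Irreflexive (addEdge μ x y)
  addEdge-irr {μ} {x} {y} x≢y ι u = cong₂ _+_ (ι u) (h u)
    where
    h : ∀ u → ⟦ ｛ x ｝ u ∧ ｛ y ｝ u ⟧ + ⟦ ｛ y ｝ u ∧ ｛ x ｝ u ⟧ ≡ 0
    h u with u ≟ x | u ≟ y
    ... | yes refl | yes refl = ⊥-elim (x≢y refl)
    ... | yes _ | no _ = refl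
    ... | no _ | yes _ = refl
    ... | no _ | no _ = refl

  over-∧ʳ : ∀ (T : Sub {N}) b y → over T (λ w → ⟦ b ∧ ｛ y ｝ w ⟧) ≡ ⟦ b ∧ T y ⟧
  over-∧ʳ T true y = over-indicator T y
  over-∧ʳ T false y = over-zero T λ _ → refl

  over-∧ˡ : ∀ (T : Sub {N}) b y → over T (λ w → ⟦ ｛ y ｝ w ∧ b ⟧) ≡ ⟦ T y ∧ b ⟧
  over-∧ˡ T b y = trans (over-cong T λ {w} _ → ⟦∧⟧-comm (｛ y ｝ w) b) (trans (over-∧ʳ T b y) (⟦∧⟧-comm b (T y)))

  deg-addEdge : ∀ μ x y T u → deg (addEdge μ x y) T u ≡ deg μ T u + (⟦ ｛ x ｝ u ∧ T y ⟧ + ⟦ ｛ y ｝ u ∧ T x ⟧)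
  deg-addEdge μ x y T u = trans (over-+ T _ _) (cong (deg μ T u +_)
    (trans (over-+ T _ _) (cong₂ _+_ (over-∧ʳ T (｛ x ｝ u) y) (over-∧ʳ T (｛ y ｝ u) x))))

  deg-addEdge-≢ : ∀ μ {x y} T {u} → u ≢ x → u ≢ y → deg (addEdge μ x y) T u ≡ deg μ T u
  deg-addEdge-≢ μ {x} {y} T {u} p q = trans (deg-addEdge μ x y T u)
    (trans (cong (deg μ T u +_) (cong₂ (λ a b → ⟦ a ∧ T y ⟧ + ⟦ b ∧ T x ⟧) (∉-｛｝ p) (∉-｛｝ q))) (+-identityʳ _))

  Q-addEdge : ∀ μ x y T → Q (addEdge μ x y) T ≡ Q μ T + 2 * ⟦ T x ∧ T y ⟧
  Q-addEdge μ x y T = trans (over-cong T λ {u} _ → deg-addEdge μ x y T u) (trans (over-+ T _ _) (cong (Q μ T +_)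
    (trans (over-+ T _ _) (trans (cong₂ _+_ (over-∧ˡ T (T y) x) (trans (over-∧ˡ T (T x) y) (⟦∧⟧-comm (T y) (T x))))
      (cong (⟦ T x ∧ T y ⟧ +_) (sym (+-identityʳ _)))))))

  addEdge-≥ : ∀ μ x y u w → μ u w ≤ addEdge μ x y u w
  addEdge-≥ μ x y u w = m≤m+n _ _

  cross-mono : ∀ μ {S S′ T T′ : Sub {N}} → S ⊆ S′ → T ⊆ T′ → cross μ S T ≤ cross μ S′ T′
  cross-mono μ {S} {S′} p q = ≤-trans (over-mono S λ {u} _ → over-⊆ (μ u) q) (over-⊆ _ p)

  ∪-∖ : ∀ (S T : Sub {N}) v → (S ∪ T) v ≡ (S ∪ (T ∖ S)) v
  ∪-∖ S T v with S v | T v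
  ... | true | _ = refl
  ... | false | true = refl
  ... | false | false = refl

  ∉-∖ : ∀ {S T : Sub {N}} {v} → v ∈ S → v ∉ T ∖ S
  ∉-∖ {S} {T} {v} p rewrite p with T v
  ... | true = refl
  ... | false = refl

  -- The edges from `T ∖ S` to `T ∩ S` are among the edges from `T ∖ S` to `S`.
  Q-supermodular : ∀ {μ} → Symmetric μ → ∀ (S T : Sub {N}) → Q μ S + Q μ T ≤ Q μ (S ∪ T) + Q μ (T ∩ S)
  Q-supermodular {μ} σ S T = subst₂ (λ a b → Q μ S + a ≤ b + Q μ (T ∩ S)) (sym (Q-split σ T S))
    (sym (trans (Q-≗ μ {S ∪ T} {S ∪ (T ∖ S)} (∪-∖ S T)) (Q-∪ σ {S} {T ∖ S} (∉-∖ {S = S} {T}))))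
    (arith (Q μ S) (Q μ (T ∩ S)) (Q μ (T ∖ S)) (cross μ (T ∩ S) (T ∖ S)) (cross μ S (T ∖ S)) (cross-mono μ (λ {u} → ∧-trueʳ {T u}) λ p → p))
    where
    arith : ∀ s i r c d → c ≤ d → s + (i + r + 2 * c) ≤ s + r + 2 * d + i
    arith s i r c d h = lin 0 (2 ⊛ h) (solve (s ∷ i ∷ r ∷ c ∷ d ∷ []))

  wt-modular : ∀ D k (S T : Sub {N}) → wt D k S + wt D k T ≡ wt D k (S ∪ T) + wt D k (T ∩ S)
  wt-modular D k S T = trans (cong (wt D k S +_) (over-split′ T S _))
    (trans (sym (+-assoc (wt D k S) _ _)) (cong (_+ wt D k (T ∩ S))
      (sym (trans (over-≗ _ (∪-∖ S T)) (over-∪ {S = S} {T ∖ S} _ (∉-∖ {S = S} {T}))))))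

  ∩+ᵥ⊆ : ∀ (W φ : Sub {N}) z → W ∩ (φ +ᵥ z) ⊆ ((W - z) ∩ φ) +ᵥ z
  ∩+ᵥ⊆ W φ z {w} p with W w | φ w | ｛ z ｝ w
  ∩+ᵥ⊆ W φ z p | true | true | true = refl
  ∩+ᵥ⊆ W φ z p | true | false | true = refl
  ∩+ᵥ⊆ W φ z p | true | true | false = refl

-- Neighbourhoods of the vertices of positive charge

module One {N : ℕ} (V : Sub {N}) {μ : Mult} (σ : Symmetric μ) (ι : Irreflexive μ)
  (k : Fin N → ℕ) (cap : ∀ u → k u ≤ 2) (adm : Adm 1 V μ k)
  (IH : Hypothesis {N} 1 (meas V k)) (g : Step.GapBy 1 ≤-refl V σ ι k cap adm IH 4) where

  open Step 1 ≤-refl V σ ι k cap adm IH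

  -- The three neighbours may coincide; testing against every `T` records their multiplicities.
  Form : (v x y z : Fin N) → Set
  Form v x y z = ∀ T → T ⊆ V → deg μ T v ≡ ⟦ T x ⟧ + ⟦ T y ⟧ + ⟦ T z ⟧

  form-rot : ∀ {v x y z} → Form v x y z → Form v y z x
  form-rot {v} {x} {y} {z} f T h = trans (f T h) (arith ⟦ T x ⟧ ⟦ T y ⟧ ⟦ T z ⟧)
    where
    arith : ∀ a b c → a + b + c ≡ b + c + a
    arith a b c = solve (a ∷ b ∷ c ∷ [])

  single⊆ : ∀ {u} {S : Sub {N}} → u ∈ S → ｛ u ｝ ⊆ S
  single⊆ {u} {S} p q = subst (_∈ S) (sym (∈-｛｝⁻ q)) p

  μ-form : ∀ {v x y z u} → Form v x y z → u ∈ V → μ v u ≡ ⟦ ｛ u ｝ x ⟧ + ⟦ ｛ u ｝ y ⟧ + ⟦ ｛ u ｝ z ⟧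
  μ-form {v} {u = u} f p = trans (sym (over-｛｝ u (μ v))) (f ｛ u ｝ (single⊆ {S = V} p))

  μ-zero : ∀ {v x y z u} → Form v x y z → u ∈ V → u ≢ x → u ≢ y → u ≢ z → μ v u ≡ 0
  μ-zero {v} {x} {y} {z} {u} f p a b c = trans (μ-form f p)
    (cong₂ _+_ (cong₂ _+_ (cong ⟦_⟧ (∉-｛｝ (a ∘ sym))) (cong ⟦_⟧ (∉-｛｝ (b ∘ sym)))) (cong ⟦_⟧ (∉-｛｝ (c ∘ sym))))

  μ-adj : ∀ {v x y z u} → Form v x y z → u ∈ V → 1 ≤ μ v u → u ≡ x ⊎ u ≡ y ⊎ u ≡ z
  μ-adj {v} {x} {y} {z} {u} f p h with ≡⊎≢ u x | ≡⊎≢ u y | ≡⊎≢ u z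
  ... | inj₁ e | _ | _ = inj₁ e
  ... | inj₂ _ | inj₁ e | _ = inj₂ (inj₁ e)
  ... | inj₂ _ | inj₂ _ | inj₁ e = inj₂ (inj₂ e)
  ... | inj₂ a | inj₂ b | inj₂ c = ⊥-elim (case subst (1 ≤_) (μ-zero f p a b c) h of λ ())

  -- A repeated neighbour loses one unit for two edges, and a neighbour of capacity 0 loses none.
  -- Either way two losses remain, and `reduce-few` applies.
  few : ∀ {v x y z} → Form v x y z → x ≡ y ⊎ k x ≡ 0 → over (V - v) (loss v) ≤ 2
  few {v} {x} {y} {z} f deg = ≤-trans (over-mono (V - v) λ p → pt (-⊆ˡ V v p))
    (≤-trans (≤-reflexive (trans (over-+ (V - v) _ _) (cong₂ _+_ (over-indicator (V - v) y) (over-indicator (V - v) z))))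
      (+-mono-≤ (⟦⟧≤1 ((V - v) y)) (⟦⟧≤1 ((V - v) z))))
    where
    loss≤1 : ∀ u → loss v u ≤ 1
    loss≤1 u = ≤-trans (m⊓n≤m (1 ⊓ μ v u) (k u)) (m⊓n≤m 1 (μ v u))
    pt : ∀ {u} → u ∈ V → loss v u ≤ ⟦ ｛ y ｝ u ⟧ + ⟦ ｛ z ｝ u ⟧
    pt {u} p with ≡⊎≢ u y | ≡⊎≢ u z | ≡⊎≢ u x
    ... | inj₁ refl | _ | _ = ≤-trans (loss≤1 u) (≤-trans (≤-reflexive (sym (cong ⟦_⟧ (∈-｛｝ u)))) (m≤m+n _ _))
    ... | inj₂ _ | inj₁ refl | _ = ≤-trans (loss≤1 u) (≤-trans (≤-reflexive (sym (cong ⟦_⟧ (∈-｛｝ u)))) (m≤n+m _ _))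
    ... | inj₂ u≢y | inj₂ u≢z | inj₂ u≢x = ≤-trans (loss≤μ v u) (≤-trans (≤-reflexive (μ-zero f p u≢x u≢y u≢z)) z≤n)
    pt {u} p | inj₂ u≢y | inj₂ u≢z | inj₁ refl = bad deg
      where
      bad : u ≡ y ⊎ k u ≡ 0 → loss v u ≤ ⟦ ｛ y ｝ u ⟧ + ⟦ ｛ z ｝ u ⟧
      bad (inj₁ u≡y) = ⊥-elim (u≢y u≡y)
      bad (inj₂ k0) = ≤-trans (m⊓n≤n (1 ⊓ μ v u) (k u)) (≤-trans (≤-reflexive k0) z≤n)

  -- The vertices of positive charge.
  B : Sub
  B u = V u ∧ (does (k u ≟ℕ 2) ∧ does (deg μ V u ≟ℕ 3))

  B⁻ : ∀ {u} → u ∈ B → u ∈ V × k u ≡ 2 × deg μ V u ≡ 3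
  B⁻ {u} p = ∧-trueˡ p , does-true (k u ≟ℕ 2) (∧-trueˡ (∧-trueʳ {V u} p))
    , does-true (deg μ V u ≟ℕ 3) (∧-trueʳ {does (k u ≟ℕ 2)} (∧-trueʳ {V u} p))

  B⁺ : ∀ {u} → u ∈ V → k u ≡ 2 → deg μ V u ≡ 3 → u ∈ B
  B⁺ {u} p a b = ∧-true p (∧-true (dec-true (k u ≟ℕ 2) a) (dec-true (deg μ V u ≟ℕ 3) b))

  -- By `few`, the neighbourhood of a vertex of `B` that `reduce-few` cannot delete.
  record Star (v x y z : Fin N) : Set where
    field
      v∈ : v ∈ V
      x∈ : x ∈ V
      y∈ : y ∈ V
      z∈ : z ∈ V
      kv : k v ≡ 2
      dv : deg μ V v ≡ 3
      x≢y : x ≢ y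
      x≢z : x ≢ z
      y≢z : y ≢ z
      kx : 1 ≤ k x
      ky : 1 ≤ k y
      kz : 1 ≤ k z
      form : Form v x y z

  star-rot : ∀ {v x y z} → Star v x y z → Star v y z x
  star-rot s = record
    { v∈ = v∈ ; x∈ = y∈ ; y∈ = z∈ ; z∈ = x∈ ; kv = kv ; dv = dv ; x≢y = y≢z ; x≢z = x≢y ∘ sym ; y≢z = x≢z ∘ sym
    ; kx = ky ; ky = kz ; kz = kx ; form = form-rot form }
    where open Star s

  form₃ : ∀ {v} → deg μ V v ≡ 3 → ∃ λ x → ∃ λ y → ∃ λ z → x ∈ V × y ∈ V × z ∈ V × Form v x y z
  form₃ {v} dv = let nb , nb∈ , f = listed 3 V (μ v) dv in
    nb zero , nb (suc zero) , nb (suc (suc zero)) , nb∈ zero , nb∈ (suc zero) , nb∈ (suc (suc zero)) ,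
    λ T h → trans (f T h) (arith ⟦ T (nb zero) ⟧ ⟦ T (nb (suc zero)) ⟧ ⟦ T (nb (suc (suc zero))) ⟧)
    where
    arith : ∀ a b c → a + (b + (c + 0)) ≡ a + b + c
    arith a b c = solve (a ∷ b ∷ c ∷ [])

  star : ∀ {v} → v ∈ B → 3 ≤ over (V - v) (loss v) → ∃ λ x → ∃ λ y → ∃ λ z → Star v x y z
  star {v} v∈B many = let v∈ , kv , dv = B⁻ v∈B ; x , y , z , x∈ , y∈ , z∈ , f = form₃ dv in
    x , y , z , record
      { v∈ = v∈ ; x∈ = x∈ ; y∈ = y∈ ; z∈ = z∈ ; kv = kv ; dv = dv
      ; x≢y = λ e → notfew f (inj₁ e) ; x≢z = λ e → notfew (form-rot (form-rot f)) (inj₁ (sym e)) ; y≢z = λ e → notfew (form-rot f) (inj₁ e)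
      ; kx = pos f ; ky = pos (form-rot f) ; kz = pos (form-rot (form-rot f)) ; form = f }
    where
    notfew : ∀ {x y z} → Form v x y z → ¬ (x ≡ y ⊎ k x ≡ 0)
    notfew f h = 1+n≰n (≤-trans many (few f h))
    pos : ∀ {x y z} → Form v x y z → 1 ≤ k x
    pos f = n≢0⇒n>0 (λ e → notfew f (inj₂ e))

  star-≤1 : ∀ {v x y z u} → Star v x y z → u ∈ V → μ v u ≤ 1
  star-≤1 {v} {x} {y} {z} {u} s p = ≤-trans (≤-reflexive (μ-form form p)) (pt u)
    where
    open Star s
    pt : ∀ u → ⟦ ｛ u ｝ x ⟧ + ⟦ ｛ u ｝ y ⟧ + ⟦ ｛ u ｝ z ⟧ ≤ 1
    pt u with x ≟ u | y ≟ u | z ≟ u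
    ... | yes refl | yes refl | _ = ⊥-elim (x≢y refl)
    ... | yes refl | _ | yes refl = ⊥-elim (x≢z refl)
    ... | _ | yes refl | yes refl = ⊥-elim (y≢z refl)
    ... | yes _ | no _ | no _ = ≤-refl
    ... | no _ | yes _ | no _ = ≤-refl
    ... | no _ | no _ | yes _ = ≤-refl
    ... | no _ | no _ | no _ = z≤n

  form-≢ : ∀ {v x y z} → Form v x y z → v ∈ V → v ≢ x
  form-≢ {v} {x} {y} {z} f p refl = case trans (sym (ι v)) (trans (μ-form f p) (cong (λ a → a + ⟦ ｛ v ｝ y ⟧ + ⟦ ｛ v ｝ z ⟧) (cong ⟦_⟧ (∈-｛｝ v)))) of λ ()

  star-toFront : ∀ {v x y z u} → Star v x y z → u ∈ V → 1 ≤ μ v u → ∃ λ a → ∃ λ b → Star v u a b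
  star-toFront s p h with μ-adj (Star.form s) p h
  ... | inj₁ refl = _ , _ , s
  ... | inj₂ (inj₁ refl) = _ , _ , star-rot s
  ... | inj₂ (inj₂ refl) = _ , _ , star-rot (star-rot s)

  gap⁺ : ∀ {S T v} → T ⊆ V → v ∈ V → v ∉ T → 2 ≤ size S → S ⊆ T → 2 * Q μ T + 4 ≤ wt 1 k T
  gap⁺ {S} {T} {v} T⊆V v∈V v∉T s S⊆T = g T (T⊆V , (v , ∖⁺ V T v∈V v∉T) , ≤-trans s (over-⊆ _ S⊆T))

  Q+≥ : ∀ {S v} d → v ∉ S → d ≤ deg μ S v → Q μ S + 2 * d ≤ Q μ (S +ᵥ v)
  Q+≥ {S} {v} d v∉S h = ≤-trans (+-monoʳ-≤ (Q μ S) (2 ⊛ h)) (≤-reflexive (sym (Q-+ᵥ σ ι {S} {v} v∉S)))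

  wt+ : ∀ {S v} → v ∉ S → wt 1 k (S +ᵥ v) ≡ wt 1 k S + (2 * k v + 3)
  wt+ {S} {v} v∉S = wt-+ᵥ 1 k {S} {v} v∉S

  -- Deleting a vertex of positive charge together with a neighbour

  module Pair {v z x y} (s : Star v z x y) where
    open Star s renaming (x∈ to z∈; y∈ to x∈; z∈ to y∈; x≢y to z≢x; x≢z to z≢y; y≢z to x≢y; kx to kz; ky to kx; kz to ky)

    k₀ : Fin N → ℕ
    k₀ u = k u ∸ (⟦ ｛ x ｝ u ⟧ + ⟦ ｛ y ｝ u ⟧)

    k₀≤k : ∀ u → k₀ u ≤ k u
    k₀≤k u = m∸n≤m (k u) (⟦ ｛ x ｝ u ⟧ + ⟦ ｛ y ｝ u ⟧)

    k₀x : k₀ x ≡ k x ∸ 1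
    k₀x = cong₂ (λ a b → k x ∸ (a + b)) (cong ⟦_⟧ (∈-｛｝ x)) (cong ⟦_⟧ (∉-｛｝ x≢y))

    k₀y : k₀ y ≡ k y ∸ 1
    k₀y = cong₂ (λ a b → k y ∸ (a + b)) (cong ⟦_⟧ (∉-｛｝ (x≢y ∘ sym))) (cong ⟦_⟧ (∈-｛｝ y))

    k₀z : k₀ z ≡ k z
    k₀z = cong₂ (λ a b → k z ∸ (a + b)) (cong ⟦_⟧ (∉-｛｝ z≢x)) (cong ⟦_⟧ (∉-｛｝ z≢y))

    wt-dec : ∀ S → wt 1 k S ≤ wt 1 k₀ S + 2 * (⟦ S x ⟧ + ⟦ S y ⟧)
    wt-dec S = ≤-trans (over-mono S λ {u} _ → pt (k u) (⟦ ｛ x ｝ u ⟧ + ⟦ ｛ y ｝ u ⟧))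
      (≤-reflexive (trans (over-+ S _ _) (cong (wt 1 k₀ S +_) (trans (over-* S 2 _) (cong (2 *_)
        (trans (over-+ S _ _) (cong₂ _+_ (over-indicator S x) (over-indicator S y))))))))
      where
      arith : ∀ a b c → a ≤ c + b → 2 * a + 3 ≤ (2 * b + 3) + 2 * c
      arith a b c p = lin 0 (2 ⊛ p) (solve (a ∷ b ∷ c ∷ []))
      pt : ∀ a c → 2 * a + 3 ≤ (2 * (a ∸ c) + 3) + 2 * c
      pt a c = arith a (a ∸ c) c (m≤n+m∸n a c)

    -- Lowering to `k₀` provides the slack at `x` and `y`, so only the slack at `z` depends on how
    -- `z` was coloured.
    finish : ∀ {φ} → IsCol (V - v) μ k₀ φ → (z ∈ φ → 2 + deg μ ((V - v) ∩ φ) z ≤ k z) → Colourable V μ k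
    finish {φ} c slackz = Extend.extend-slack σ ι V v v∈ k c (λ {u} _ → k₀≤k u)
      (≤-reflexive dv) (≤-reflexive (trans dv (cong suc (sym kv)))) λ _ → slack
      where
      lift : ∀ {u} → k₀ u ≡ k u ∸ 1 → u ∈ V - v → u ∈ φ → 2 + deg μ ((V - v) ∩ φ) u ≤ k u
      lift {u} e p q = ≤-trans (≤-reflexive (cong suc (+-comm 1 _))) (∸-slack _ (k u) 1 (subst (suc (deg μ ((V - v) ∩ φ) u) ≤_) e (IsCol.bound c p q)))
      slack : ∀ {u} → u ∈ V - v → u ∈ φ → 1 ≤ μ u v → 2 + deg μ ((V - v) ∩ φ) u ≤ k u
      slack {u} p q h with μ-adj form (-⊆ˡ V v p) (subst (1 ≤_) (σ u v) h)
      ... | inj₁ refl = slackz q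
      ... | inj₂ (inj₁ refl) = lift k₀x p q
      ... | inj₂ (inj₂ refl) = lift k₀y p q

    V₀ : Sub
    V₀ = V - v - z

    V₀⊆V : V₀ ⊆ V
    V₀⊆V p = -⊆ˡ V v (-⊆ˡ (V - v) z p)

    v≢z : v ≢ z
    v≢z = form-≢ form v∈

    v∉V₀ : v ∉ V₀
    v∉V₀ = ∉-⊆ V₀ (V - v) (-⊆ˡ (V - v) z) (-∉ V v)

    z∈V-v : z ∈ V - v
    z∈V-v = -⁺ V z∈ (v≢z ∘ sym)

    -- The average of two gaps. The set `S` has potential at least 4; `S +ᵥ v` is proper because it
    -- misses `z`, and this gives `S` potential at least 4a - 3, where a is the number of `x`, `y`
    -- in `S`.
    core : ∀ S → S ⊆ V₀ → 2 ≤ size S → 2 * Q μ S + 2 * (⟦ S x ⟧ + ⟦ S y ⟧) ≤ wt 1 k S + 1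
    core S S⊆ sz = arith (Q μ S) (wt 1 k S) (⟦ S x ⟧ + ⟦ S y ⟧) (Q μ (S +ᵥ v)) (wt 1 k (S +ᵥ v)) (k v)
      (gap⁺ {S} {S} {v} (λ p → V₀⊆V (S⊆ p)) v∈ v∉S sz λ p → p)
      (gap⁺ {S} {S +ᵥ v} {z} (+ᵥ-⊆ S V (λ p → V₀⊆V (S⊆ p)) v∈) z∈ (+ᵥ-∉ S z∉S (v≢z ∘ sym)) sz (⊆+ᵥ S v))
      (Q+≥ {S} {v} _ v∉S (≤-reflexive (sym (trans (form S (λ p → V₀⊆V (S⊆ p))) (cong (λ a → a + ⟦ S x ⟧ + ⟦ S y ⟧) (cong ⟦_⟧ z∉S))))))
      (wt+ {S} {v} v∉S) kv
      where
      v∉S : v ∉ S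
      v∉S = ∉-⊆ S V₀ S⊆ v∉V₀
      z∉S : z ∉ S
      z∉S = ∉-⊆ S V₀ S⊆ (-∉ (V - v) z)
      arith : ∀ q w a q′ w′ k → 2 * q + 4 ≤ w → 2 * q′ + 4 ≤ w′ → q + 2 * a ≤ q′ → w′ ≡ w + (2 * k + 3) → k ≡ 2 →
        2 * q + 2 * a ≤ w + 1
      arith q w a q′ _ _ h i j refl refl = *-cancelˡ-≤ 2 (lin 3 (h ⊕ i ⊕ 2 ⊛ j) (solve (q ∷ w ∷ a ∷ q′ ∷ [])))

  -- Delete v and z and lower k at x and y.
  bad-bad : ∀ {v z x y p q} → Star v z x y → Star z v p q → Colourable V μ k
  bad-bad {v} {z} {x} {y} {p} {q} s t = go (deg μ (V₀ ∩ ∁ φ) z ≤? 1)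
    where
    open Pair s
    open Star s using (v∈)
    module Z = Star t
    adm₀ : Adm 1 V₀ μ k₀
    adm₀ S S⊆ ne with size-or-Q σ ι {S} ne
    ... | inj₂ q0 = subst (λ q → 2 * q ≤ wt 1 k₀ S + 1) (sym q0) z≤n
    ... | inj₁ sz = arith (Q μ S) (wt 1 k S) (wt 1 k₀ S) (⟦ S x ⟧ + ⟦ S y ⟧) (core S S⊆ sz) (wt-dec S)
      where
      arith : ∀ q w w′ a → 2 * q + 2 * a ≤ w + 1 → w ≤ w′ + 2 * a → 2 * q ≤ w′ + 1
      arith q w w′ a h i = lin 0 (h ⊕ i) (solve (q ∷ w ∷ w′ ∷ a ∷ []))
    col : Colourable V₀ μ k₀
    col = IH V₀ μ k₀ σ ι (λ u → ≤-trans (k₀≤k u) (cap u)) adm₀ (meas-mono {V = V} {V₀} {k} {k₀} V₀⊆V k₀≤k v∈ v∉V₀)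
    φ = proj₁ col
    open Extend σ ι (V - v) z z∈V-v k₀
    go : Dec (deg μ (V₀ ∩ ∁ φ) z ≤ 1) → Colourable V μ k
    go (yes F≤1) = finish (extendF-leaf (proj₂ col) (λ _ → ≤-refl) F≤1) λ z∈φ → ⊥-elim (true≢false z∈φ (-∉ φ z))
    -- At most two edges of `z` end in `V₀`, so both end in F. Hence `z` joins M without an
    -- M-neighbour and keeps room for `v`.
    go (no F≰1) = finish (extendM (proj₂ col) (λ _ → ≤-refl) (≤-trans (≤-reflexive M0) z≤n)
        (≤-trans (s≤s (≤-reflexive M0)) (≤-trans (s≤s z≤n) (≤-reflexive (sym (trans k₀z Z.kv)))))
        λ {u} p q → ≤-trans (s≤s (≤-reflexive (trans (cong (deg μ (V₀ ∩ φ) u +_) (μ0 p q)) (+-identityʳ _)))) (IsCol.bound (proj₂ col) p q))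
      λ _ → ≤-trans (s≤s (s≤s (≤-trans (over-⊆ (μ z) (∩+ᵥ⊆ (V - v) φ z)) (≤-reflexive (trans (over-+ᵥ {S = V₀ ∩ φ} {z} (μ z) z∉) (cong₂ _+_ M0 (ι z))))))) (≤-reflexive (sym Z.kv))
      where
      z∉ : z ∉ V₀ ∩ φ
      z∉ rewrite -∉ (V - v) z = refl
      degV₀ : deg μ V₀ z ≤ 2
      degV₀ = ≤-trans (≤-reflexive (trans (Z.form V₀ V₀⊆V) (cong (λ a → a + ⟦ V₀ p ⟧ + ⟦ V₀ q ⟧) (cong ⟦_⟧ v∉V₀)))) (+-mono-≤ (⟦⟧≤1 (V₀ p)) (⟦⟧≤1 (V₀ q)))
      M0 : deg μ (V₀ ∩ φ) z ≡ 0
      M0 = n≤0⇒n≡0 (arith (deg μ (V₀ ∩ φ) z) (deg μ (V₀ ∩ ∁ φ) z) (≤-trans (≤-reflexive (sym (over-split V₀ φ (μ z)))) degV₀) (≰⇒> F≰1))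
        where
        arith : ∀ a b → a + b ≤ 2 → 2 ≤ b → a ≤ 0
        arith a b h i = lin 0 (h ⊕ i) (solve (a ∷ b ∷ []))
      μ0 : ∀ {u} → u ∈ V₀ → u ∈ φ → μ u z ≡ 0
      μ0 {u} p q = n≤0⇒n≡0 (≤-trans (≤-reflexive (σ u z)) (≤-trans (term≤over (V₀ ∩ φ) (μ z) (∧-true p q)) (≤-reflexive M0)))

  -- Delete v and z, lower k at x and y, and add an edge pq; back in F, z subdivides that edge.
  tight₁ : ∀ {v z x y p q} → Star v z x y → k z ≡ 1 → Form z v p q → p ≢ q → Colourable V μ k
  tight₁ {v} {z} {x} {y} {p} {q} s kz fz p≢q =
    finish (extendF (proj₂ col) (λ {u} {w} _ _ → addEdge-≥ μ p q u w) (λ _ → ≤-refl) cond) λ z∈φ → ⊥-elim (true≢false z∈φ (-∉ (proj₁ col) z))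
    where
    open Pair s
    open Star s using (v∈; kv; form) renaming (x∈ to z∈; y∈ to x∈; z∈ to y∈; x≢y to z≢x; x≢z to z≢y)
    open Extend σ ι (V - v) z z∈V-v k₀
    μ₀ : Mult
    μ₀ = addEdge μ p q
    degz : ∀ S → S ⊆ V₀ → deg μ S z ≡ ⟦ S p ⟧ + ⟦ S q ⟧
    degz S S⊆ = trans (fz S (λ r → V₀⊆V (S⊆ r))) (cong (λ a → a + ⟦ S p ⟧ + ⟦ S q ⟧) (cong ⟦_⟧ (∉-⊆ S V₀ S⊆ v∉V₀)))
    module _ (S : Sub) (S⊆ : S ⊆ V₀) (p∈S : p ∈ S) (q∈S : q ∈ S) where
      private
        S⊆V : S ⊆ V
        S⊆V r = V₀⊆V (S⊆ r)
        z∉S : z ∉ S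
        z∉S = ∉-⊆ S V₀ S⊆ (-∉ (V - v) z)
        v∉S : v ∉ S
        v∉S = ∉-⊆ S V₀ S⊆ v∉V₀
        Sz Szv : Sub
        Sz = S +ᵥ z
        Szv = Sz +ᵥ v
        v∉Sz : v ∉ Sz
        v∉Sz = +ᵥ-∉ S v∉S v≢z
        Sz⊆V : Sz ⊆ V
        Sz⊆V = +ᵥ-⊆ S V S⊆V z∈
        Szv⊆V : Szv ⊆ V
        Szv⊆V = +ᵥ-⊆ Sz V Sz⊆V v∈
        S⊆Szv : S ⊆ Szv
        S⊆Szv r = ⊆+ᵥ Sz v (⊆+ᵥ S z r)
        a = ⟦ S x ⟧ + ⟦ S y ⟧
        Qz : Q μ S + 4 ≤ Q μ Sz
        Qz = Q+≥ {S} {z} 2 z∉S (≤-reflexive (sym (trans (degz S S⊆) (cong₂ _+_ (cong ⟦_⟧ p∈S) (cong ⟦_⟧ q∈S)))))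
        Qzv : Q μ Sz + 2 * (1 + a) ≤ Q μ Szv
        Qzv = Q+≥ {Sz} {v} (1 + a) v∉Sz (≤-trans
          (+-mono-≤ (+-mono-≤ (≤-reflexive (sym (cong ⟦_⟧ (v∈+ᵥ S z)))) (⟦⟧-mono {S x} (⊆+ᵥ S z))) (⟦⟧-mono {S y} (⊆+ᵥ S z)))
          (≤-reflexive (sym (form Sz Sz⊆V))))
        wtzv : wt 1 k Szv ≡ wt 1 k S + 12
        wtzv = trans (wt+ {Sz} {v} v∉Sz) (trans (cong₂ (λ a b → a + (2 * b + 3)) (trans (wt+ {S} {z} z∉S) (cong (λ b → wt 1 k S + (2 * b + 3)) kz)) kv) (+-assoc (wt 1 k S) 5 7))
        missing : ∀ {u} → u ∈ V → u ∉ Szv → 2 * (Q μ S + 2) + 2 * a ≤ wt 1 k S + 1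
        missing u∈ u∉ = arith (Q μ S) (Q μ Sz) (Q μ Szv) a (wt 1 k S) (wt 1 k Szv) Qz Qzv wtzv
          (gap⁺ {S} {Szv} Szv⊆V u∈ u∉ (size-≥2 S p∈S q∈S p≢q) S⊆Szv)
          where
          arith : ∀ q q₁ q₂ a w w′ → q + 4 ≤ q₁ → q₁ + 2 * (1 + a) ≤ q₂ → w′ ≡ w + 12 → 2 * q₂ + 4 ≤ w′ → 2 * (q + 2) + 2 * a ≤ w + 1
          arith q q₁ q₂ a w _ h i refl j = lin (2 * a + 1) (2 ⊛ h ⊕ 2 ⊛ i ⊕ j) (solve (q ∷ q₁ ∷ q₂ ∷ a ∷ w ∷ []))
      -- Adding `z` and `v` brings weight 5 + 7 and edges that cost at least 12 + 4a, so the
      -- potential of `S` exceeds that of `Szv` by at least 4a, while 2a + 3 is needed. If `x` or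
      -- `y` is missing, `Szv` is proper and has potential 4; otherwise a = 2 and -1 is enough.
      both : 2 * (Q μ S + 2) + 2 * (⟦ S x ⟧ + ⟦ S y ⟧) ≤ wt 1 k S + 1
      both with bool-cases (S x) | bool-cases (S y)
      ... | inj₂ x∉ | _ = missing x∈ (+ᵥ-∉ Sz (+ᵥ-∉ S x∉ (z≢x ∘ sym)) (form-≢ (form-rot form) v∈ ∘ sym))
      ... | inj₁ _ | inj₂ y∉ = missing y∈ (+ᵥ-∉ Sz (+ᵥ-∉ S y∉ (z≢y ∘ sym)) (form-≢ (form-rot (form-rot form)) v∈ ∘ sym))
      ... | inj₁ xx | inj₁ yy = arith (Q μ S) (Q μ Sz) (Q μ Szv) a (wt 1 k S) (wt 1 k Szv) Qz Qzv wtzv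
              (adm Szv Szv⊆V (v , v∈+ᵥ Sz v)) (cong₂ _+_ (cong ⟦_⟧ xx) (cong ⟦_⟧ yy))
          where
          arith : ∀ q q₁ q₂ a w w′ → q + 4 ≤ q₁ → q₁ + 2 * (1 + a) ≤ q₂ → w′ ≡ w + 12 → 2 * q₂ ≤ w′ + 1 → a ≡ 2 → 2 * (q + 2) + 2 * a ≤ w + 1
          arith q q₁ q₂ _ w _ h i refl j refl = lin 0 (2 ⊛ h ⊕ 2 ⊛ i ⊕ j) (solve (q ∷ q₁ ∷ q₂ ∷ w ∷ []))
    adm₀ : Adm 1 V₀ μ₀ k₀
    adm₀ S S⊆ ne with size-or-Q (addEdge-sym {μ = μ} p q σ) (addEdge-irr {μ = μ} p≢q ι) {S} ne
    ... | inj₂ q0 = subst (λ q → 2 * q ≤ wt 1 k₀ S + 1) (sym q0) z≤n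
    ... | inj₁ sz = ≤-trans (≤-reflexive (cong (2 *_) (Q-addEdge μ p q S)))
            (arith (Q μ S + 2 * ⟦ S p ∧ S q ⟧) (wt 1 k S) (wt 1 k₀ S) (⟦ S x ⟧ + ⟦ S y ⟧) (need (bool-cases (S p ∧ S q))) (wt-dec S))
      where
      need : (S p ∧ S q ≡ true) ⊎ (S p ∧ S q ≡ false) → 2 * (Q μ S + 2 * ⟦ S p ∧ S q ⟧) + 2 * (⟦ S x ⟧ + ⟦ S y ⟧) ≤ wt 1 k S + 1
      need (inj₁ e) = subst (λ b → 2 * (Q μ S + 2 * ⟦ b ⟧) + 2 * (⟦ S x ⟧ + ⟦ S y ⟧) ≤ wt 1 k S + 1) (sym e) (both S S⊆ (∧-trueˡ e) (∧-trueʳ {S p} e))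
      need (inj₂ e) = subst (λ b → 2 * (Q μ S + 2 * ⟦ b ⟧) + 2 * (⟦ S x ⟧ + ⟦ S y ⟧) ≤ wt 1 k S + 1) (sym e)
        (subst (λ b → 2 * b + 2 * (⟦ S x ⟧ + ⟦ S y ⟧) ≤ wt 1 k S + 1) (sym (+-identityʳ (Q μ S))) (core S S⊆ sz))
      arith : ∀ q w w′ a → 2 * q + 2 * a ≤ w + 1 → w ≤ w′ + 2 * a → 2 * q ≤ w′ + 1
      arith q w w′ a h i = lin 0 (h ⊕ i) (solve (q ∷ w ∷ w′ ∷ a ∷ []))
    col : Colourable V₀ μ₀ k₀
    col = IH V₀ μ₀ k₀ (addEdge-sym {μ = μ} p q σ) (addEdge-irr {μ = μ} p≢q ι) (λ u → ≤-trans (k₀≤k u) (cap u)) adm₀ (meas-mono {V = V} {V₀} {k} {k₀} V₀⊆V k₀≤k v∈ v∉V₀)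
    cond : ∀ S → S ⊆ V₀ ∩ ∁ (proj₁ col) → Q μ S + 2 * deg μ S z ≤ Q μ₀ S + 2
    cond S S⊆ = subst₂ (λ d q → Q μ S + 2 * d ≤ q + 2) (sym (degz S λ r → ∧-trueˡ (S⊆ r))) (sym (Q-addEdge μ p q S)) (subdivide (S p) (S q) (Q μ S))

  Form₄ : (z a b c p : Fin N) → Set
  Form₄ z a b c p = ∀ T → T ⊆ V → deg μ T z ≡ ⟦ T a ⟧ + ⟦ T b ⟧ + ⟦ T c ⟧ + ⟦ T p ⟧

  star-B : ∀ {v x y z} → Star v x y z → v ∈ B
  star-B s = B⁺ (Star.v∈ s) (Star.kv s) (Star.dv s)

  star-μ : ∀ {v x y z} → Star v x y z → 1 ≤ μ v x
  star-μ {v} {x} {y} {z} s = ≤-trans (≤-trans (≤-reflexive (sym (cong ⟦_⟧ (∈-｛｝ x)))) (≤-trans (m≤m+n _ _) (m≤m+n _ _)))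
    (≤-reflexive (sym (μ-form (Star.form s) (Star.x∈ s))))

  -- Three vertices of positive charge around a vertex of capacity 2 and degree 4

  module Claws (indep : ∀ {u w} → u ∈ B → w ∈ B → μ u w ≡ 0) where

    star-≢ : ∀ {v x y z w} → Star v x y z → w ∈ B → w ≢ x
    star-≢ s w∈B refl = case subst (1 ≤_) (indep (star-B s) w∈B) (star-μ s) of λ ()

    -- The configuration that `FewBad 2 4` excludes: `z` has three neighbours in `B`, and `p` is its
    -- fourth.
    record Claw (z p v₁ x₁ y₁ v₂ x₂ y₂ v₃ x₃ y₃ : Fin N) : Set where
      field
        z∈ : z ∈ V
        kz : k z ≡ 2
        form₄ : Form₄ z v₁ v₂ v₃ p
        s₁ : Star v₁ z x₁ y₁
        s₂ : Star v₂ z x₂ y₂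
        s₃ : Star v₃ z x₃ y₃
        v₁≢v₂ : v₁ ≢ v₂
        v₁≢v₃ : v₁ ≢ v₃
        v₂≢v₃ : v₂ ≢ v₃
        p≢v₁ : p ≢ v₁
        p≢v₂ : p ≢ v₂
        p≢v₃ : p ≢ v₃

    claw-rot : ∀ {z p v₁ x₁ y₁ v₂ x₂ y₂ v₃ x₃ y₃} → Claw z p v₁ x₁ y₁ v₂ x₂ y₂ v₃ x₃ y₃ → Claw z p v₂ x₂ y₂ v₃ x₃ y₃ v₁ x₁ y₁
    claw-rot {z} {p} {v₁} {_} {_} {v₂} {_} {_} {v₃} c = record
      { z∈ = z∈ ; kz = kz ; form₄ = λ T h → trans (form₄ T h) (arith ⟦ T v₁ ⟧ ⟦ T v₂ ⟧ ⟦ T v₃ ⟧ ⟦ T p ⟧)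
      ; s₁ = s₂ ; s₂ = s₃ ; s₃ = s₁ ; v₁≢v₂ = v₂≢v₃ ; v₁≢v₃ = v₁≢v₂ ∘ sym ; v₂≢v₃ = v₁≢v₃ ∘ sym
      ; p≢v₁ = p≢v₂ ; p≢v₂ = p≢v₃ ; p≢v₃ = p≢v₁ }
      where
      open Claw c
      arith : ∀ a b c d → a + b + c + d ≡ b + c + a + d
      arith a b c d = solve (a ∷ b ∷ c ∷ d ∷ [])

    claw-swap : ∀ {z p v₁ x₁ y₁ v₂ x₂ y₂ v₃ x₃ y₃} → Claw z p v₁ x₁ y₁ v₂ x₂ y₂ v₃ x₃ y₃ → Claw z p v₁ x₁ y₁ v₃ x₃ y₃ v₂ x₂ y₂
    claw-swap {z} {p} {v₁} {_} {_} {v₂} {_} {_} {v₃} c = record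
      { z∈ = z∈ ; kz = kz ; form₄ = λ T h → trans (form₄ T h) (arith ⟦ T v₁ ⟧ ⟦ T v₂ ⟧ ⟦ T v₃ ⟧ ⟦ T p ⟧)
      ; s₁ = s₁ ; s₂ = s₃ ; s₃ = s₂ ; v₁≢v₂ = v₁≢v₃ ; v₁≢v₃ = v₁≢v₂ ; v₂≢v₃ = v₂≢v₃ ∘ sym
      ; p≢v₁ = p≢v₁ ; p≢v₂ = p≢v₃ ; p≢v₃ = p≢v₂ }
      where
      open Claw c
      arith : ∀ a b c d → a + b + c + d ≡ a + c + b + d
      arith a b c d = solve (a ∷ b ∷ c ∷ d ∷ [])

    record Away (z v₁ v₂ v₃ : Fin N) (S : Sub) : Set where
      field
        ⊆V : S ⊆ V
        z∉ : z ∉ S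
        v₁∉ : v₁ ∉ S
        v₂∉ : v₂ ∉ S
        v₃∉ : v₃ ∉ S

    -- The sets that obstruct adding the edge from `x` to `y` while `p` is forced into F: the edge
    -- costs 4 and the capacity of `p` up to 4, so potential 7 is needed. The ambient set `R` stays
    -- the same when the claw is rotated.
    Low : (R : Sub) (p x y : Fin N) → Sub → Set
    Low R p x y S = S ⊆ R × x ∈ S × y ∈ S × p ∈ S × wt 1 k S ≤ 2 * Q μ S + 6

    low? : ∀ R p x y → Dec (∃ (Low R p x y))
    low? R p x y = any-subset?
      (λ {S} {T} e (a , b , c , d , f) → (λ {u} q → a (trans (e u) q)) , trans (sym (e x)) b , trans (sym (e y)) c , trans (sym (e p)) d
        , subst₂ (λ w q → w ≤ 2 * q + 6) (over-≗ _ e) (Q-≗ μ e) f)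
      λ S → ⊆? S R ×-dec ((S x ≟ᵇ true) ×-dec ((S y ≟ᵇ true) ×-dec ((S p ≟ᵇ true) ×-dec (wt 1 k S ≤? 2 * Q μ S + 6))))

    module _ {z p v₁ x₁ y₁ v₂ x₂ y₂ v₃ x₃ y₃} (c : Claw z p v₁ x₁ y₁ v₂ x₂ y₂ v₃ x₃ y₃) where
      open Claw c
      private
        module S₁ = Star s₁
        module S₂ = Star s₂
        module S₃ = Star s₃

      -- Adding `v₁`, `v₂` and `z` brings weight 21 and edges that cost at least 24, or 28 if `p` is
      -- in `S`; the result misses `v₃`, so it is proper and has potential at least 4. The bound is
      -- exactly what both new edges and the forcing of `p` require.
      two-full : ∀ S → Away z v₁ v₂ v₃ S → x₁ ∈ S → y₁ ∈ S → x₂ ∈ S → y₂ ∈ S → 2 * Q μ S + 7 + 4 * ⟦ S p ⟧ ≤ wt 1 k S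
      two-full S away x₁∈ y₁∈ x₂∈ y₂∈ = arith (Q μ S) (Q μ T₁) (Q μ T₂) (Q μ T₃) (wt 1 k S) (wt 1 k T₃) ⟦ S p ⟧
        (Q+≥ {S} {v₁} 2 v₁∉ (≤-trans (+-mono-≤ (≤-trans (≤-reflexive (sym (cong ⟦_⟧ x₁∈))) (m≤n+m _ ⟦ S z ⟧)) (≤-reflexive (sym (cong ⟦_⟧ y₁∈)))) (≤-reflexive (sym (S₁.form S ⊆V)))))
        (Q+≥ {T₁} {v₂} 2 v₂∉T₁ (≤-trans (+-mono-≤ (≤-trans (≤-reflexive (sym (cong ⟦_⟧ (up₁ x₂∈)))) (m≤n+m _ ⟦ T₁ z ⟧)) (≤-reflexive (sym (cong ⟦_⟧ (up₁ y₂∈))))) (≤-reflexive (sym (S₂.form T₁ T₁⊆V)))))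
        (Q+≥ {T₂} {z} (2 + ⟦ S p ⟧) z∉T₂ (≤-trans
          (+-mono-≤ (≤-trans (+-mono-≤ (≤-reflexive (sym (cong ⟦_⟧ (up₂ (v∈+ᵥ S v₁))))) (≤-reflexive (sym (cong ⟦_⟧ (v∈+ᵥ T₁ v₂))))) (m≤m+n _ ⟦ T₂ v₃ ⟧)) (⟦⟧-mono {S p} λ q → up₂ (up₁ q)))
          (≤-reflexive (sym (form₄ T₂ T₂⊆V)))))
        (trans (wt+ {T₂} {z} z∉T₂) (cong₂ (λ a b → a + (2 * b + 3)) (trans (wt+ {T₁} {v₂} v₂∉T₁) (cong₂ (λ a b → a + (2 * b + 3)) (trans (wt+ {S} {v₁} v₁∉) (cong (λ b → wt 1 k S + (2 * b + 3)) S₁.kv)) S₂.kv)) kz))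
        (gap⁺ {S} {T₃} {v₃} T₃⊆V S₃.v∈ v₃∉T₃ (size-≥2 S x₁∈ y₁∈ S₁.y≢z) λ q → ⊆+ᵥ T₂ z (up₂ (up₁ q)))
        where
        open Away away
        T₁ T₂ T₃ : Sub
        T₁ = S +ᵥ v₁
        T₂ = T₁ +ᵥ v₂
        T₃ = T₂ +ᵥ z
        up₁ : S ⊆ T₁
        up₁ = ⊆+ᵥ S v₁
        up₂ : T₁ ⊆ T₂
        up₂ = ⊆+ᵥ T₁ v₂
        T₁⊆V : T₁ ⊆ V
        T₁⊆V = +ᵥ-⊆ S V ⊆V S₁.v∈
        T₂⊆V : T₂ ⊆ V
        T₂⊆V = +ᵥ-⊆ T₁ V T₁⊆V S₂.v∈
        T₃⊆V : T₃ ⊆ V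
        T₃⊆V = +ᵥ-⊆ T₂ V T₂⊆V z∈
        v₂∉T₁ : v₂ ∉ T₁
        v₂∉T₁ = +ᵥ-∉ S v₂∉ (v₁≢v₂ ∘ sym)
        z∉T₂ : z ∉ T₂
        z∉T₂ = +ᵥ-∉ T₁ (+ᵥ-∉ S z∉ (form-≢ S₁.form S₁.v∈ ∘ sym)) (form-≢ S₂.form S₂.v∈ ∘ sym)
        v₃∉T₃ : v₃ ∉ T₃
        v₃∉T₃ = +ᵥ-∉ T₂ (+ᵥ-∉ T₁ (+ᵥ-∉ S v₃∉ (v₁≢v₃ ∘ sym)) (v₂≢v₃ ∘ sym)) (form-≢ S₃.form S₃.v∈)
        arith : ∀ q q₁ q₂ q₃ w w′ e → q + 2 * 2 ≤ q₁ → q₁ + 2 * 2 ≤ q₂ → q₂ + 2 * (2 + e) ≤ q₃ → w′ ≡ w + (2 * 2 + 3) + (2 * 2 + 3) + (2 * 2 + 3) → 2 * q₃ + 4 ≤ w′ →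
          2 * q + 7 + 4 * e ≤ w
        arith q q₁ q₂ q₃ w _ e h i j refl l = lin 0 (2 ⊛ h ⊕ 2 ⊛ i ⊕ 2 ⊛ j ⊕ l) (solve (q ∷ q₁ ∷ q₂ ∷ q₃ ∷ w ∷ e ∷ []))

      -- Uncrossing: the union and the intersection of two low sets would have total potential 14 > 6 + 6.
      not-both-low : ∀ {R} → Away z v₁ v₂ v₃ R → ∃ (Low R p x₁ y₁) → ∃ (Low R p x₂ y₂) → ⊥
      not-both-low {R} away (S , S⊆ , x₁∈ , y₁∈ , p∈ , lo) (T , T⊆ , x₂∈ , y₂∈ , p∈′ , lo′) =
        1+n≰n (arith (Q μ S) (Q μ T) (Q μ (S ∪ T)) (Q μ (T ∩ S)) (wt 1 k S) (wt 1 k T) (wt 1 k (S ∪ T)) (wt 1 k (T ∩ S))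
          lo lo′ union (inter (size-or-Q σ ι {T ∩ S} (p , ∧-true p∈′ p∈))) (Q-supermodular σ S T) (wt-modular 1 k S T))
        where
        open Away away
        U⊆R : S ∪ T ⊆ R
        U⊆R q = case ∪⁻ S T q of λ { (inj₁ r) → S⊆ r ; (inj₂ r) → T⊆ r }
        union : 2 * Q μ (S ∪ T) + 11 ≤ wt 1 k (S ∪ T)
        union = ≤-trans (≤-reflexive (trans (sym (+-assoc (2 * Q μ (S ∪ T)) 7 4)) (cong (λ a → 2 * Q μ (S ∪ T) + 7 + 4 * a) (sym (cong ⟦_⟧ (∪⁺ˡ S T p∈))))))
          (two-full (S ∪ T) (record { ⊆V = λ q → ⊆V (U⊆R q) ; z∉ = ∉-⊆ (S ∪ T) R U⊆R z∉ ; v₁∉ = ∉-⊆ (S ∪ T) R U⊆R v₁∉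
                                    ; v₂∉ = ∉-⊆ (S ∪ T) R U⊆R v₂∉ ; v₃∉ = ∉-⊆ (S ∪ T) R U⊆R v₃∉ })
            (∪⁺ˡ S T x₁∈) (∪⁺ˡ S T y₁∈) (∪⁺ʳ S T x₂∈) (∪⁺ʳ S T y₂∈))
        I⊆R : T ∩ S ⊆ R
        I⊆R q = T⊆ (∧-trueˡ q)
        inter : 2 ≤ size (T ∩ S) ⊎ Q μ (T ∩ S) ≡ 0 → 2 * Q μ (T ∩ S) + 3 ≤ wt 1 k (T ∩ S)
        inter (inj₁ sz) = ≤-trans (+-monoʳ-≤ _ (n≤1+n 3)) (gap⁺ {T ∩ S} {T ∩ S} {z} (λ q → ⊆V (I⊆R q)) z∈ (∉-⊆ (T ∩ S) R I⊆R z∉) sz λ q → q)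
        inter (inj₂ q0) = subst (λ q → 2 * q + 3 ≤ wt 1 k (T ∩ S)) (sym q0) (≤-trans (m≤n+m 3 (2 * k p)) (term≤over (T ∩ S) (λ u → 2 * k u + 3) (∧-true p∈′ p∈)))
        arith : ∀ s t u i ws wt wu wi → ws ≤ 2 * s + 6 → wt ≤ 2 * t + 6 → 2 * u + 11 ≤ wu → 2 * i + 3 ≤ wi → s + t ≤ u + i → ws + wt ≡ wu + wi → 2 ≤ 1
        arith s t u i ws wt wu wi a b c d e f = lin 1 (a ⊕ b ⊕ c ⊕ d ⊕ 2 ⊛ e ⊕ ≤-reflexive (sym f)) (solve (s ∷ t ∷ u ∷ i ∷ ws ∷ wt ∷ wu ∷ wi ∷ []))

      -- Delete z, v₁, v₂, v₃, force p into F and add the edges x₁y₁ and x₂y₂, to be subdivided by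
      -- v₁ and v₂ in F; then z can go to M.
      claw-colours : ∀ {R} → (∀ {S} → Away z v₁ v₂ v₃ S → S ⊆ R) → ¬ ∃ (Low R p x₁ y₁) → ¬ ∃ (Low R p x₂ y₂) → Colourable V μ k
      claw-colours {R} R-max ¬low₁ ¬low₂ = result
        where
        V₃ V₂ V₁ V₀ : Sub
        V₃ = V - v₃
        V₂ = V₃ - z
        V₁ = V₂ - v₂
        V₀ = V₁ - v₁
        V₃⊆ : V₃ ⊆ V
        V₃⊆ = -⊆ˡ V v₃
        V₂⊆ : V₂ ⊆ V₃
        V₂⊆ = -⊆ˡ V₃ z
        V₁⊆ : V₁ ⊆ V₂
        V₁⊆ = -⊆ˡ V₂ v₂
        V₀⊆ : V₀ ⊆ V₁
        V₀⊆ = -⊆ˡ V₁ v₁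
        z≢v₁ : z ≢ v₁
        z≢v₁ = form-≢ S₁.form S₁.v∈ ∘ sym
        z≢v₂ : z ≢ v₂
        z≢v₂ = form-≢ S₂.form S₂.v∈ ∘ sym
        z≢v₃ : z ≢ v₃
        z≢v₃ = form-≢ S₃.form S₃.v∈ ∘ sym
        z∈V₃ : z ∈ V₃
        z∈V₃ = -⁺ V z∈ z≢v₃
        v₂∈V₂ : v₂ ∈ V₂
        v₂∈V₂ = -⁺ V₃ (-⁺ V S₂.v∈ v₂≢v₃) (z≢v₂ ∘ sym)
        v₁∈V₁ : v₁ ∈ V₁
        v₁∈V₁ = -⁺ V₂ (-⁺ V₃ (-⁺ V S₁.v∈ v₁≢v₃) (z≢v₁ ∘ sym)) v₁≢v₂
        z∉V₂ : z ∉ V₂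
        z∉V₂ = -∉ V₃ z
        z∉V₁ : z ∉ V₁
        z∉V₁ = ∉-⊆ V₁ V₂ V₁⊆ z∉V₂
        z∉V₀ : z ∉ V₀
        z∉V₀ = ∉-⊆ V₀ V₁ V₀⊆ z∉V₁
        v₃∉V₂ : v₃ ∉ V₂
        v₃∉V₂ = ∉-⊆ V₂ V₃ V₂⊆ (-∉ V v₃)
        V₁⊆V : V₁ ⊆ V
        V₁⊆V q = V₃⊆ (V₂⊆ (V₁⊆ q))
        V₀⊆V : V₀ ⊆ V
        V₀⊆V q = V₁⊆V (V₀⊆ q)
        away : ∀ {S} → S ⊆ V₀ → Away z v₁ v₂ v₃ S
        away {S} S⊆ = record
          { ⊆V = λ q → V₀⊆V (S⊆ q) ; z∉ = ∉-⊆ S V₀ S⊆ z∉V₀ ; v₁∉ = ∉-⊆ S V₀ S⊆ (-∉ V₁ v₁)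
          ; v₂∉ = ∉-⊆ S V₁ (λ q → V₀⊆ (S⊆ q)) (-∉ V₂ v₂) ; v₃∉ = ∉-⊆ S V₂ (λ q → V₁⊆ (V₀⊆ (S⊆ q))) v₃∉V₂ }

        μ₁ μ₀ : Mult
        μ₁ = addEdge μ x₂ y₂
        μ₀ = addEdge μ₁ x₁ y₁
        σ₁ : Symmetric μ₁
        σ₁ = addEdge-sym {μ = μ} x₂ y₂ σ
        ι₁ : Irreflexive μ₁
        ι₁ = addEdge-irr {μ = μ} S₂.y≢z ι
        σ₀ : Symmetric μ₀
        σ₀ = addEdge-sym {μ = μ₁} x₁ y₁ σ₁
        ι₀ : Irreflexive μ₀
        ι₀ = addEdge-irr {μ = μ₁} S₁.y≢z ι₁
        k₀ : Fin N → ℕ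
        k₀ u = if ｛ p ｝ u then 0 else k u
        k₀p : k₀ p ≡ 0
        k₀p = cong (if_then 0 else k p) (∈-｛｝ p)
        k₀≤k : ∀ u → k₀ u ≤ k u
        k₀≤k u with ｛ p ｝ u
        ... | true = z≤n
        ... | false = ≤-refl
        wt-dec : ∀ S → wt 1 k S ≤ wt 1 k₀ S + 4 * ⟦ S p ⟧
        wt-dec S = ≤-trans (over-mono S λ {u} _ → pt u)
          (≤-reflexive (trans (over-+ S _ _) (cong (wt 1 k₀ S +_) (trans (over-* S 4 _) (cong (4 *_) (over-indicator S p))))))
          where
          pt : ∀ u → 2 * k u + 3 ≤ (2 * k₀ u + 3) + 4 * ⟦ ｛ p ｝ u ⟧
          pt u with ｛ p ｝ u
          ... | true = +-monoˡ-≤ 3 (2 ⊛ cap u)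
          ... | false = ≤-reflexive (sym (+-identityʳ (2 * k u + 3)))

        need : ∀ S → S ⊆ V₀ → 2 ≤ size S → 2 * (Q μ S + 2 * ⟦ S x₂ ∧ S y₂ ⟧ + 2 * ⟦ S x₁ ∧ S y₁ ⟧) + 4 * ⟦ S p ⟧ ≤ wt 1 k S + 1
        need S S⊆ sz = cases (bool-cases (S x₂ ∧ S y₂)) (bool-cases (S x₁ ∧ S y₁)) (bool-cases (S p))
          where
          gapS : 2 * Q μ S + 4 ≤ wt 1 k S
          gapS = gap⁺ {S} {S} {z} (λ q → V₀⊆V (S⊆ q)) z∈ (∉-⊆ S V₀ S⊆ z∉V₀) sz λ q → q
          Goal : Bool → Bool → Bool → Set
          Goal a b d = 2 * (Q μ S + 2 * ⟦ a ⟧ + 2 * ⟦ b ⟧) + 4 * ⟦ d ⟧ ≤ wt 1 k S + 1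
          ar₀ : ∀ q w d → 2 * q + 4 ≤ w → d ≤ 1 → 2 * (q + 2 * 0 + 2 * 0) + 4 * d ≤ w + 1
          ar₀ q w d h i = lin 1 (h ⊕ 4 ⊛ i) (solve (q ∷ w ∷ d ∷ []))
          ar₁ : ∀ q w → 2 * q + 4 ≤ w → 2 * (q + 2 * 1 + 2 * 0) + 4 * 0 ≤ w + 1
          ar₁ q w h = lin 1 h (solve (q ∷ w ∷ []))
          ar₁′ : ∀ q w → 2 * q + 4 ≤ w → 2 * (q + 2 * 0 + 2 * 1) + 4 * 0 ≤ w + 1
          ar₁′ q w h = lin 1 h (solve (q ∷ w ∷ []))
          ar₂ : ∀ q w → 2 * q + 7 ≤ w → 2 * (q + 2 * 1 + 2 * 0) + 4 * 1 ≤ w + 1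
          ar₂ q w h = lin 0 h (solve (q ∷ w ∷ []))
          ar₂′ : ∀ q w → 2 * q + 7 ≤ w → 2 * (q + 2 * 0 + 2 * 1) + 4 * 1 ≤ w + 1
          ar₂′ q w h = lin 0 h (solve (q ∷ w ∷ []))
          ar₃ : ∀ q w d → 2 * q + 7 + 4 * d ≤ w → 2 * (q + 2 * 1 + 2 * 1) + 4 * d ≤ w + 1
          ar₃ q w d h = lin 0 h (solve (q ∷ w ∷ d ∷ []))
          high : ∀ {x y} → ¬ ∃ (Low R p x y) → S x ∧ S y ≡ true → p ∈ S → 2 * Q μ S + 7 ≤ wt 1 k S
          high {x} {y} ¬low e p∈ = ≤-trans (≤-reflexive (+-suc (2 * Q μ S) 6))
            (≰⇒> λ lo → ¬low (S , R-max (away S⊆) , ∧-trueˡ e , ∧-trueʳ {S x} e , p∈ , lo))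
          cases : S x₂ ∧ S y₂ ≡ true ⊎ S x₂ ∧ S y₂ ≡ false → S x₁ ∧ S y₁ ≡ true ⊎ S x₁ ∧ S y₁ ≡ false → S p ≡ true ⊎ S p ≡ false →
            Goal (S x₂ ∧ S y₂) (S x₁ ∧ S y₁) (S p)
          cases (inj₁ e₂) (inj₁ e₁) _ = subst₂ (λ a b → Goal a b (S p)) (sym e₂) (sym e₁)
            (ar₃ (Q μ S) (wt 1 k S) ⟦ S p ⟧ (two-full S (away S⊆) (∧-trueˡ e₁) (∧-trueʳ {S x₁} e₁) (∧-trueˡ e₂) (∧-trueʳ {S x₂} e₂)))
          cases (inj₂ e₂) (inj₂ e₁) _ = subst₂ (λ a b → Goal a b (S p)) (sym e₂) (sym e₁) (ar₀ (Q μ S) (wt 1 k S) ⟦ S p ⟧ gapS (⟦⟧≤1 (S p)))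
          cases (inj₁ e₂) (inj₂ e₁) (inj₂ e) rewrite e₂ | e₁ | e = ar₁ (Q μ S) (wt 1 k S) gapS
          cases (inj₂ e₂) (inj₁ e₁) (inj₂ e) rewrite e₂ | e₁ | e = ar₁′ (Q μ S) (wt 1 k S) gapS
          cases (inj₁ e₂) (inj₂ e₁) (inj₁ e) = subst₂ (λ a b → Goal a b (S p)) (sym e₂) (sym e₁) (subst (Goal true false) (sym e) (ar₂ (Q μ S) (wt 1 k S) (high ¬low₂ e₂ e)))
          cases (inj₂ e₂) (inj₁ e₁) (inj₁ e) = subst₂ (λ a b → Goal a b (S p)) (sym e₂) (sym e₁) (subst (Goal false true) (sym e) (ar₂′ (Q μ S) (wt 1 k S) (high ¬low₁ e₁ e)))

        adm₀ : Adm 1 V₀ μ₀ k₀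
        adm₀ S S⊆ ne with size-or-Q σ₀ ι₀ {S} ne
        ... | inj₂ q0 = subst (λ q → 2 * q ≤ wt 1 k₀ S + 1) (sym q0) z≤n
        ... | inj₁ sz = ≤-trans (≤-reflexive (cong (2 *_) (trans (Q-addEdge μ₁ x₁ y₁ S) (cong (_+ 2 * ⟦ S x₁ ∧ S y₁ ⟧) (Q-addEdge μ x₂ y₂ S)))))
                (arith (Q μ S + 2 * ⟦ S x₂ ∧ S y₂ ⟧ + 2 * ⟦ S x₁ ∧ S y₁ ⟧) (wt 1 k S) (wt 1 k₀ S) ⟦ S p ⟧ (need S S⊆ sz) (wt-dec S))
          where
          arith : ∀ q w w′ a → 2 * q + 4 * a ≤ w + 1 → w ≤ w′ + 4 * a → 2 * q ≤ w′ + 1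
          arith q w w′ a h i = lin 0 (h ⊕ i) (solve (q ∷ w ∷ w′ ∷ a ∷ []))

        col₀ : Colourable V₀ μ₀ k₀
        col₀ = IH V₀ μ₀ k₀ σ₀ ι₀ (λ u → ≤-trans (k₀≤k u) (cap u)) adm₀ (meas-mono {V = V} {V₀} {k} {k₀} V₀⊆V k₀≤k S₁.v∈ (-∉ V₁ v₁))
        φ₀ φ₁ φ₂ φ₃ : Sub
        φ₀ = proj₁ col₀
        φ₁ = φ₀ - v₁
        φ₂ = φ₁ - v₂
        φ₃ = φ₂ +ᵥ z

        col₁ : IsCol V₁ μ₁ k₀ φ₁
        col₁ = Extend.extendF σ₁ ι₁ V₁ v₁ v₁∈V₁ k₀ (proj₂ col₀) (λ {u} {w} _ _ → addEdge-≥ μ₁ x₁ y₁ u w) (λ _ → ≤-refl)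
          λ S S⊆ → subst₂ (λ d q → Q μ₁ S + 2 * d ≤ q + 2)
            -- As `B` is independent, `v₁` is not an end of the edge added between `x₂` and `y₂`,
            -- which therefore does not change its degree.
            (sym (trans (deg-addEdge-≢ μ S (star-≢ (star-rot s₂) (star-B s₁)) (star-≢ (star-rot (star-rot s₂)) (star-B s₁)))
              (trans (S₁.form S λ q → V₀⊆V (∧-trueˡ (S⊆ q))) (cong (λ a → a + ⟦ S x₁ ⟧ + ⟦ S y₁ ⟧)
                (cong ⟦_⟧ (∉-⊆ S V₀ (λ q → ∧-trueˡ (S⊆ q)) z∉V₀))))))
            (sym (Q-addEdge μ₁ x₁ y₁ S)) (subdivide (S x₁) (S y₁) (Q μ₁ S))

        col₂ : IsCol V₂ μ k₀ φ₂
        col₂ = Extend.extendF σ ι V₂ v₂ v₂∈V₂ k₀ col₁ (λ {u} {w} _ _ → addEdge-≥ μ x₂ y₂ u w) (λ _ → ≤-refl)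
          λ S S⊆ → subst₂ (λ d q → Q μ S + 2 * d ≤ q + 2)
            (sym (trans (S₂.form S λ q → V₁⊆V (∧-trueˡ (S⊆ q))) (cong (λ a → a + ⟦ S x₂ ⟧ + ⟦ S y₂ ⟧)
                (cong ⟦_⟧ (∉-⊆ S V₁ (λ q → ∧-trueˡ (S⊆ q)) z∉V₁)))))
            (sym (Q-addEdge μ x₂ y₂ S)) (subdivide (S x₂) (S y₂) (Q μ S))

        M0 : deg μ (V₂ ∩ φ₂) z ≡ 0
        M0 = trans (form₄ (V₂ ∩ φ₂) λ q → V₃⊆ (V₂⊆ (∧-trueˡ q)))
          (cong₂ _+_ (cong₂ _+_ (cong₂ _+_ (cong ⟦_⟧ v₁∉) (cong ⟦_⟧ v₂∉)) (cong ⟦_⟧ v₃∉)) (cong ⟦_⟧ p∉))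
          where
          v₁∉ : v₁ ∉ V₂ ∩ φ₂
          v₁∉ = ∉-⊆ (V₂ ∩ φ₂) φ₁ (λ {u} q → -⊆ˡ φ₁ v₂ (∧-trueʳ {V₂ u} q)) (-∉ φ₀ v₁)
          v₂∉ : v₂ ∉ V₂ ∩ φ₂
          v₂∉ = ∉-⊆ (V₂ ∩ φ₂) φ₂ (λ {u} → ∧-trueʳ {V₂ u}) (-∉ φ₁ v₂)
          v₃∉ : v₃ ∉ V₂ ∩ φ₂
          v₃∉ = ∉-⊆ (V₂ ∩ φ₂) V₂ ∧-trueˡ v₃∉V₂
          p∉ : p ∉ V₂ ∩ φ₂
          p∉ with bool-cases ((V₂ ∩ φ₂) p)
          ... | inj₂ q = q
          ... | inj₁ q = ⊥-elim (case subst (suc (deg μ₀ (V₀ ∩ φ₀) p) ≤_) k₀p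
                  (IsCol.bound (proj₂ col₀) (-⁺ V₁ (-⁺ V₂ (∧-trueˡ q) p≢v₂) p≢v₁)
                    (-⊆ˡ φ₀ v₁ (-⊆ˡ φ₁ v₂ (∧-trueʳ {V₂ p} q)))) of λ ())

        p≢z : p ≢ z
        p≢z refl = case trans (sym (ι z)) (trans (trans (sym (over-｛｝ z (μ z))) (form₄ ｛ z ｝ (single⊆ {S = V} z∈)))
          (trans (cong (⟦ ｛ z ｝ v₁ ⟧ + ⟦ ｛ z ｝ v₂ ⟧ + ⟦ ｛ z ｝ v₃ ⟧ +_) (cong ⟦_⟧ (∈-｛｝ z))) (+-comm (⟦ ｛ z ｝ v₁ ⟧ + ⟦ ｛ z ｝ v₂ ⟧ + ⟦ ｛ z ｝ v₃ ⟧) 1))) of λ ()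

        k₀z≡2 : k₀ z ≡ 2
        k₀z≡2 = trans (cong (if_then 0 else k z) (∉-｛｝ (p≢z ∘ sym))) kz

        col₃ : IsCol V₃ μ k₀ φ₃
        col₃ = Extend.extendM σ ι V₃ z z∈V₃ k₀ col₂ (λ _ → ≤-refl) (≤-trans (≤-reflexive M0) z≤n)
          (≤-trans (s≤s (≤-reflexive M0)) (≤-trans (s≤s z≤n) (≤-reflexive (sym k₀z≡2))))
          λ {u} q r → ≤-trans (s≤s (≤-reflexive (trans (cong (deg μ (V₂ ∩ φ₂) u +_) (μ0 q r)) (+-identityʳ _)))) (IsCol.bound col₂ q r)
          where
          μ0 : ∀ {u} → u ∈ V₂ → u ∈ φ₂ → μ u z ≡ 0
          μ0 {u} q r = n≤0⇒n≡0 (≤-trans (≤-reflexive (σ u z)) (≤-trans (term≤over (V₂ ∩ φ₂) (μ z) (∧-true q r)) (≤-reflexive M0)))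

        result : Colourable V μ k
        result = Extend.extend-slack σ ι V v₃ S₃.v∈ k col₃ (λ {u} _ → k₀≤k u) (≤-reflexive S₃.dv) (≤-reflexive (trans S₃.dv (cong suc (sym S₃.kv)))) slack
          where
          F : Sub
          F = V₃ ∩ ∁ φ₃
          F⊆V : F ⊆ V
          F⊆V q = V₃⊆ (∧-trueˡ q)
          ∉F : ∀ {u} → u ∈ φ₃ → u ∉ F
          ∉F {u} q rewrite q with V₃ u
          ... | true = refl
          ... | false = refl
          slack : 2 ≤ deg μ F v₃ → ∀ {u} → u ∈ V₃ → u ∈ φ₃ → 1 ≤ μ u v₃ → 2 + deg μ (V₃ ∩ φ₃) u ≤ k u
          slack F≥2 {u} q r h with μ-adj S₃.form (V₃⊆ q) (subst (1 ≤_) (σ u v₃) h)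
          ... | inj₁ refl = ≤-trans (s≤s (s≤s (≤-trans (over-⊆ (μ z) (∩+ᵥ⊆ V₃ φ₂ z))
                  (≤-reflexive (trans (over-+ᵥ {S = V₂ ∩ φ₂} {z} (μ z) (∉-⊆ (V₂ ∩ φ₂) V₂ ∧-trueˡ z∉V₂)) (cong₂ _+_ M0 (ι z))))))) (≤-reflexive (sym kz))
          -- Besides `z`, a second neighbour of `v₃` in M would leave at most one edge from `v₃` to
          -- F, against `F≥2`.
          ... | inj₂ (inj₁ refl) = ⊥-elim (1+n≰n (≤-trans F≥2 (≤-trans (≤-reflexive (S₃.form F F⊆V))
                  (+-mono-≤ (≤-reflexive (cong₂ _+_ (cong ⟦_⟧ (∉F (v∈+ᵥ φ₂ z))) (cong ⟦_⟧ (∉F r)))) (⟦⟧≤1 (F y₃))))))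
          ... | inj₂ (inj₂ refl) = ⊥-elim (1+n≰n (≤-trans F≥2 (≤-trans (≤-reflexive (S₃.form F F⊆V))
                  (≤-trans (+-mono-≤ (+-mono-≤ (≤-reflexive (cong ⟦_⟧ (∉F (v∈+ᵥ φ₂ z)))) (⟦⟧≤1 (F x₃))) (≤-reflexive (cong ⟦_⟧ (∉F r)))) ≤-refl))))

    -- By `not-both-low` at most one of the three pairs is low. The claw is permuted so that the two
    -- pairs that receive an edge are not low.
    tight₂ : ∀ {z p v₁ x₁ y₁ v₂ x₂ y₂ v₃ x₃ y₃} → Claw z p v₁ x₁ y₁ v₂ x₂ y₂ v₃ x₃ y₃ → Colourable V μ k
    tight₂ {z} {p} {v₁} {x₁} {y₁} {v₂} {x₂} {y₂} {v₃} {x₃} {y₃} c = go (low? R p x₁ y₁) (low? R p x₂ y₂)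
      where
      R : Sub
      R = V - z - v₁ - v₂ - v₃
      R-max : ∀ {S} → S ⊆ V → z ∉ S → v₁ ∉ S → v₂ ∉ S → v₃ ∉ S → S ⊆ R
      R-max {S} a b d e f = ∉⇒⊆- S (V - z - v₁ - v₂) (∉⇒⊆- S (V - z - v₁) (∉⇒⊆- S (V - z) (∉⇒⊆- S V a b) d) e) f
      R₃ R₂ R₁ : Sub
      R₁ = V - z
      R₂ = R₁ - v₁
      R₃ = R₂ - v₂
      R⊆R₃ : R ⊆ R₃
      R⊆R₃ = -⊆ˡ R₃ v₃
      R⊆R₂ : R ⊆ R₂
      R⊆R₂ q = -⊆ˡ R₂ v₂ (R⊆R₃ q)
      R⊆R₁ : R ⊆ R₁
      R⊆R₁ q = -⊆ˡ R₁ v₁ (R⊆R₂ q)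
      r⊆V : R ⊆ V
      r⊆V q = -⊆ˡ V z (R⊆R₁ q)
      rz : z ∉ R
      rz = ∉-⊆ R R₁ R⊆R₁ (-∉ V z)
      r₁ : v₁ ∉ R
      r₁ = ∉-⊆ R R₂ R⊆R₂ (-∉ R₁ v₁)
      r₂ : v₂ ∉ R
      r₂ = ∉-⊆ R R₃ R⊆R₃ (-∉ R₂ v₂)
      r₃ : v₃ ∉ R
      r₃ = -∉ R₃ v₃
      go : Dec (∃ (Low R p x₁ y₁)) → Dec (∃ (Low R p x₂ y₂)) → Colourable V μ k
      go (no a) (no b) = claw-colours c (λ w → let open Away w in R-max ⊆V z∉ v₁∉ v₂∉ v₃∉) a b
      go (yes a) _ = claw-colours (claw-rot c) (λ w → let open Away w in R-max ⊆V z∉ v₃∉ v₁∉ v₂∉)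
        (λ b → not-both-low c (record { ⊆V = r⊆V ; z∉ = rz ; v₁∉ = r₁ ; v₂∉ = r₂ ; v₃∉ = r₃ }) a b)
        (λ b → not-both-low (claw-swap c) (record { ⊆V = r⊆V ; z∉ = rz ; v₁∉ = r₁ ; v₂∉ = r₃ ; v₃∉ = r₂ }) a b)
      go (no a) (yes b) = claw-colours (claw-swap c) (λ w → let open Away w in R-max ⊆V z∉ v₁∉ v₃∉ v₂∉) a
        (λ d → not-both-low (claw-rot c) (record { ⊆V = r⊆V ; z∉ = rz ; v₁∉ = r₂ ; v₂∉ = r₃ ; v₃∉ = r₁ }) b d)

  -- Exhausting the reductions, and discharging

  Many Independent : Set
  Many = ∀ {v} → v ∈ V → deg μ V v ≤ 3 → deg μ V v ≤ suc (k v) → 3 ≤ over (V - v) (loss v)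
  Independent = ∀ {u w} → u ∈ B → w ∈ B → μ u w ≡ 0

  FewBad : ℕ → ℕ → Set
  FewBad a d = ∀ {u} → u ∈ V → k u ≡ a → deg μ V u ≡ d → deg μ B u ≤ 2

  three : ∀ p q r → 3 ≤ ⟦ p ⟧ + ⟦ q ⟧ + ⟦ r ⟧ → p ≡ true × q ≡ true × r ≡ true
  three true true true _ = refl , refl , refl
  three true true false (s≤s (s≤s ()))
  three true false true (s≤s (s≤s ()))
  three false true true (s≤s (s≤s ()))
  three true false false (s≤s ())
  three false true false (s≤s ())
  three false false true (s≤s ())

  many? : Colourable V μ k ⊎ Many
  many? with any? (λ v → (V v ≟ᵇ true) ×-dec ((deg μ V v ≤? 3) ×-dec ((deg μ V v ≤? suc (k v)) ×-dec (over (V - v) (loss v) ≤? 2))))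
  ... | yes (v , v∈ , d≤3 , d≤ , h) = inj₁ (reduce-few v v∈ d≤3 d≤ (λ S p → ≤-trans (+-monoʳ-≤ (2 * Q μ S) (n≤1+n 3)) (g S p)) h)
  ... | no ¬h = inj₂ λ {v} v∈ d≤3 d≤ → ≰⇒> λ h → ¬h (v , v∈ , d≤3 , d≤ , h)

  module Bad-stars (many : Many) where

    bad-star : ∀ {v} → v ∈ B → ∃ λ x → ∃ λ y → ∃ λ z → Star v x y z
    bad-star v∈B = let v∈ , kv , dv = B⁻ v∈B in star v∈B (many v∈ (≤-reflexive dv) (≤-reflexive (trans dv (cong suc (sym kv)))))

    bad-front : ∀ {v u} → v ∈ B → u ∈ V → 1 ≤ μ v u → ∃ λ x → ∃ λ y → Star v u x y
    bad-front v∈B u∈ h = let _ , _ , _ , s = bad-star v∈B in star-toFront s u∈ h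

    independent? : Colourable V μ k ⊎ Independent
    independent? with any? (λ v → any? λ z → (B v ≟ᵇ true) ×-dec ((B z ≟ᵇ true) ×-dec (1 ≤? μ v z)))
    ... | yes (v , z , v∈ , z∈ , h) = let _ , _ , s = bad-front v∈ (proj₁ (B⁻ z∈)) h
                                          _ , _ , t = bad-front z∈ (proj₁ (B⁻ v∈)) (subst (1 ≤_) (σ v z) h)
                                      in inj₁ (bad-bad s t)
    ... | no ¬h = inj₂ λ {u} {w} u∈ w∈ → n<1⇒n≡0 (≰⇒> λ h → ¬h (u , w , u∈ , w∈ , h))

    bad-≤1 : ∀ {v u} → v ∈ B → u ∈ V → μ u v ≤ 1
    bad-≤1 {v} {u} v∈ u∈ = let _ , _ , _ , s = bad-star v∈ in ≤-trans (≤-reflexive (σ u v)) (star-≤1 s u∈)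

    tight₁? : Colourable V μ k ⊎ FewBad 1 3
    tight₁? with any? (λ u → (V u ≟ᵇ true) ×-dec ((k u ≟ℕ 1) ×-dec ((deg μ V u ≟ℕ 3) ×-dec (3 ≤? deg μ B u))))
    ... | no ¬h = inj₂ λ {u} u∈ ku du → ≤-pred (≰⇒> λ h → ¬h (u , u∈ , ku , du , h))
    ... | yes (u , u∈ , ku , du , h) = inj₁ (let a , b , c , _ , _ , _ , f = form₃ du in go a b c f)
      where
      go : ∀ a b c → Form u a b c → Colourable V μ k
      go a b c f with three (B a) (B b) (B c) (≤-trans h (≤-reflexive (f B ∧-trueˡ)))
      ... | a∈ , b∈ , c∈ = let _ , _ , s = bad-front a∈ u∈ (≤-trans (≤-trans (≤-reflexive (sym (cong ⟦_⟧ (∈-｛｝ a)))) (≤-trans (m≤m+n _ _) (m≤m+n _ _)))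
                                 (≤-reflexive (trans (sym (μ-form f (proj₁ (B⁻ a∈)))) (σ u a))))
                           in tight₁ s ku f b≢c
        where
        b≢c : b ≢ c
        b≢c refl = 1+n≰n (≤-trans (≤-trans (+-mono-≤ (≤-trans (≤-reflexive (sym (cong ⟦_⟧ (∈-｛｝ b)))) (m≤n+m _ ⟦ ｛ b ｝ a ⟧)) (≤-reflexive (sym (cong ⟦_⟧ (∈-｛｝ b)))))
          (≤-reflexive (sym (μ-form f (proj₁ (B⁻ b∈)))))) (bad-≤1 b∈ u∈))

    module _ (indep : Independent) where
      open Claws indep

      claw : ∀ {u a b c d} → u ∈ V → k u ≡ 2 → Form₄ u a b c d → a ∈ B → b ∈ B → c ∈ B → Colourable V μ k
      claw {u} {a} {b} {c} {d} u∈ ku f a∈ b∈ c∈ =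
        let _ , _ , s₁ = bad-front a∈ u∈ (adj a∈ (≤-trans (m≤m+n _ ⟦ ｛ a ｝ b ⟧) (≤-trans (m≤m+n _ ⟦ ｛ a ｝ c ⟧) (m≤m+n _ ⟦ ｛ a ｝ d ⟧))))
            _ , _ , s₂ = bad-front b∈ u∈ (adj b∈ (≤-trans (m≤n+m _ ⟦ ｛ b ｝ a ⟧) (≤-trans (m≤m+n _ ⟦ ｛ b ｝ c ⟧) (m≤m+n _ ⟦ ｛ b ｝ d ⟧))))
            _ , _ , s₃ = bad-front c∈ u∈ (adj c∈ (≤-trans (m≤n+m _ (⟦ ｛ c ｝ a ⟧ + ⟦ ｛ c ｝ b ⟧)) (m≤m+n _ ⟦ ｛ c ｝ d ⟧)))
        in tight₂ (record { z∈ = u∈ ; kz = ku ; form₄ = f ; s₁ = s₁ ; s₂ = s₂ ; s₃ = s₃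
          ; v₁≢v₂ = λ { refl → twice a∈ (+-mono-≤ (sing a) (sing a)) (≤-trans (m≤m+n _ ⟦ ｛ a ｝ c ⟧) (m≤m+n _ ⟦ ｛ a ｝ d ⟧)) }
          ; v₁≢v₃ = λ { refl → twice a∈ (+-mono-≤ (sing a) (sing a)) (≤-trans (+-monoˡ-≤ ⟦ ｛ a ｝ a ⟧ (m≤m+n _ ⟦ ｛ a ｝ b ⟧)) (m≤m+n _ ⟦ ｛ a ｝ d ⟧)) }
          ; v₂≢v₃ = λ { refl → twice b∈ (+-mono-≤ (sing b) (sing b)) (≤-trans (+-monoˡ-≤ ⟦ ｛ b ｝ b ⟧ (m≤n+m _ ⟦ ｛ b ｝ a ⟧)) (m≤m+n _ ⟦ ｛ b ｝ d ⟧)) }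
          ; p≢v₁ = λ { refl → twice a∈ (+-mono-≤ (sing a) (sing a)) (+-monoˡ-≤ ⟦ ｛ a ｝ a ⟧ (≤-trans (m≤m+n _ ⟦ ｛ a ｝ b ⟧) (m≤m+n _ ⟦ ｛ a ｝ c ⟧))) }
          ; p≢v₂ = λ { refl → twice b∈ (+-mono-≤ (sing b) (sing b)) (+-monoˡ-≤ ⟦ ｛ b ｝ b ⟧ (≤-trans (m≤n+m _ ⟦ ｛ b ｝ a ⟧) (m≤m+n _ ⟦ ｛ b ｝ c ⟧))) }
          ; p≢v₃ = λ { refl → twice c∈ (+-mono-≤ (sing c) (sing c)) (+-monoˡ-≤ ⟦ ｛ c ｝ c ⟧ (m≤n+m _ (⟦ ｛ c ｝ a ⟧ + ⟦ ｛ c ｝ b ⟧))) } })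
        where
        sing : ∀ w → 1 ≤ ⟦ ｛ w ｝ w ⟧
        sing w = ≤-reflexive (sym (cong ⟦_⟧ (∈-｛｝ w)))
        μ≡ : ∀ {w} → w ∈ B → μ u w ≡ ⟦ ｛ w ｝ a ⟧ + ⟦ ｛ w ｝ b ⟧ + ⟦ ｛ w ｝ c ⟧ + ⟦ ｛ w ｝ d ⟧
        μ≡ {w} w∈ = trans (sym (over-｛｝ w (μ u))) (f ｛ w ｝ (single⊆ {S = V} (proj₁ (B⁻ w∈))))
        adj : ∀ {w} → w ∈ B → ⟦ ｛ w ｝ w ⟧ ≤ ⟦ ｛ w ｝ a ⟧ + ⟦ ｛ w ｝ b ⟧ + ⟦ ｛ w ｝ c ⟧ + ⟦ ｛ w ｝ d ⟧ → 1 ≤ μ w u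
        adj {w} w∈ h = ≤-trans (sing w) (≤-trans h (≤-reflexive (trans (sym (μ≡ w∈)) (σ u w))))
        twice : ∀ {w m} → w ∈ B → 2 ≤ m → m ≤ ⟦ ｛ w ｝ a ⟧ + ⟦ ｛ w ｝ b ⟧ + ⟦ ｛ w ｝ c ⟧ + ⟦ ｛ w ｝ d ⟧ → ⊥
        twice w∈ h i = 1+n≰n (≤-trans h (≤-trans i (≤-trans (≤-reflexive (sym (μ≡ w∈))) (bad-≤1 w∈ u∈))))

      tight₂? : Colourable V μ k ⊎ FewBad 2 4
      tight₂? with any? (λ u → (V u ≟ᵇ true) ×-dec ((k u ≟ℕ 2) ×-dec ((deg μ V u ≟ℕ 4) ×-dec (3 ≤? deg μ B u))))
      ... | no ¬h = inj₂ λ {u} u∈ ku du → ≤-pred (≰⇒> λ h → ¬h (u , u∈ , ku , du , h))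
      ... | yes (u , u∈ , ku , du , h) = inj₁ (let nb , nb∈ , f = listed 4 V (μ u) du in
              go (nb zero) (nb (suc zero)) (nb (suc (suc zero))) (nb (suc (suc (suc zero))))
                λ T r → trans (f T r) (arith ⟦ T (nb zero) ⟧ ⟦ T (nb (suc zero)) ⟧ ⟦ T (nb (suc (suc zero))) ⟧ ⟦ T (nb (suc (suc (suc zero)))) ⟧))
        where
        arith : ∀ a b c d → a + (b + (c + (d + 0))) ≡ a + b + c + d
        arith a b c d = solve (a ∷ b ∷ c ∷ d ∷ [])
        to-front : ∀ {a b c d} → Form₄ u a b c d → Form₄ u b c d a
        to-front {a} {b} {c} {d} f T r = trans (f T r) (ar ⟦ T a ⟧ ⟦ T b ⟧ ⟦ T c ⟧ ⟦ T d ⟧)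
          where
          ar : ∀ a b c d → a + b + c + d ≡ b + c + d + a
          ar a b c d = solve (a ∷ b ∷ c ∷ d ∷ [])
        last : ∀ {a b c d} → Form₄ u a b c d → d ∉ B → Colourable V μ k
        last {a} {b} {c} {d} f d∉ = let a∈ , b∈ , c∈ = three (B a) (B b) (B c) (≤-trans h (≤-reflexive (trans (f B ∧-trueˡ)
                                          (trans (cong (⟦ B a ⟧ + ⟦ B b ⟧ + ⟦ B c ⟧ +_) (cong ⟦_⟧ d∉)) (+-identityʳ _)))))
                                    in claw u∈ ku f a∈ b∈ c∈
        go : ∀ a b c d → Form₄ u a b c d → Colourable V μ k
        go a b c d f with bool-cases (B a) | bool-cases (B b) | bool-cases (B c)
        ... | inj₁ a∈ | inj₁ b∈ | inj₁ c∈ = claw u∈ ku f a∈ b∈ c∈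
        ... | inj₂ a∉ | _ | _ = last (to-front f) a∉
        ... | inj₁ _ | inj₂ b∉ | _ = last (to-front (to-front f)) b∉
        ... | inj₁ _ | inj₁ _ | inj₂ c∉ = last (to-front (to-front (to-front f))) c∉

      module Discharge (few₁ : FewBad 1 3) (few₂ : FewBad 2 4) (neV : Nonempty V) where

        d : Fin N → ℕ
        d = deg μ V

        heavy : ∀ {u} → u ∈ V → u ∉ B → k u + 2 ≤ d u
        heavy {u} u∈ u∉ with d u ≤? suc (k u)
        ... | no h = ≤-trans (≤-reflexive (+-comm (k u) 2)) (≰⇒> h)
        ... | yes h with d u ≤? 3
        ...   | no h′ = ≤-trans (+-monoˡ-≤ 2 (cap u)) (≰⇒> h′)
        ...   | yes h′ = ⊥-elim (true≢false (B⁺ u∈ (≤-antisym (cap u) (≤-pred (≤-trans d≥3 h))) (≤-antisym h′ d≥3)) u∉)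
          where
          d≥3 : 3 ≤ d u
          d≥3 = ≤-trans (many u∈ h′ h) (≤-trans (over-mono (V - u) λ {w} _ → loss≤μ u w) (over-⊆ (μ u) (-⊆ˡ V u)))

        nonbad : ∀ {u} → (∀ {w} → w ∈ B → w ≢ u) → u ∉ B
        nonbad {u} h with bool-cases (B u)
        ... | inj₂ p = p
        ... | inj₁ p = ⊥-elim (h p refl)

        b≤d : ∀ u → deg μ B u ≤ d u
        b≤d u = over-⊆ (μ u) ∧-trueˡ

        -- In doubled charges: every vertex of `B` sends 1/2 along each of its edges. A vertex
        -- outside `B` with d = k + 2 has charge -1 and can receive from two neighbours, which the
        -- degree ensures for k = 0 and the last two hypotheses for k = 1, 2. From d = k + 3 on, it
        -- can receive along all its edges.
        charge : ∀ k d b → k ≤ 2 → k + 2 ≤ d → b ≤ d → (k ≡ 1 → d ≡ 3 → b ≤ 2) → (k ≡ 2 → d ≡ 4 → b ≤ 2) → b + 2 * (2 * k + 3) ≤ 4 * d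
        charge k d b k≤2 kd bd h₁ h₂ with d ≤? k + 2
        ... | no h = lin 1 (bd ⊕ 3 ⊛ ≰⇒> h ⊕ k≤2) (solve (k ∷ d ∷ b ∷ []))
        ... | yes h with ≤-antisym h kd
        charge 0 d b k≤2 kd bd h₁ h₂ | yes h | refl = +-monoˡ-≤ 6 bd
        charge 1 d b k≤2 kd bd h₁ h₂ | yes h | refl = +-monoˡ-≤ 10 (h₁ refl refl)
        charge 2 d b k≤2 kd bd h₁ h₂ | yes h | refl = +-monoˡ-≤ 14 (h₂ refl refl)
        charge (suc (suc (suc _))) d b (s≤s (s≤s ())) kd bd h₁ h₂ | yes h | refl

        charge₁ : ∀ {u} → u ∈ V → deg μ B u + 2 * (2 * k u + 3) ≤ 4 * d u + 2 * ⟦ B u ⟧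
        charge₁ {u} u∈ with bool-cases (B u)
        ... | inj₂ u∉ = ≤-trans (charge (k u) (d u) (deg μ B u) (cap u) (heavy u∈ u∉) (b≤d u) (few₁ u∈) (few₂ u∈)) (m≤m+n _ _)
        ... | inj₁ u∈B = let _ , ku , du = B⁻ u∈B in
              ≤-reflexive (trans (cong₂ (λ a b → a + 2 * (2 * b + 3)) (over-zero B λ w∈ → indep u∈B w∈) ku) (sym (cong₂ (λ a b → 4 * a + 2 * b) du (cong ⟦_⟧ u∈B))))

        -- The charges before discharging, at most -1 outside `B` and 1 on `B`; their sum bounds
        -- `size V` in terms of `size B`.
        charge₂ : ∀ {u} → u ∈ V → 2 * k u + 3 + 1 ≤ 2 * d u + 2 * ⟦ B u ⟧
        charge₂ {u} u∈ with bool-cases (B u)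
        ... | inj₂ u∉ = arith (k u) (d u) ⟦ B u ⟧ (heavy u∈ u∉)
          where
          arith : ∀ k d b → k + 2 ≤ d → 2 * k + 3 + 1 ≤ 2 * d + 2 * b
          arith k d b h = lin (2 * b) (2 ⊛ h) (solve (k ∷ d ∷ b ∷ []))
        ... | inj₁ u∈B = let _ , ku , du = B⁻ u∈B in
              ≤-reflexive (trans (cong (λ b → 2 * b + 3 + 1) ku) (sym (cong₂ (λ a b → 2 * a + 2 * b) du (cong ⟦_⟧ u∈B))))

        nb : ℕ
        nb = size B

        over-B : over V (λ u → ⟦ B u ⟧) ≡ nb
        over-B = trans (over-split V B _) (trans (cong₂ _+_
          (trans (over-cong (V ∩ B) λ {u} p → cong ⟦_⟧ (∧-trueʳ {V u} p)) (over-≗ _ V∩B))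
          (over-zero (V ∖ B) λ p → cong ⟦_⟧ (∖⁻ʳ V B p))) (+-identityʳ nb))
          where
          V∩B : ∀ u → (V ∩ B) u ≡ B u
          V∩B u with V u
          ... | true = refl
          ... | false = refl

        bad-degrees : over V (deg μ B) ≡ 3 * nb
        bad-degrees = trans (cross-sym σ V B) (trans (over-cong B λ u∈ → proj₂ (proj₂ (B⁻ u∈))) (over-* B 3 _))

        sum₁ : 3 * nb + 2 * wt 1 k V ≤ 4 * Q μ V + 2 * nb
        sum₁ = ≤-trans (≤-reflexive (sym (trans (over-+ V _ _) (cong₂ _+_ bad-degrees (over-* V 2 _)))))
          (≤-trans (over-mono V charge₁) (≤-reflexive (trans (over-+ V _ _) (cong₂ _+_ (over-* V 4 _) (trans (over-* V 2 _) (cong (2 *_) over-B))))))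

        sum₂ : wt 1 k V + size V ≡ over V (λ u → 2 * k u + 3 + 1)
        sum₂ = sym (over-+ V _ _)

        sum₃ : over V (λ u → 2 * d u + 2 * ⟦ B u ⟧) ≡ 2 * Q μ V + 2 * nb
        sum₃ = trans (over-+ V _ _) (cong₂ _+_ (over-* V 2 _) (trans (over-* V 2 _) (cong (2 *_) over-B)))

        -- A vertex of `B` has charge 1 and sends away 3/2, so the total charge is at most -nb/2,
        -- while admissibility of `V` makes it at least -1.
        nb≤2 : nb ≤ 2
        nb≤2 = arith nb (wt 1 k V) (Q μ V) sum₁ (adm V (λ p → p) neV)
          where
          arith : ∀ n w q → 3 * n + 2 * w ≤ 4 * q + 2 * n → 2 * q ≤ w + 1 → n ≤ 2
          arith n w q h i = lin 0 (h ⊕ 2 ⊛ i) (solve (n ∷ w ∷ q ∷ []))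

        size≤ : size V ≤ 1 + 2 * nb
        size≤ = arith nb (wt 1 k V) (Q μ V) (size V) (≤-trans (≤-reflexive sum₂) (≤-trans (over-mono V charge₂) (≤-reflexive sum₃))) (adm V (λ p → p) neV)
          where
          arith : ∀ n w q s → w + s ≤ 2 * q + 2 * n → 2 * q ≤ w + 1 → s ≤ 1 + 2 * n
          arith n w q s h i = lin 0 (h ⊕ i) (solve (n ∷ w ∷ q ∷ s ∷ []))

        -- Here V consists of v₁, v₂ and their common neighbours x, y, z.
        module Five {v₁ v₂ x y z} (s : Star v₁ x y z) (v₂∈B : v₂ ∈ B) (v₁≢v₂ : v₁ ≢ v₂) where
          open Star s

          v₁∈B : v₁ ∈ B
          v₁∈B = star-B s
          v₂∈ : v₂ ∈ V
          v₂∈ = proj₁ (B⁻ v₂∈B)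

          T₁ T₂ T₃ T₄ T₅ : Sub
          T₁ = ｛ v₁ ｝
          T₂ = T₁ +ᵥ v₂
          T₃ = T₂ +ᵥ x
          T₄ = T₃ +ᵥ y
          T₅ = T₄ +ᵥ z
          v₂∉ : v₂ ∉ T₁
          v₂∉ = ∉-｛｝ (v₁≢v₂ ∘ sym)
          x∉ : x ∉ T₂
          x∉ = +ᵥ-∉ T₁ (∉-｛｝ (star-≢ s v₁∈B ∘ sym)) (star-≢ s v₂∈B ∘ sym)
          y∉ : y ∉ T₃
          y∉ = +ᵥ-∉ T₂ (+ᵥ-∉ T₁ (∉-｛｝ (star-≢ (star-rot s) v₁∈B ∘ sym)) (star-≢ (star-rot s) v₂∈B ∘ sym)) (x≢y ∘ sym)
          z∉ : z ∉ T₄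
          z∉ = +ᵥ-∉ T₃ (+ᵥ-∉ T₂ (+ᵥ-∉ T₁ (∉-｛｝ (star-≢ (star-rot (star-rot s)) v₁∈B ∘ sym)) (star-≢ (star-rot (star-rot s)) v₂∈B ∘ sym)) (x≢z ∘ sym)) (y≢z ∘ sym)

          over-T : ∀ f → over T₅ f ≡ f v₁ + f v₂ + f x + f y + f z
          over-T f = trans (over-+ᵥ {S = T₄} {z} f z∉) (cong (_+ f z) (trans (over-+ᵥ {S = T₃} {y} f y∉) (cong (_+ f y)
            (trans (over-+ᵥ {S = T₂} {x} f x∉) (cong (_+ f x) (trans (over-+ᵥ {S = T₁} {v₂} f v₂∉) (cong (_+ f v₂) (over-｛｝ v₁ f))))))))

          T₅⊆V : T₅ ⊆ V
          T₅⊆V = +ᵥ-⊆ T₄ V (+ᵥ-⊆ T₃ V (+ᵥ-⊆ T₂ V (+ᵥ-⊆ T₁ V (single⊆ {S = V} v∈) v₂∈) x∈) y∈) z∈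

          sizeV : size V ≡ 5
          sizeV = ≤-antisym (≤-trans size≤ (s≤s (2 ⊛ nb≤2))) (≤-trans (≤-reflexive (sym (over-T λ _ → 1))) (over-⊆ _ T₅⊆V))

          V⊆T₅ : V ⊆ T₅
          V⊆T₅ {u} u∈ with bool-cases (T₅ u)
          ... | inj₁ h = h
          ... | inj₂ u∉ = ⊥-elim (1+n≰n (≤-trans (≤-trans (≤-reflexive (sym (trans (over-+ᵥ {S = T₅} {u} (λ _ → 1) u∉) (cong (_+ 1) (over-T λ _ → 1)))))
                  (over-⊆ _ (+ᵥ-⊆ T₅ V T₅⊆V u∈))) (≤-reflexive sizeV)))

          over-V : ∀ f → over V f ≡ f v₁ + f v₂ + f x + f y + f z
          over-V f = trans (≤-antisym (over-⊆ f V⊆T₅) (over-⊆ f T₅⊆V)) (over-T f)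

          cls : ∀ {u} → u ∈ V → u ≡ v₁ ⊎ u ≡ v₂ ⊎ u ≡ x ⊎ u ≡ y ⊎ u ≡ z
          cls {u} u∈ with ∪⁻ T₄ ｛ z ｝ {u} (V⊆T₅ {u} u∈)
          ... | inj₂ h = inj₂ (inj₂ (inj₂ (inj₂ (∈-｛｝⁻ {u = u} h))))
          ... | inj₁ h₄ with ∪⁻ T₃ ｛ y ｝ {u} h₄
          ...   | inj₂ h = inj₂ (inj₂ (inj₂ (inj₁ (∈-｛｝⁻ {u = u} h))))
          ...   | inj₁ h₃ with ∪⁻ T₂ ｛ x ｝ {u} h₃
          ...     | inj₂ h = inj₂ (inj₂ (inj₁ (∈-｛｝⁻ {u = u} h)))
          ...     | inj₁ h₂ with ∪⁻ T₁ ｛ v₂ ｝ {u} h₂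
          ...       | inj₂ h = inj₂ (inj₁ (∈-｛｝⁻ {u = u} h))
          ...       | inj₁ h = inj₁ (∈-｛｝⁻ {u = u} h)

          -- With five vertices and at most two of them in `B`, the sum of `charge₂` leaves no room,
          -- so it is an equality at every vertex.
          tight : ∀ {u} → u ∈ V → d u + ⟦ B u ⟧ ≤ k u + 2
          tight {u} u∈ = arith (k u) (d u) ⟦ B u ⟧ _ _ _ _ (over-mono (V - u) λ p → charge₂ (-⊆ˡ V u p))
            (over-remove f u∈) (over-remove h u∈)
            (≤-trans (≤-reflexive sum₃) (≤-trans (total (Q μ V) nb (wt 1 k V) (adm V (λ p → p) neV) nb≤2)
              (≤-reflexive (trans (cong (wt 1 k V +_) (sym sizeV)) sum₂))))
            where
            f h : Fin N → ℕ
            f u = 2 * k u + 3 + 1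
            h u = 2 * d u + 2 * ⟦ B u ⟧
            total : ∀ q n w → 2 * q ≤ w + 1 → n ≤ 2 → 2 * q + 2 * n ≤ w + 5
            total q n w a b = lin 0 (a ⊕ 2 ⊛ b) (solve (q ∷ n ∷ w ∷ []))
            arith : ∀ k d b F H F′ H′ → F ≤ H → F′ ≡ F + (2 * k + 3 + 1) → H′ ≡ H + (2 * d + 2 * b) → H′ ≤ F′ → d + b ≤ k + 2
            arith k d b F H _ _ a refl refl e = *-cancelˡ-≤ 2 (lin 0 (a ⊕ e) (solve (k ∷ d ∷ b ∷ F ∷ H ∷ [])))

          -- M consists of `x` and `y`. In F, the vertices `v₁` and `v₂` are not adjacent, and each
          -- has at most one edge to `z`.
          colour : ∀ {x y z} → x ≢ y → (∀ {u} → u ∈ V → u ≡ v₁ ⊎ u ≡ v₂ ⊎ u ≡ x ⊎ u ≡ y ⊎ u ≡ z) →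
            v₁ ≢ z → z ∈ V → suc (μ x y) ≤ k x → suc (μ x y) ≤ k y → Colourable V μ k
          colour {x} {y} {z} x≢y cl v₁≢z z∈ hx hy = φ , record
            { bound = bnd
            ; forestM = matching-forest σ ι (V ∩ φ) λ {u} p → ≤-pred (≤-trans (bnd (∧-trueˡ p) (∧-trueʳ {V u} p)) (cap u))
            ; forestF = Forest-⊆ (λ {w} → F⊆ {w}) (forest-leaf σ ι X v₂ (Forest-⊆ (λ {w} → X-⊆ {w}) forestY) (≤-trans (over-⊆ (μ v₂) (λ {w} → X-⊆ {w}))
                (≤-trans (≤-reflexive (trans (over-+ᵥ {S = ｛ z ｝} {v₁} (μ v₂) (∉-｛｝ v₁≢z)) (trans (cong₂ _+_ (over-｛｝ z (μ v₂)) (indep v₂∈B v₁∈B)) (+-identityʳ _))))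
                  (≤-trans (≤-reflexive (σ v₂ z)) (bad-≤1 v₂∈B z∈)))))
            }
            where
            φ Y X : Sub
            φ = ｛ x ｝ +ᵥ y
            Y = ｛ z ｝ +ᵥ v₁
            X = Y +ᵥ v₂
            X-⊆ : X - v₂ ⊆ Y
            X-⊆ {w} = -⊆ X Y {v₂} (λ {w′} p → p) {w}
            Y-⊆ : Y - v₁ ⊆ ｛ z ｝
            Y-⊆ {w} = -⊆ Y ｛ z ｝ {v₁} (λ {w′} p → p) {w}
            forestY : Forest μ Y
            forestY = forest-leaf σ ι Y v₁ (Forest-⊆ (λ {w} → Y-⊆ {w}) (small-forest σ ι {X = ｛ z ｝} (≤-reflexive (over-｛｝ z λ _ → 1))))
              (≤-trans (over-⊆ (μ v₁) (λ {w} → Y-⊆ {w})) (≤-trans (≤-reflexive (trans (over-｛｝ z (μ v₁)) (σ v₁ z))) (bad-≤1 v₁∈B z∈)))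
            F⊆ : V ∩ ∁ φ ⊆ X
            F⊆ {u} p with cl (∧-trueˡ p)
            ... | inj₁ refl = ⊆+ᵥ Y v₂ {v₁} (v∈+ᵥ ｛ z ｝ v₁)
            ... | inj₂ (inj₁ refl) = v∈+ᵥ Y v₂
            ... | inj₂ (inj₂ (inj₁ refl)) = ⊥-elim (true≢false (⊆+ᵥ (｛ u ｝) y {u} (∈-｛｝ u)) (not-true (∧-trueʳ {V u} p)))
            ... | inj₂ (inj₂ (inj₂ (inj₁ refl))) = ⊥-elim (true≢false (v∈+ᵥ ｛ x ｝ u) (not-true (∧-trueʳ {V u} p)))
            ... | inj₂ (inj₂ (inj₂ (inj₂ refl))) = ⊆+ᵥ Y v₂ {u} (⊆+ᵥ (｛ u ｝) v₁ {u} (∈-｛｝ u))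
            degφ : ∀ u → deg μ (V ∩ φ) u ≤ μ u x + μ u y
            degφ u = ≤-trans (over-⊆ (μ u) λ {w} → ∧-trueʳ {V w}) (≤-reflexive (trans (over-+ᵥ {S = ｛ x ｝} {y} (μ u) (∉-｛｝ (x≢y ∘ sym))) (cong (_+ μ u y) (over-｛｝ x (μ u)))))
            bnd : ∀ {u} → u ∈ V → u ∈ φ → suc (deg μ (V ∩ φ) u) ≤ k u
            bnd {u} _ p with ∪⁻ ｛ x ｝ ｛ y ｝ {u} p
            ... | inj₁ q = subst (λ w → suc (deg μ (V ∩ φ) w) ≤ k w) (sym (∈-｛｝⁻ {u = u} q)) (≤-trans (s≤s (≤-trans (degφ x) (≤-reflexive (cong (_+ μ x y) (ι x))))) hx)
            ... | inj₂ q = subst (λ w → suc (deg μ (V ∩ φ) w) ≤ k w) (sym (∈-｛｝⁻ {u = u} q)) (≤-trans (s≤s (≤-trans (degφ y) (≤-reflexive (trans (cong₂ _+_ (σ y x) (ι y)) (+-identityʳ _))))) hy)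

          ones : ∀ a b c → a ≤ 1 → b ≤ 1 → c ≤ 1 → 3 ≤ a + b + c → 1 ≤ a × 1 ≤ b × 1 ≤ c
          ones a b c p q r h = lin 0 (q ⊕ r ⊕ h) (solve (a ∷ b ∷ c ∷ [])) , lin 0 (p ⊕ r ⊕ h) (solve (a ∷ b ∷ c ∷ [])) , lin 0 (p ⊕ q ⊕ h) (solve (a ∷ b ∷ c ∷ []))

          -- The three edges at `v` avoid `B` and have no parallels, so they reach all of `x`, `y`
          -- and `z`.
          bad-adj : ∀ {v} → v ∈ B → 1 ≤ μ v x × 1 ≤ μ v y × 1 ≤ μ v z
          bad-adj {v} v∈B = ones (μ v x) (μ v y) (μ v z) (le x∈) (le y∈) (le z∈) (≤-reflexive (sym (trans
            (cong (λ a → a + μ v x + μ v y + μ v z) (sym (cong₂ _+_ (indep v∈B v₁∈B) (indep v∈B v₂∈B))))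
            (trans (sym (over-V (μ v))) (proj₂ (proj₂ (B⁻ v∈B)))))))
            where
            le : ∀ {u} → u ∈ V → μ v u ≤ 1
            le {u} u∈ = ≤-trans (≤-reflexive (σ v u)) (bad-≤1 v∈B u∈)

          inner≤ : ∀ {u} → u ∈ V → 1 ≤ μ v₁ u → 1 ≤ μ v₂ u → μ u x + μ u y + μ u z ≤ k u
          inner≤ {u} u∈ a b = arith (μ u v₁) (μ u v₂) (μ u x) (μ u y) (μ u z) (d u) ⟦ B u ⟧ (k u) (over-V (μ u)) (tight u∈)
            (≤-trans a (≤-reflexive (σ v₁ u))) (≤-trans b (≤-reflexive (σ v₂ u)))
            where
            arith : ∀ p q x y z d b k → d ≡ p + q + x + y + z → d + b ≤ k + 2 → 1 ≤ p → 1 ≤ q → x + y + z ≤ k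
            arith p q x y z _ b k refl h i j = lin b (h ⊕ i ⊕ j) (solve (p ∷ q ∷ x ∷ y ∷ z ∷ b ∷ k ∷ []))

          inner≥ : ∀ {u} → u ∈ V → u ∉ B → k u ≤ μ u x + μ u y + μ u z
          inner≥ {u} u∈ u∉ = arith (μ u v₁) (μ u v₂) (μ u x) (μ u y) (μ u z) (d u) (k u) (over-V (μ u)) (heavy u∈ u∉) (bad-≤1 v₁∈B u∈) (bad-≤1 v₂∈B u∈)
            where
            arith : ∀ p q x y z d k → d ≡ p + q + x + y + z → k + 2 ≤ d → p ≤ 1 → q ≤ 1 → k ≤ x + y + z
            arith p q x y z _ k refl h i j = lin 0 (h ⊕ i ⊕ j) (solve (p ∷ q ∷ x ∷ y ∷ z ∷ k ∷ []))

          -- Among `x`, `y`, `z` the degree of each equals its capacity and is positive, so one of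
          -- them is adjacent to both others. That one goes to F, and the capacity that the other
          -- two had for their edges to it makes room for them in M.
          colourable : Colourable V μ k
          colourable = go (1 ≤? μ x y) (1 ≤? μ x z)
            where
            kx≤ : μ x y + μ x z ≤ k x
            kx≤ = subst (λ a → a + μ x y + μ x z ≤ k x) (ι x) (inner≤ x∈ (proj₁ (bad-adj v₁∈B)) (proj₁ (bad-adj v₂∈B)))
            ky≤ : μ x y + μ y z ≤ k y
            ky≤ = subst (_≤ k y) (cong (_+ μ y z) (trans (cong₂ _+_ (σ y x) (ι y)) (+-identityʳ _))) (inner≤ y∈ (proj₁ (proj₂ (bad-adj v₁∈B))) (proj₁ (proj₂ (bad-adj v₂∈B))))
            kz≤ : μ x z + μ y z ≤ k z
            kz≤ = subst (_≤ k z) (trans (cong₂ _+_ (cong₂ _+_ (σ z x) (σ z y)) (ι z)) (+-identityʳ _)) (inner≤ z∈ (proj₂ (proj₂ (bad-adj v₁∈B))) (proj₂ (proj₂ (bad-adj v₂∈B))))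
            kx≥ : k x ≤ μ x y + μ x z
            kx≥ = subst (λ a → k x ≤ a + μ x y + μ x z) (ι x) (inner≥ x∈ (nonbad (star-≢ s)))
            ky≥ : k y ≤ μ x y + μ y z
            ky≥ = subst (k y ≤_) (cong (_+ μ y z) (trans (cong₂ _+_ (σ y x) (ι y)) (+-identityʳ _))) (inner≥ y∈ (nonbad (star-≢ (star-rot s))))
            kz≥ : k z ≤ μ x z + μ y z
            kz≥ = subst (k z ≤_) (trans (cong₂ _+_ (cong₂ _+_ (σ z x) (σ z y)) (ι z)) (+-identityʳ _)) (inner≥ z∈ (nonbad (star-≢ (star-rot (star-rot s)))))
            sucˡ : ∀ {a b c} → 1 ≤ a → a + b ≤ c → suc b ≤ c
            sucˡ {a} {b} {c} h i = ≤-trans (+-monoˡ-≤ b h) i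
            sucʳ : ∀ {a b c} → 1 ≤ b → a + b ≤ c → suc a ≤ c
            sucʳ {a} {b} {c} h i = sucˡ h (≤-trans (≤-reflexive (+-comm b a)) i)
            posʳ : ∀ {a b c} → ¬ (1 ≤ a) → 1 ≤ c → c ≤ a + b → 1 ≤ b
            posʳ {zero} _ h i = ≤-trans h i
            posʳ {suc a} ¬h _ _ = ⊥-elim (¬h (s≤s z≤n))
            yzx : ∀ {u} → u ∈ V → u ≡ v₁ ⊎ u ≡ v₂ ⊎ u ≡ y ⊎ u ≡ z ⊎ u ≡ x
            yzx u∈ = map₂ (map₂ (assocʳ ∘ swap)) (cls u∈)
            xzy : ∀ {u} → u ∈ V → u ≡ v₁ ⊎ u ≡ v₂ ⊎ u ≡ x ⊎ u ≡ z ⊎ u ≡ y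
            xzy u∈ = map₂ (map₂ (map₂ swap)) (cls u∈)
            go : Dec (1 ≤ μ x y) → Dec (1 ≤ μ x z) → Colourable V μ k
            go (no ¬xy) _ = colour x≢y cls (star-≢ (star-rot (star-rot s)) v₁∈B) z∈ (sucʳ (posʳ ¬xy kx kx≥) kx≤) (sucʳ (posʳ ¬xy ky ky≥) ky≤)
            go (yes xy) (yes xz) = colour y≢z yzx (star-≢ s v₁∈B) x∈ (sucˡ xy ky≤) (sucˡ xz kz≤)
            go (yes xy) (no ¬xz) = colour x≢z xzy (star-≢ (star-rot s) v₁∈B) y∈ (sucˡ xy kx≤) (sucʳ (posʳ ¬xz kz kz≥) kz≤)

        -- A vertex of `B` has three neighbours outside `B`, so nb + 3 ≤ 1 + 2nb: one vertex of `B`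
        -- forces a second.
        discharged : Colourable V μ k
        discharged with empty? B
        ... | inj₂ e = small-colourable σ ι k (≤-trans size≤ (≤-reflexive (cong (λ n → 1 + 2 * n) (over-zero B λ {u} p → ⊥-elim (true≢false p (e u))))))
        ... | inj₁ (v₁ , v₁∈B) = let x , y , z , s = bad-star v₁∈B in go s
          where
          go : ∀ {x y z} → Star v₁ x y z → Colourable V μ k
          go {x} {y} {z} s with over-pos (B - v₁) (λ _ → 1) one-more
            where
            open Star s
            x∉ : x ∉ B
            x∉ = nonbad (star-≢ s)
            y∉ : y ∉ B +ᵥ x
            y∉ = +ᵥ-∉ B (nonbad (star-≢ (star-rot s))) (x≢y ∘ sym)
            z∉ : z ∉ B +ᵥ x +ᵥ y
            z∉ = +ᵥ-∉ (B +ᵥ x) (+ᵥ-∉ B (nonbad (star-≢ (star-rot (star-rot s)))) (x≢z ∘ sym)) (y≢z ∘ sym)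
            big : nb + 1 + 1 + 1 ≤ size V
            big = ≤-trans (≤-reflexive (sym (trans (over-+ᵥ {S = B +ᵥ x +ᵥ y} {z} _ z∉) (cong (_+ 1) (trans (over-+ᵥ {S = B +ᵥ x} {y} _ y∉) (cong (_+ 1) (over-+ᵥ {S = B} {x} _ x∉)))))))
              (over-⊆ _ (+ᵥ-⊆ (B +ᵥ x +ᵥ y) V (+ᵥ-⊆ (B +ᵥ x) V (+ᵥ-⊆ B V ∧-trueˡ x∈) y∈) z∈))
            one-more : 1 ≤ size (B - v₁)
            one-more = arith (size (B - v₁)) nb (size V) (over-remove {S = B} (λ _ → 1) v₁∈B) big size≤
              where
              arith : ∀ a n s → n ≡ a + 1 → n + 1 + 1 + 1 ≤ s → s ≤ 1 + 2 * n → 1 ≤ a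
              arith a _ s refl h i = lin 0 (h ⊕ i) (solve (a ∷ s ∷ []))
          ... | v₂ , v₂∈ , _ = Five.colourable s (-⊆ˡ B v₁ v₂∈) (-⁻ B v₂∈ ∘ sym)

  colour₁ : Colourable V μ k
  colour₁ with empty? V
  ... | inj₂ e = small-colourable σ ι k (≤-trans (≤-reflexive (over-zero V λ {u} p → ⊥-elim (true≢false p (e u)))) z≤n)
  ... | inj₁ neV = go many?
    where
    go₃ : Many → Independent → FewBad 1 3 → Colourable V μ k ⊎ FewBad 2 4 → Colourable V μ k
    go₃ many indep few₁ (inj₁ c) = c
    go₃ many indep few₁ (inj₂ few₂) = Bad-stars.Discharge.discharged many indep few₁ few₂ neV
    go₂ : Many → Independent → Colourable V μ k ⊎ FewBad 1 3 → Colourable V μ k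
    go₂ many indep (inj₁ c) = c
    go₂ many indep (inj₂ few₁) = go₃ many indep few₁ (Bad-stars.tight₂? many indep)
    go₁ : Many → Colourable V μ k ⊎ Independent → Colourable V μ k
    go₁ many (inj₁ c) = c
    go₁ many (inj₂ indep) = go₂ many indep (Bad-stars.tight₁? many)
    go : Colourable V μ k ⊎ Many → Colourable V μ k
    go (inj₁ c) = c
    go (inj₂ many) = go₁ many (Bad-stars.independent? many)

-- The weighted theorem, by induction on the measure

weighted-theorem : ∀ D → 1 ≤ D → ∀ {N} (V : Sub {N}) μ k → Symmetric μ → Irreflexive μ →
  (∀ u → k u ≤ suc D) → Adm D V μ k → Colourable V μ k
weighted-theorem D 1≤D V μ k σ ι cap adm = go V μ k σ ι cap adm (<-wellFounded (meas V k))
  where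
  go : ∀ {N} (V : Sub {N}) μ k → Symmetric μ → Irreflexive μ → (∀ u → k u ≤ suc D) → Adm D V μ k →
    Acc _<_ (meas V k) → Colourable V μ k
  go {N} V μ k σ ι cap adm (acc rec) = by-size (D ≟ℕ 1)
    where
    IH : Hypothesis D (meas V k)
    IH V′ ν l σ′ ι′ cap′ adm′ lt = go V′ ν l σ′ ι′ cap′ adm′ (rec lt)
    by-size : Dec (D ≡ 1) → Colourable V μ k
    by-size (no D≢1) = Step.D≥2-colourable D 1≤D V σ ι k cap adm IH (≤∧≢⇒< 1≤D (D≢1 ∘ sym))
    by-size (yes refl) = case Step.gap 1 1≤D V σ ι k cap adm IH of λ
      { (inj₁ c) → c ; (inj₂ (_ , g)) → One.colour₁ V σ ι k cap adm IH (g refl) }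

-- Multigraphs

sum-const-1 : ∀ n → sum {n} (λ _ → 1) ≡ n
sum-const-1 zero = refl
sum-const-1 (suc n) = cong suc (sum-const-1 n)

sum-injection : ∀ {m k} (g : Fin m → ℕ) (f : Fin k → Fin m) → (∀ {i j} → f i ≡ f j → i ≡ j) → (∀ i → 1 ≤ g (f i)) → k ≤ sum g
sum-injection {m} {k} g f inj pos = begin
  k                                      ≡⟨ sum-const-1 k ⟨
  sum {k} (λ _ → 1)                      ≡⟨ sum-cong-≗ (λ i → sym (trans (sum-single (λ e → ⟦ ｛ f i ｝ e ⟧) (f i) λ e p → cong ⟦_⟧ (∉-｛｝ p)) (cong ⟦_⟧ (∈-｛｝ (f i))))) ⟩
  sum (λ i → sum λ e → ⟦ ｛ f i ｝ e ⟧)  ≡⟨ ∑-comm (λ i e → ⟦ ｛ f i ｝ e ⟧) ⟩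
  sum (λ e → sum λ i → ⟦ ｛ f i ｝ e ⟧)  ≤⟨ sum-mono pt ⟩
  sum g ∎
  where
  open ≤-Reasoning
  pt : ∀ e → sum (λ i → ⟦ ｛ f i ｝ e ⟧) ≤ g e
  pt e with any? (λ i → e ≟ f i)
  ... | yes (i , refl) = ≤-trans (≤-reflexive (trans (sum-single (λ j → ⟦ ｛ f j ｝ (f i) ⟧) i λ j p → cong ⟦_⟧ (∉-｛｝ (λ e → p (inj (sym e))))) (cong ⟦_⟧ (∈-｛｝ (f i))))) (pos i)
  ... | no ¬p = ≤-trans (≤-reflexive (sum-zero λ i → cong ⟦_⟧ (∉-｛｝ λ q → ¬p (i , q)))) z≤n

length-filter : ∀ {m} (P : Fin m → Bool) → ∀ {n} (f : Fin n → Fin m) → length (filter (λ e → T? (P e)) (tabulate f)) ≡ sum λ i → ⟦ P (f i) ⟧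
length-filter P {zero} f = refl
length-filter P {suc n} f with P (f zero)
... | true = cong suc (length-filter P (f ∘ suc))
... | false = length-filter P (f ∘ suc)

⌊⌋-true : ∀ {A : Set} (a? : Dec A) → A → ⌊ a? ⌋ ≡ true
⌊⌋-true (yes _) _ = refl
⌊⌋-true (no ¬a) a = ⊥-elim (¬a a)

⌊⌋-false : ∀ {A : Set} (a? : Dec A) → ¬ A → ⌊ a? ⌋ ≡ false
⌊⌋-false (yes a) ¬a = ⊥-elim (¬a a)
⌊⌋-false (no _) _ = refl

module Bridge (G : Multigraph) where

  src tgt : Fin (m G) → Fin (n G)
  src e = proj₁ (ends G e)
  tgt e = proj₂ (ends G e)

  μ : Mult {n G}
  μ u w = sum λ e → ⟦ ｛ src e ｝ u ∧ ｛ tgt e ｝ w ⟧ + ⟦ ｛ tgt e ｝ u ∧ ｛ src e ｝ w ⟧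

  σ : Symmetric μ
  σ u w = sum-cong-≗ λ e → trans (+-comm ⟦ ｛ src e ｝ u ∧ ｛ tgt e ｝ w ⟧ ⟦ ｛ tgt e ｝ u ∧ ｛ src e ｝ w ⟧)
    (cong₂ _+_ (⟦∧⟧-comm (｛ tgt e ｝ u) (｛ src e ｝ w)) (⟦∧⟧-comm (｛ src e ｝ u) (｛ tgt e ｝ w)))

  not-both : ∀ e u → ｛ src e ｝ u ∧ ｛ tgt e ｝ u ≡ false
  not-both e u with u ≟ src e | u ≟ tgt e
  ... | yes refl | yes q = ⊥-elim (loopless G e q)
  ... | yes _ | no _ = refl
  ... | no _ | _ = refl

  ι : Irreflexive μ
  ι u = sum-zero λ e → cong₂ _+_ (cong ⟦_⟧ (not-both e u)) (trans (⟦∧⟧-comm (｛ tgt e ｝ u) (｛ src e ｝ u)) (cong ⟦_⟧ (not-both e u)))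

  term : Sub → Fin (n G) → Fin (m G) → ℕ
  term T u e = ⟦ ｛ src e ｝ u ∧ T (tgt e) ⟧ + ⟦ ｛ tgt e ｝ u ∧ T (src e) ⟧

  deg-sum : ∀ T u → deg μ T u ≡ sum (term T u)
  deg-sum T u = trans (over-sum T λ e w → ⟦ ｛ src e ｝ u ∧ ｛ tgt e ｝ w ⟧ + ⟦ ｛ tgt e ｝ u ∧ ｛ src e ｝ w ⟧) (sum-cong-≗ λ e → trans (over-+ T _ _)
    (cong₂ _+_ (over-∧ʳ T (｛ src e ｝ u) (tgt e)) (over-∧ʳ T (｛ tgt e ｝ u) (src e))))

  within : Sub → Fin (m G) → Bool
  within S e = S (src e) ∧ S (tgt e)

  edges : Sub → ℕ
  edges S = sum λ e → ⟦ within S e ⟧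

  Q-sum : ∀ S → Q μ S ≡ 2 * edges S
  Q-sum S = trans (over-cong S λ {u} _ → deg-sum S u) (trans (over-sum S λ e u → term S u e) (trans (sum-cong-≗ λ e → trans (over-+ S _ _)
    (trans (cong₂ _+_ (over-∧ˡ S (S (tgt e)) (src e)) (trans (over-∧ˡ S (S (src e)) (tgt e)) (⟦∧⟧-comm (S (tgt e)) (S (src e)))))
      (cong (⟦ within S e ⟧ +_) (sym (+-identityʳ ⟦ within S e ⟧)))))
    (sym (*-distribˡ-sum 2 (λ e → ⟦ within S e ⟧)))))

  cycle-mono : ∀ {P P′ : EdgeSet G} → (∀ e → P e ≡ true → P′ e ≡ true) → Cycle G P → Cycle G P′
  cycle-mono h c = record
    { k = k ; k≥2 = k≥2 ; vtx = vtx ; edg = edg ; closed = closed ; joins = joins ; inP = λ i → h (edg i) (inP i)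
    ; edg-inj = edg-inj ; vtx-inj = vtx-inj }
    where open Cycle c

  -- A cycle of length `k` has at most `k` vertices, and they span its `k` distinct edges: too many
  -- for a forest.
  forest-no-cycle : ∀ {X} {P : EdgeSet G} → (∀ e → P e ≡ true → src e ∈ X × tgt e ∈ X) → Forest μ X → ¬ Cycle G P
  forest-no-cycle {X} {P} P⊆ f c = 1+n≰n (arith k (edges S) (size S) (sum-injection (λ e → ⟦ within S e ⟧) edg edg-inj (λ i → ≤-reflexive (sym (cong ⟦_⟧ (edge∈ i))))) size≤
    (≤-trans (≤-reflexive (cong (_+ 2) (sym (Q-sum S)))) (f S S⊆X (vtx (inject₁ i₀) , S∋ i₀))))
    where
    open Cycle c
    S : Sub
    S v = does (any? λ i → v ≟ vtx (inject₁ i))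
    S∋ : ∀ i → vtx (inject₁ i) ∈ S
    S∋ i = dec-true (any? λ j → vtx (inject₁ i) ≟ vtx (inject₁ j)) (i , refl)
    S⁻ : ∀ {v} → v ∈ S → ∃ λ i → v ≡ vtx (inject₁ i)
    S⁻ {v} p with any? (λ i → v ≟ vtx (inject₁ i))
    ... | yes q = q
    i₀ : Fin k
    i₀ = fromℕ< (≤-trans (s≤s z≤n) k≥2)
    next∈ : ∀ (j : Fin (suc k)) → vtx j ∈ S
    next∈ j with view j
    ... | ‵fromℕ = subst (_∈ S) (trans (cong vtx (toℕ-injective (trans (toℕ-inject₁ i₀) (toℕ-fromℕ< (≤-trans (s≤s z≤n) k≥2))))) (sym closed)) (S∋ i₀)
    ... | ‵inject₁ i = S∋ i
    edge∈ : ∀ i → within S (edg i) ≡ true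
    edge∈ i with joins i
    ... | inj₁ (p , q) = ∧-true (subst (_∈ S) (sym p) (S∋ i)) (subst (_∈ S) (sym q) (next∈ (suc i)))
    ... | inj₂ (p , q) = ∧-true (subst (_∈ S) (sym p) (next∈ (suc i))) (subst (_∈ S) (sym q) (S∋ i))
    S⊆X : S ⊆ X
    S⊆X {v} p with S⁻ {v} p
    ... | i , refl with joins i | P⊆ (edg i) (inP i)
    ...   | inj₁ (q , _) | h , _ = subst (_∈ X) q h
    ...   | inj₂ (_ , q) | _ , h = subst (_∈ X) q h
    size≤ : size S ≤ k
    size≤ = ≤-trans (over-mono S λ {v} p → let i , e = S⁻ {v} p in
        ≤-trans (≤-reflexive (sym (cong ⟦_⟧ (subst (λ w → v ∈ ｛ w ｝) e (∈-｛｝ v))))) (term≤sum (λ i → ⟦ ｛ vtx (inject₁ i) ｝ v ⟧) i))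
      (≤-trans (≤-reflexive (over-sum S λ i v → ⟦ ｛ vtx (inject₁ i) ｝ v ⟧))
        (≤-trans (sum-mono λ i → ≤-trans (≤-reflexive (over-indicator S (vtx (inject₁ i)))) (⟦⟧≤1 _)) (≤-reflexive (sum-const-1 k))))
    arith : ∀ k e s → k ≤ e → s ≤ k → 2 * e + 2 ≤ 2 * s → 2 ≤ 1
    arith k e s h i j = lin 1 (2 ⊛ h ⊕ 2 ⊛ i ⊕ j) (solve (k ∷ e ∷ s ∷ []))

  term≤1 : ∀ T u e → term T u e ≤ 1
  term≤1 T u e with u ≟ src e | u ≟ tgt e
  ... | yes refl | yes q = ⊥-elim (loopless G e q)
  ... | yes _ | no _ = ≤-trans (≤-reflexive (+-identityʳ _)) (⟦⟧≤1 (T (tgt e)))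
  ... | no _ | yes _ = ⟦⟧≤1 (T (src e))
  ... | no _ | no _ = z≤n

  term-joins : ∀ T u e → 1 ≤ term T u e → ∃ λ w → w ∈ T × Joins G e u w
  term-joins T u e h with u ≟ src e | u ≟ tgt e | bool-cases (T (tgt e)) | bool-cases (T (src e))
  ... | yes p | _ | inj₁ t | _ = tgt e , t , inj₁ (sym p , refl)
  ... | yes refl | yes q | _ | _ = ⊥-elim (loopless G e q)
  ... | yes refl | no _ | inj₂ t | _ = ⊥-elim (case subst (λ b → 1 ≤ ⟦ b ⟧ + 0) t h of λ ())
  ... | no _ | yes q | _ | inj₁ t = src e , t , inj₂ (refl , sym q)
  ... | no _ | yes q | _ | inj₂ t = ⊥-elim (case subst (λ b → 1 ≤ ⟦ b ⟧) t h of λ ())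
  term-joins T u e () | no _ | no _ | _ | _

  second-term : ∀ {k} (f : Fin k → ℕ) e → 2 ≤ sum f → f e ≤ 1 → ∃ λ e′ → e′ ≢ e × 1 ≤ f e′
  second-term f e h i with any? (λ e′ → ¬? (e′ ≟ e) ×-dec (1 ≤? f e′))
  ... | yes p = p
  ... | no ¬p = ⊥-elim (1+n≰n (≤-trans h (≤-trans (≤-reflexive (sum-single f e λ e′ q → n<1⇒n≡0 (≰⇒> λ r → ¬p (e′ , q , r)))) i)))

  joins-unique : ∀ {e p q r s} → Joins G e p q → Joins G e r s → (p ≡ r × q ≡ s) ⊎ (p ≡ s × q ≡ r)
  joins-unique (inj₁ (a , b)) (inj₁ (c , d)) = inj₁ (trans (sym a) c , trans (sym b) d)
  joins-unique (inj₁ (a , b)) (inj₂ (c , d)) = inj₂ (trans (sym a) c , trans (sym b) d)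
  joins-unique (inj₂ (a , b)) (inj₁ (c , d)) = inj₂ (trans (sym b) d , trans (sym a) c)
  joins-unique (inj₂ (a , b)) (inj₂ (c , d)) = inj₁ (trans (sym b) d , trans (sym a) c)

  joins-irrefl : ∀ {e p} → ¬ Joins G e p p
  joins-irrefl {e} (inj₁ (a , b)) = loopless G e (trans a (sym b))
  joins-irrefl {e} (inj₂ (a , b)) = loopless G e (trans a (sym b))

  -- A walk that never turns back, in a set of minimum degree 2, closes a cycle at its first repeated vertex.
  module Walk (S : Sub) (d≥2 : ∀ {v} → v ∈ S → 2 ≤ deg μ S v) (start : Nonempty S) where

    record State : Set where
      constructor state
      field
        at : Fin (n G)
        at∈ : at ∈ S
        via : Fin (m G)
    open State

    step : ∀ s → ∃ λ s′ → Joins G (via s′) (at s) (at s′) × via s′ ≢ via s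
    step (state v v∈ e) = let e′ , e′≢e , h = second-term (term S v) e (≤-trans (d≥2 v∈) (≤-reflexive (deg-sum S v))) (term≤1 S v e)
                              w , w∈ , j = term-joins S v e′ h
                          in state w w∈ e′ , j , e′≢e

    walk : ℕ → State
    walk zero = state (proj₁ start) (proj₂ start)
      (proj₁ (sum-pos (term S (proj₁ start)) (≤-trans (s≤s z≤n) (≤-trans (d≥2 (proj₂ start)) (≤-reflexive (deg-sum S (proj₁ start)))))))
    walk (suc i) = proj₁ (step (walk i))

    vt : ℕ → Fin (n G)
    vt i = at (walk i)
    ed : ℕ → Fin (m G)
    ed i = via (walk i)
    walk-joins : ∀ i → Joins G (ed (suc i)) (vt i) (vt (suc i))
    walk-joins i = proj₁ (proj₂ (step (walk i)))
    no-return : ∀ i → ed (suc i) ≢ ed i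
    no-return i = proj₂ (proj₂ (step (walk i)))

    Distinct : ℕ → Set
    Distinct j = ∀ {a b} → a < b → b < j → vt a ≢ vt b

    first-repeat : ∀ j → Distinct j ⊎ ∃ λ i → ∃ λ j′ → i < j′ × vt i ≡ vt j′ × Distinct j′
    first-repeat zero = inj₁ λ _ ()
    first-repeat (suc j) with first-repeat j
    ... | inj₂ r = inj₂ r
    ... | inj₁ h with any? (λ (i : Fin j) → vt (toℕ i) ≟ vt j)
    ...   | yes (i , e) = inj₂ (toℕ i , j , toℕ<n i , e , h)
    ...   | no ¬p = inj₁ λ {a} {b} a<b b<sj → case m≤n⇒m<n∨m≡n (≤-pred b<sj) of λ
              { (inj₁ b<j) → h a<b b<j
              ; (inj₂ refl) → λ e → ¬p (fromℕ< a<b , trans (cong vt (toℕ-fromℕ< a<b)) e) }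

    repeat : ∃ λ i → ∃ λ j → i < j × vt i ≡ vt j × Distinct j
    repeat with first-repeat (suc (n G))
    ... | inj₂ r = r
    ... | inj₁ h = let a , b , a<b , e = pigeonhole (n<1+n (n G)) (λ i → vt (toℕ i)) in ⊥-elim (h a<b (toℕ<n b) e)

    cycle : Cycle G (within S)
    cycle = let i , j , i<j , e , h = repeat in build i (j ∸ suc i) (subst (λ j → vt i ≡ vt j) (sym (m+[n∸m]≡n i<j)) e)
                                                   (subst Distinct (sym (m+[n∸m]≡n i<j)) h)
      where
      build : ∀ i o → vt i ≡ vt (suc i + o) → Distinct (suc i + o) → Cycle G (within S)
      build i o e h = record
        { k = suc o ; k≥2 = k≥2 o e ; vtx = λ l → vt (i + toℕ l) ; edg = λ l → ed (suc (i + toℕ l))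
        ; closed = trans (cong (λ x → vt (i + x)) (toℕ-fromℕ (suc o))) (trans (cong vt (+-suc i o)) (trans (sym e) (cong vt (sym (+-identityʳ i)))))
        ; joins = λ l → subst₂ (Joins G (ed (suc (i + toℕ l)))) (cong (λ x → vt (i + x)) (sym (toℕ-inject₁ l))) (cong vt (sym (+-suc i (toℕ l)))) (walk-joins (i + toℕ l))
        ; inP = λ l → in-S (i + toℕ l)
        ; edg-inj = λ {l} {l′} p → toℕ-injective (edge-inj (toℕ<n l) (toℕ<n l′) p)
        ; vtx-inj = λ {l} {l′} p → toℕ-injective (vertex-inj (toℕ<n l) (toℕ<n l′)
            (trans (cong (λ x → vt (i + x)) (sym (toℕ-inject₁ l))) (trans p (cong (λ x → vt (i + x)) (toℕ-inject₁ l′))))) }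
        where
        k≥2 : ∀ o → vt i ≡ vt (suc i + o) → 2 ≤ suc o
        -- A repetition after a single step would be a loop.
        k≥2 zero e = ⊥-elim (joins-irrefl (subst (Joins G (ed (suc i)) (vt i)) (trans (cong vt (sym (+-identityʳ (suc i)))) (sym e)) (walk-joins i)))
        k≥2 (suc o) _ = s≤s (s≤s z≤n)
        in-S : ∀ j → within S (ed (suc j)) ≡ true
        in-S j with walk-joins j
        ... | inj₁ (p , q) = ∧-true (subst (_∈ S) (sym p) (at∈ (walk j))) (subst (_∈ S) (sym q) (at∈ (walk (suc j))))
        ... | inj₂ (p , q) = ∧-true (subst (_∈ S) (sym p) (at∈ (walk (suc j)))) (subst (_∈ S) (sym q) (at∈ (walk j)))
        bound : ∀ {a} → a < suc o → i + a < suc i + o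
        bound {a} p = ≤-trans (≤-reflexive (sym (+-suc i a))) (≤-trans (+-monoʳ-≤ i p) (≤-reflexive (+-suc i o)))
        vertex-inj : ∀ {a b} → a < suc o → b < suc o → vt (i + a) ≡ vt (i + b) → a ≡ b
        vertex-inj {a} {b} p q r with <-cmp a b
        ... | tri< a<b _ _ = ⊥-elim (h (+-monoʳ-< i a<b) (bound q) r)
        ... | tri≈ _ a≡b _ = a≡b
        ... | tri> _ _ b<a = ⊥-elim (h (+-monoʳ-< i b<a) (bound p) (sym r))
        -- An edge used again in the same direction repeats a vertex too early. Used again
        -- backwards, it does so too unless the two uses are consecutive, and that is excluded by
        -- `no-return`.
        edge-< : ∀ {a b} → a < b → b < suc o → ed (suc (i + a)) ≢ ed (suc (i + b))
        edge-< {a} {b} a<b q r with joins-unique (walk-joins (i + a)) (subst (λ e → Joins G e (vt (i + b)) (vt (suc (i + b)))) (sym r) (walk-joins (i + b)))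
        ... | inj₁ (x , _) = h (+-monoʳ-< i a<b) (bound q) x
        ... | inj₂ (_ , y) with m≤n⇒m<n∨m≡n a<b
        ...   | inj₁ sa<b = h (≤-trans (s≤s (≤-reflexive (sym (+-suc i a)))) (+-monoʳ-< i sa<b)) (bound q) y
        ...   | inj₂ refl = no-return (suc (i + a)) (sym (trans r (cong (ed ∘ suc) (+-suc i a))))
        edge-inj : ∀ {a b} → a < suc o → b < suc o → ed (suc (i + a)) ≡ ed (suc (i + b)) → a ≡ b
        edge-inj {a} {b} p q r with <-cmp a b
        ... | tri< a<b _ _ = ⊥-elim (edge-< a<b q r)
        ... | tri≈ _ a≡b _ = a≡b
        ... | tri> _ _ b<a = ⊥-elim (edge-< b<a p (sym r))

  -- Deleting a vertex of degree at most 1 preserves the density and cannot empty the set, since a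
  -- single vertex spans no edge. What remains has minimum degree 2, as `Walk` requires.
  dense-cycle : ∀ S → Nonempty S → 2 * size S ≤ Q μ S → Cycle G (within S)
  dense-cycle S ne h = go S ne h (<-wellFounded (size S))
    where
    go : ∀ S → Nonempty S → 2 * size S ≤ Q μ S → Acc _<_ (size S) → Cycle G (within S)
    go S ne h (acc rec) with any? (λ v → (S v ≟ᵇ true) ×-dec (deg μ S v ≤? 1))
    ... | no ¬p = Walk.cycle S (λ {v} v∈ → ≰⇒> λ d≤1 → ¬p (v , v∈ , d≤1)) ne
    ... | yes (v , v∈ , d≤1) = cycle-mono (λ e p → ∧-true (-⊆ˡ S v (∧-trueˡ p)) (-⊆ˡ S v (∧-trueʳ {(S - v) (src e)} p)))
            (go (S - v) (nonempty (empty? (S - v))) h′ (rec (≤-reflexive (trans (+-comm 1 _) (sym (over-remove {S = S} _ v∈))))))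
      where
      d′ : deg μ (S - v) v ≤ 1
      d′ = ≤-trans (over-⊆ (μ v) (-⊆ˡ S v)) d≤1
      h″ : 2 * (size (S - v) + 1) ≤ Q μ (S - v) + 2 * deg μ (S - v) v
      h″ = subst₂ (λ s q → 2 * s ≤ q) (over-remove {S = S} _ v∈) (Q-remove σ ι {S} v∈) h
      h′ : 2 * size (S - v) ≤ Q μ (S - v)
      h′ = arith (size (S - v)) (Q μ (S - v)) (deg μ (S - v) v) h″ d′
        where
        arith : ∀ s q d → 2 * (s + 1) ≤ q + 2 * d → d ≤ 1 → 2 * s ≤ q
        arith s q d a b = lin 0 (a ⊕ 2 ⊛ b) (solve (s ∷ q ∷ d ∷ []))
      nonempty : Nonempty (S - v) ⊎ (∀ u → u ∉ S - v) → Nonempty (S - v)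
      nonempty (inj₁ p) = p
      nonempty (inj₂ e) = ⊥-elim (1+n≰n (≤-trans (≤-trans (s≤s z≤n) (2 ⊛ m≤n+m 1 (size (S - v))))
        (≤-trans h″ (≤-reflexive (cong₂ (λ a b → a + 2 * b) (Q-empty μ {S - v} e) (deg-empty μ {S - v} v e))))))

  -- `Q` is twice a number of edges, so by parity a violation of the forest bound is a density of
  -- `2 * size S ≤ Q μ S`, and `dense-cycle` applies.
  no-cycle-forest : ∀ {X} {P : EdgeSet G} → (∀ e → src e ∈ X → tgt e ∈ X → P e ≡ true) → ¬ Cycle G P → Forest μ X
  no-cycle-forest {X} {P} ⊆P ¬c S S⊆X ne with Q μ S + 2 ≤? 2 * size S
  ... | yes h = h
  ... | no h = ⊥-elim (¬c (cycle-mono (λ e p → ⊆P e (S⊆X (∧-trueˡ p)) (S⊆X (∧-trueʳ {S (src e)} p))) (dense-cycle S ne even)))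
    where
    halve : ∀ a b → ¬ (2 * a + 2 ≤ 2 * b) → b ≤ a
    halve a b h = ≮⇒≥ λ a<b → h (≤-trans (≤-reflexive (trans (+-comm (2 * a) 2) (sym (*-suc 2 a)))) (2 ⊛ a<b))
    even : 2 * size S ≤ Q μ S
    even = ≤-trans (2 ⊛ halve (edges S) (size S) (λ r → h (≤-trans (≤-reflexive (cong (_+ 2) (Q-sum S))) r))) (≤-reflexive (sym (Q-sum S)))

  degree-sum : ∀ P v → degree G P v ≡ sum λ e → ⟦ P e ∧ incident G e v ⟧
  degree-sum P v = length-filter (λ e → P e ∧ incident G e v) (λ e → e)

  fromDF : ∀ D A → DFColoring D G A (within A) → Colourable A μ (λ _ → suc D)
  fromDF D A (c , fM , dM , fF) = c , record
    { bound = λ {v} v∈ c∈ → s≤s (≤-trans (≤-trans (≤-reflexive (deg-sum (A ∩ c) v))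
        (≤-trans (sum-mono (pt v v∈ c∈)) (≤-reflexive (sym (degree-sum (induced G A (within A) c) v))))) (dM v v∈ c∈))
    ; forestM = no-cycle-forest (induced⁺ c) fM
    ; forestF = no-cycle-forest (induced⁺ (∁ c)) fF }
    where
    induced⁺ : ∀ c e → src e ∈ A ∩ c → tgt e ∈ A ∩ c → induced G A (within A) c e ≡ true
    induced⁺ c e p q = ∧-true (∧-true a b) (∧-true a (∧-true b (∧-true (∧-trueʳ {A (src e)} p) (∧-trueʳ {A (tgt e)} q))))
      where
      a = ∧-trueˡ {A (src e)} p
      b = ∧-trueˡ {A (tgt e)} q
    pt : ∀ v → v ∈ A → v ∈ c → ∀ e → term (A ∩ c) v e ≤ ⟦ induced G A (within A) c e ∧ incident G e v ⟧
    pt v v∈ c∈ e with 1 ≤? term (A ∩ c) v e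
    ... | no h = ≤-trans (≤-pred (≰⇒> h)) z≤n
    ... | yes h = ≤-trans (term≤1 (A ∩ c) v e) (≤-reflexive (sym (cong ⟦_⟧ (∧-true ind inc))))
      where
      j = term-joins (A ∩ c) v e h
      ind : induced G A (within A) c e ≡ true
      ind with proj₂ (proj₂ j)
      ... | inj₁ (p , q) = induced⁺ c e (subst (_∈ A ∩ c) (sym p) (∧-true v∈ c∈)) (subst (_∈ A ∩ c) (sym q) (proj₁ (proj₂ j)))
      ... | inj₂ (p , q) = induced⁺ c e (subst (_∈ A ∩ c) (sym p) (proj₁ (proj₂ j))) (subst (_∈ A ∩ c) (sym q) (∧-true v∈ c∈))
      inc : incident G e v ≡ true
      inc with proj₂ (proj₂ j)
      ... | inj₁ (p , _) rewrite ⌊⌋-true (src e ≟ v) p = refl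
      ... | inj₂ (_ , q) rewrite ⌊⌋-true (tgt e ≟ v) q = ∨-true ⌊ src e ≟ v ⌋
        where
        ∨-true : ∀ b → b ∨ true ≡ true
        ∨-true true = refl
        ∨-true false = refl

  all : Sub {n G}
  all _ = true

  toDF : ∀ D → Colourable all μ (λ _ → suc D) → DFColoring D G all (λ _ → true)
  toDF D (c , col) = c , forest-no-cycle {all ∩ c} (λ e p → ∧-trueˡ p , ∧-trueʳ {c (src e)} p) forestM
    , (λ v _ c∈ → ≤-trans (≤-trans (≤-reflexive (degree-sum (induced G all (λ _ → true) c) v)) (≤-trans (sum-mono (pt v)) (≤-reflexive (sym (deg-sum (all ∩ c) v))))) (≤-pred (bound refl c∈)))
    , forest-no-cycle {all ∩ ∁ c} (λ e p → ∧-trueˡ p , ∧-trueʳ {not (c (src e))} p) forestF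
    where
    open IsCol col
    pt : ∀ v e → ⟦ induced G all (λ _ → true) c e ∧ incident G e v ⟧ ≤ term (all ∩ c) v e
    pt v e with c (src e) | c (tgt e) | ≡⊎≢ v (src e) | ≡⊎≢ v (tgt e)
    ... | true | true | inj₁ p | _ rewrite dec-true (v ≟ src e) p = ≤-trans (⟦⟧≤1 _) (m≤m+n 1 _)
    ... | true | true | inj₂ _ | inj₁ q rewrite dec-true (v ≟ tgt e) q = ≤-trans (⟦⟧≤1 _) (m≤n+m 1 _)
    ... | true | true | inj₂ p | inj₂ q rewrite ⌊⌋-false (src e ≟ v) (p ∘ sym) | ⌊⌋-false (tgt e ≟ v) (q ∘ sym) = z≤n
    ... | true | false | _ | _ = z≤n
    ... | false | _ | _ | _ = z≤n

-- Critical multigraphs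

theorem1p4 : (D : ℕ) → 1 ≤ D → (G : Multigraph) → Critical D G → 3 ≤ n G →
    (4 * D + 3) * n G + 2 ≤ 2 * (D + 1) * m G
theorem1p4 D 1≤D G (¬col , sub) _ with (4 * D + 3) * n G + 2 ≤? 2 * (D + 1) * m G
... | yes h = h
... | no ¬h = ⊥-elim (¬col (toDF D (by-violation (any-subset? {P = Violation} viol-resp viol?))))
  where
  open Bridge G
  k : Fin (n G) → ℕ
  k _ = suc D

  wt-all : wt D k all ≡ (4 * D + 3) * n G
  wt-all = trans (trans (over-cong all λ _ → arith D) (over-* all (4 * D + 3) _)) (cong ((4 * D + 3) *_) (trans (over-all _) (sum-const-1 (n G))))
    where
    arith : ∀ D → 2 * suc D + (2 * D + 1) ≡ (4 * D + 3) * 1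
    arith D = solve (D ∷ [])

  Q-all : suc D * Q μ all ≡ 2 * (D + 1) * m G
  Q-all = trans (cong (suc D *_) (trans (Q-sum all) (cong (2 *_) (sum-const-1 (m G))))) (arith D (m G))
    where
    arith : ∀ D m → suc D * (2 * m) ≡ 2 * (D + 1) * m
    arith D m = solve (D ∷ m ∷ [])

  -- The failure of the claimed bound says precisely that the whole vertex set has potential at
  -- least -1.
  adm-all : suc D * Q μ all ≤ wt D k all + 1
  adm-all = subst₂ (λ q w → q ≤ w + 1) (sym Q-all) (sym wt-all) (≤-pred (≤-trans (≰⇒> ¬h) (≤-reflexive (+-suc _ 1))))

  Violation : Sub → Set
  Violation S = Nonempty S × wt D k S + 2 ≤ suc D * Q μ S

  viol-resp : Respects≗ Violation
  viol-resp e ((v , p) , h) = (v , trans (sym (e v)) p) , subst₂ (λ w q → w + 2 ≤ suc D * q) (over-≗ _ e) (Q-≗ μ e) h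

  viol? : ∀ S → Dec (Violation S)
  viol? S = nonempty? S ×-dec (wt D k S + 2 ≤? suc D * Q μ S)

  nonempty-resp : Respects≗ Nonempty
  nonempty-resp e (v , p) = v , trans (sym (e v)) p

  -- Criticality colours `A` with full capacities. As `A` is least among all nonempty sets, the
  -- bound for `C` holds even if `C` is the whole outside, so no excepted edges are called for and
  -- `ex` is 0.
  minimal : ∀ A → Nonempty A → (∀ B → Nonempty B → wt D k A + suc D * Q μ B ≤ wt D k B + suc D * Q μ A) →
    Nonempty (all ∖ A) → Colourable all μ k
  minimal A (a , a∈A) min (b , b∈) = χ , combined (inj₁ (≤-trans (≤-reflexive (over-zero A λ _ → over-zero outside λ _ → refl)) z≤n))
    where
    colA : Colourable A μ k
    colA = fromDF D A (sub A (within A) (λ e p → ∧-trueˡ p , ∧-trueʳ {A (src e)} p) (inj₁ (b , ∖⁻ʳ all A b∈)))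
    open Contract σ ι k all A (λ _ → refl) a a∈A (proj₁ colA) (λ _ _ → 0) (λ _ _ → z≤n)
    open Admissible D (λ _ → ≤-refl) using () renaming (adm to contract-adm)
    part : ∀ C → C ⊆ outside → Nonempty C → suc D * (Q μ C + 2 * cross μ C A) ≤ wt D k C
    part C C⊆ (c , c∈) = superset-potential D σ k {A} {C} (λ p → out∉A (C⊆ p)) (min (C ∪ A) (c , ∪⁺ˡ C A c∈))
    colC : Colourable V′ ν l
    colC = weighted-theorem D 1≤D V′ ν l ν-sym ν-irr (l-cap (λ _ → ≤-refl))
      (contract-adm (λ C h ne → ≤-trans (part C h ne) (≤-trans (m≤m+n _ 1) (m≤m+n _ _))) (λ C h ne → ≤-trans (part C h ne) (m≤m+n _ _)))
    open Combine (IsCol-mono (λ _ _ → ≤-refl) (λ {u} _ → ≤-reflexive (sym (cong (suc D ∸_) (over-zero outside λ _ → refl)))) (proj₂ colA)) (proj₂ colC)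

  by-violation : Dec (∃ Violation) → Colourable all μ k
  by-violation (no ¬v) = weighted-theorem D 1≤D all μ k σ ι (λ _ → ≤-refl) λ S _ ne → ≤-pred (≤-trans (≰⇒> λ v → ¬v (S , ne , v)) (≤-reflexive (+-suc _ 1)))
  by-violation (yes (S , ne , v)) =
    let A , neA , min = min-potential D all μ k nonempty-resp nonempty? (λ _ _ → refl) S ne in proper A neA min (empty? (all ∖ A))
    where
    proper : ∀ A → Nonempty A → (∀ B → Nonempty B → wt D k A + suc D * Q μ B ≤ wt D k B + suc D * Q μ A) →
      Nonempty (all ∖ A) ⊎ (∀ u → u ∉ all ∖ A) → Colourable all μ k
    proper A neA min (inj₁ p) = minimal A neA min p
    -- If `A` were everything, its potential would be at most that of `S`, hence at most -2, against
    -- `adm-all`.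
    proper A neA min (inj₂ e) = ⊥-elim (1+n≰n (arith (wt D k A) (wt D k S) (suc D * Q μ A) (suc D * Q μ S) (wt D k all) (suc D * Q μ all)
      (min S ne) v adm-all (≤-reflexive (over-≗ _ A≗)) (≤-reflexive (cong (suc D *_) (sym (Q-≗ μ A≗))))))
      where
      A≗ : ∀ u → all u ≡ A u
      A≗ u with A u | e u
      ... | true | _ = refl
      arith : ∀ a s p q w r → a + q ≤ s + p → s + 2 ≤ q → r ≤ w + 1 → w ≤ a → p ≤ r → 2 ≤ 1
      arith a s p q w r h i j l o = lin 0 (h ⊕ i ⊕ j ⊕ l ⊕ o) (solve (a ∷ s ∷ p ∷ q ∷ w ∷ r ∷ []))
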